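{- Let $G$ and $H$ be cubic graphs on $n_G$ and $n_H$ vertices, respectively. Then $$\chi''_=(G \circ H) = \Delta(G\circ H) + 1 = n_H + 4.$$
   Context: All graphs are finite, simple, undirected. The corona $G\circ H$ is obtained by taking one copy of $G$ and $n_G=|V(G)|$ copies $H_1,\dots,H_{n_G}$ of $H$, and joining the $i$-th vertex of $G$ to every vertex of $H_i$. A $k$-total-coloring of a graph assigns one of $k$ colors to each vertex and each edge so that adjacent vertices, adjacent edges (sharing an endpoint), and a vertex and any edge incident to it all receive different colors. It is equitable if the sizes of any two color classes (counting both vertices and edges) differ by at most one. $\chi''_=(X)$ is the least $k$ such that $X$ has an equitable $k$-total-coloring, and $\Delta(X)$ is the maximum degree of $X$. -}

module Defs where

open import Data.Nat using (ℕ; zero; suc; _+_; _*_; _≤_; _<_; _⊔_)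
open import Data.Bool using (Bool; true; false; T; _∧_)
open import Data.Bool.Properties using (∧-comm)
open import Data.Fin using (Fin; splitAt; remQuot) renaming (_<_ to _<ᶠ_)
open import Data.Fin.Properties using (_≟_; _<?_)
open import Data.Sum using (_⊎_; inj₁; inj₂)
open import Data.Product using (_×_; _,_; proj₁; proj₂)
open import Data.List using (List; length; filterᵇ; map; foldr; concatMap)
open import Data.List.Base using (allFin)
open import Relation.Nullary using (¬_)
open import Relation.Nullary.Decidable using (⌊_⌋; does)
open import Relation.Binary.PropositionalEquality using (_≡_; _≢_; refl; sym; cong)

record Graph (n : ℕ) : Set where
  field
    adj    : Fin n → Fin n → Bool
    adj-sym : ∀ u v → adj u v ≡ adj v u
    adj-irr : ∀ u → adj u u ≡ false
open Graph public

degree : ∀ {n} → Graph n → Fin n → ℕ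
degree G v = length (filterᵇ (adj G v) (allFin _))

Δ : ∀ {n} → Graph n → ℕ
Δ G = foldr _⊔_ 0 (map (degree G) (allFin _))

Cubic : ∀ {n} → Graph n → Set
Cubic G = ∀ v → degree G v ≡ 3

_==_ : ∀ {n} → Fin n → Fin n → Bool
a == b = ⌊ a ≟ b ⌋

==-sym : ∀ {n} (a b : Fin n) → (a == b) ≡ (b == a)
==-sym a b with a ≟ b | b ≟ a
... | Relation.Nullary.yes _ | Relation.Nullary.yes _ = refl
... | Relation.Nullary.no _  | Relation.Nullary.no _  = refl
... | Relation.Nullary.yes p | Relation.Nullary.no q  = Data.Empty.⊥-elim (q (sym p))
  where import Data.Empty
... | Relation.Nullary.no p  | Relation.Nullary.yes q = Data.Empty.⊥-elim (p (sym q))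
  where import Data.Empty

-- Corona G ∘ H.  Vertex set Fin (nG + nG * nH): the first nG vertices
-- are the copy of G; vertex (i , x) of Fin (nG * nH) (via remQuot) is
-- vertex x of the i-th copy H_i of H.
coronaAdj : ∀ {nG nH} → Graph nG → Graph nH →
            Fin (nG + nG * nH) → Fin (nG + nG * nH) → Bool
coronaAdj {nG} {nH} G H u v with splitAt nG u | splitAt nG v
... | inj₁ a | inj₁ b = adj G a b
... | inj₁ a | inj₂ q = a == proj₁ (remQuot {nG} nH q)
... | inj₂ p | inj₁ b = proj₁ (remQuot {nG} nH p) == b
... | inj₂ p | inj₂ q = (proj₁ (remQuot {nG} nH p) == proj₁ (remQuot {nG} nH q))
                        ∧ adj H (proj₂ (remQuot {nG} nH p)) (proj₂ (remQuot {nG} nH q))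

corona : ∀ {nG nH} → Graph nG → Graph nH → Graph (nG + nG * nH)
corona {nG} {nH} G H = record
  { adj = coronaAdj G H ; adj-sym = s ; adj-irr = i }
  where
  s : ∀ u v → coronaAdj G H u v ≡ coronaAdj G H v u
  s u v with splitAt nG u | splitAt nG v
  ... | inj₁ a | inj₁ b = adj-sym G a b
  ... | inj₁ a | inj₂ q = ==-sym a _
  ... | inj₂ p | inj₁ b = ==-sym _ b
  ... | inj₂ p | inj₂ q
    rewrite ==-sym (proj₁ (remQuot {nG} nH p)) (proj₁ (remQuot {nG} nH q))
          | adj-sym H (proj₂ (remQuot {nG} nH p)) (proj₂ (remQuot {nG} nH q)) = refl
  i : ∀ u → coronaAdj G H u u ≡ false
  i u with splitAt nG u
  ... | inj₁ a = adj-irr G a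
  ... | inj₂ p rewrite adj-irr H (proj₂ (remQuot {nG} nH p)) = ∧-comm _ false

-- A k-total-coloring: a vertex coloring and an edge coloring (a function
-- on ordered pairs, required to be symmetric on edges, ignored on non-edges).
record TotalColoring {n} (X : Graph n) (k : ℕ) : Set where
  field
    vcol : Fin n → Fin k
    ecol : Fin n → Fin n → Fin k
    ecol-sym : ∀ u v → T (adj X u v) → ecol u v ≡ ecol v u
    vv : ∀ u v → T (adj X u v) → vcol u ≢ vcol v
    ee : ∀ u v w → T (adj X u v) → T (adj X u w) → v ≢ w → ecol u v ≢ ecol u w
    ve : ∀ u v → T (adj X u v) → vcol u ≢ ecol u v
open TotalColoring public

-- size of color class c: vertices of color c plus edges {u,v} (counted once,
-- as u < v) of color c
classSize : ∀ {n k} {X : Graph n} → TotalColoring X k → Fin k → ℕ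
classSize {n} {k} {X} φ c =
  length (filterᵇ (λ v → vcol φ v == c) (allFin n)) +
  length (filterᵇ (λ e → ⌊ proj₁ e <? proj₂ e ⌋ ∧ adj X (proj₁ e) (proj₂ e)
                            ∧ (ecol φ (proj₁ e) (proj₂ e) == c))
                  (concatMap (λ u → map (λ v → (u , v)) (allFin n)) (allFin n)))

Equitable : ∀ {n k} {X : Graph n} → TotalColoring X k → Set
Equitable {k = k} φ = ∀ (c d : Fin k) → classSize φ c ≤ classSize φ d + 1

HasEquitableTotalColoring : ∀ {n} → Graph n → ℕ → Set
HasEquitableTotalColoring X k =
  Data.Product.Σ (TotalColoring X k) Equitable
  where import Data.Product

EqTotalChromaticNumber : ∀ {n} → Graph n → ℕ → Set
EqTotalChromaticNumber X k =
  HasEquitableTotalColoring X k × (∀ j → HasEquitableTotalColoring X j → k ≤ j)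

{-# OPTIONS --safe #-}
module Submission where

-- Put n = |H|, N = |G|, k = n + 4.  A vertex of G has degree k - 1 in the corona, so it sees each
-- colour exactly once; hence the class of d has size N - e(d) + Σᵢ hᵢ(d), where e counts the edges of
-- G and hᵢ the elements of the i-th copy of H coloured d.  It suffices to colour the edges of G
-- equitably and then to add the copies one by one, each with class sizes differing by at most one and
-- its larger classes on the colours with the smaller load.
--
-- Equitable colourings come from a general local search in a conflict graph of degree D with q ≥ 2D
-- colours: an item leaves a big class for a class W, from which another item moves to a small class.
-- If this is impossible, counting conflicts gives qb + 2 ≤ 2Db, b being the least class size.
--
-- For n = 2h ≥ 8 a copy gets h colours with two vertices each and h + 4 colours for its edges, which
-- leaves room for the colour of the vertex of G; the spokes are found by exchanging two bad values.
-- For n = 4, 6 the graph is K₄, K₃₃ or the prism, and there is an explicit colouring for every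
-- distribution of the larger classes among centre, edges of G and spokes.

open import Defs
open import Data.Nat using (ℕ; zero; suc; _+_; _*_; _∸_; _≤_; _<_; z≤n; s≤s; s≤s⁻¹; _⊔_)
open import Data.Nat.Properties
open import Data.Nat.Induction using (<-wellFounded)
open import Induction.WellFounded using (Acc; acc)
open import Data.Bool using (Bool; true; false; T; T?; _∧_; not; if_then_else_)
open import Data.Fin using (Fin; zero; suc; splitAt; remQuot; combine; _↑ˡ_; _↑ʳ_; punchIn; toℕ)
import Data.Fin as Fin
import Data.Fin.Properties as Fin
open import Data.Sum using (_⊎_; inj₁; inj₂; [_,_]′)
import Data.Sum as Sum
open import Data.Product using (_×_; _,_; proj₁; proj₂; ∃; Σ; map₁; map₂)
open import Data.Empty using (⊥; ⊥-elim)
open import Data.Unit using (⊤; tt)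
open import Data.List using (List; []; _∷_; _++_; length; filterᵇ; map; concatMap; tabulate; allFin; foldr)
open import Relation.Nullary using (¬_; yes; no; Dec; contradiction)
open import Relation.Nullary.Decidable using (⌊_⌋; toWitness; fromWitness; dec-true; dec-false; _×-dec_; _→-dec_; ¬?; True)
open import Relation.Binary.PropositionalEquality
open import Function using (_∘_; id)
open import Algebra.Properties.Semiring.Sum +-*-semiring using (sum; sum-cong-≗; ∑-distrib-+; ∑-comm; *-distribˡ-sum; *-distribʳ-sum)
open import Data.Nat.Tactic.RingSolver using (solve-∀)
open import Data.Fin.Permutation.Components using (transpose; transpose-inverse)
open import Data.Vec using (Vec; []; _∷_; lookup)
import Data.Vec as Vec
open import Data.Vec.Properties using (lookup∘tabulate)
open import Data.Bool.Properties using (T-∧)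
open import Function.Bundles using (Equivalence)
import Data.Bool.Properties as Bool
open import Data.List.Relation.Unary.Any using (Any; any?; satisfied)
open import Data.List.Relation.Unary.All using (All; []; _∷_)
import Data.List.Relation.Unary.All as All
open import Data.Fin.Patterns
open import Data.Bool.ListAction using (all)

-- The obstacle is the lack of slack at a vertex of G: its colour, its three edges in G and its n
-- spokes use up all n + 4 colours. Once its own colour and those of its edges in G are fixed, the
-- set of spoke colours is forced, and only the distribution over the copy is free. That
-- distribution changes no class size, so properness is its only concern. The copies of H carry the
-- whole burden of balance, and for a copy that is equitable in itself a permutation of its colours
-- discharges it. What must survive an arbitrary permutation is a colour for the vertex of G that
-- avoids the vertex colours of the copy; keeping the vertex and edge colours of a copy disjoint
-- leaves only h of these to avoid. The exchange of spokes needs classes of at most h - 2 elements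
-- in a copy, which vertex classes of size two violate for h ≤ 3. This is why n = 4 and n = 6 stand
-- apart: there the colour of the vertex of G is chosen in advance and the copy is adapted to it.

private variable
  m n k : ℕ

-- Finite sums of indicators and pigeonhole principles

⟦_⟧ : Bool → ℕ
⟦ true ⟧ = 1
⟦ false ⟧ = 0

δ : Fin n → Fin n → ℕ
δ a b = ⟦ a == b ⟧

⟦⟧≤1 : ∀ b → ⟦ b ⟧ ≤ 1
⟦⟧≤1 true = ≤-refl
⟦⟧≤1 false = z≤n

⟦∧⟧ : ∀ a b → ⟦ a ∧ b ⟧ ≡ ⟦ a ⟧ * ⟦ b ⟧
⟦∧⟧ true b = sym (+-identityʳ _)
⟦∧⟧ false b = refl

T⇒⟦⟧ : ∀ {b} → T b → ⟦ b ⟧ ≡ 1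
T⇒⟦⟧ {true} _ = refl

δ-refl : (a : Fin n) → δ a a ≡ 1
δ-refl a with a Fin.≟ a
... | yes _ = refl
... | no a≢a = contradiction refl a≢a

δ-≢ : {a b : Fin n} → a ≢ b → δ a b ≡ 0
δ-≢ {a = a} {b} a≢b with a Fin.≟ b
... | yes a≡b = contradiction a≡b a≢b
... | no _ = refl

δ-sym : (a b : Fin n) → δ a b ≡ δ b a
δ-sym a b = cong ⟦_⟧ (==-sym a b)

δ≤1 : (a b : Fin n) → δ a b ≤ 1
δ≤1 a b = ⟦⟧≤1 (a == b)

δ-pos : {a b : Fin n} → 1 ≤ δ a b → a ≡ b
δ-pos {a = a} {b} p with a Fin.≟ b
... | yes a≡b = a≡b

δ-inj : (f : Fin m → Fin n) → (∀ {a b} → f a ≡ f b → a ≡ b) → ∀ a b → δ (f a) (f b) ≡ δ a b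
δ-inj f inj a b with a Fin.≟ b
... | yes refl = δ-refl (f a)
... | no a≢b = δ-≢ (a≢b ∘ inj)

sum-mono : {f g : Fin n → ℕ} → (∀ i → f i ≤ g i) → sum f ≤ sum g
sum-mono {zero} le = z≤n
sum-mono {suc n} le = +-mono-≤ (le zero) (sum-mono (le ∘ suc))

-- A slack of `d` at a single index survives in the sum. The counting arguments below draw their
-- strictness from one such index.
sum-mono-gap : {f g : Fin n → ℕ} {d : ℕ} → (∀ i → f i ≤ g i) → ∀ i → f i + d ≤ g i → sum f + d ≤ sum g
sum-mono-gap {suc n} {f} {g} {d} le zero lt = begin
  f zero + sum (f ∘ suc) + d   ≡⟨ solve₁ (f zero) (sum (f ∘ suc)) d ⟩
  f zero + d + sum (f ∘ suc)   ≤⟨ +-mono-≤ lt (sum-mono (le ∘ suc)) ⟩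
  g zero + sum (g ∘ suc)       ∎
  where
  open ≤-Reasoning
  solve₁ : ∀ a b d → a + b + d ≡ a + d + b
  solve₁ = solve-∀
sum-mono-gap {suc n} {f} {g} {d} le (suc i) lt = begin
  f zero + sum (f ∘ suc) + d   ≡⟨ +-assoc (f zero) _ d ⟩
  f zero + (sum (f ∘ suc) + d) ≤⟨ +-mono-≤ (le zero) (sum-mono-gap (le ∘ suc) i lt) ⟩
  g zero + sum (g ∘ suc)       ∎
  where open ≤-Reasoning

sum-const : ∀ n x → sum {n} (λ _ → x) ≡ n * x
sum-const zero x = refl
sum-const (suc n) x = cong (x +_) (sum-const n x)

sum-zero : sum {n} (λ _ → 0) ≡ 0
sum-zero {n} = trans (sum-const n 0) (*-zeroʳ n)

term≤sum : (f : Fin n → ℕ) → ∀ i → f i ≤ sum f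
term≤sum f zero = m≤m+n _ _
term≤sum f (suc i) = ≤-trans (term≤sum (f ∘ suc) i) (m≤n+m _ (f zero))

sum-δ : (i : Fin n) (f : Fin n → ℕ) → sum (λ j → δ i j * f j) ≡ f i
sum-δ {suc n} zero f = begin
  (f zero + 0) + sum (λ j → δ zero (suc j) * f (suc j)) ≡⟨ cong ((f zero + 0) +_) (sum-zero {n}) ⟩
  (f zero + 0) + 0 ≡⟨ trans (+-identityʳ _) (+-identityʳ _) ⟩
  f zero ∎
  where open ≡-Reasoning
sum-δ {suc n} (suc i) f = begin
  sum (λ j → δ (suc i) (suc j) * f (suc j)) ≡⟨ sum-cong-≗ (λ j → cong (_* f (suc j)) (δ-inj suc Fin.suc-injective i j)) ⟩
  sum (λ j → δ i j * f (suc j)) ≡⟨ sum-δ i (f ∘ suc) ⟩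
  f (suc i) ∎
  where open ≡-Reasoning

sum-δ₁ : (i : Fin n) → sum (δ i) ≡ 1
sum-δ₁ i = trans (sum-cong-≗ (λ j → sym (*-identityʳ (δ i j)))) (sum-δ i (λ _ → 1))

positive-term : (f : Fin n → ℕ) → 1 ≤ sum f → ∃ λ i → 1 ≤ f i
positive-term {suc n} f p with f zero in eq
... | suc x = zero , subst (1 ≤_) (sym eq) (s≤s z≤n)
... | zero = let i , q = positive-term (f ∘ suc) p in suc i , q

-- Pigeonhole: if no term vanished, the sum would be at least `n`. With `f` counting obstacles per
-- colour, this is how free colours are found.
zero-term : (f : Fin n → ℕ) → sum f < n → ∃ λ i → f i ≡ 0
zero-term {suc n} f lt with f zero in eq
... | zero = zero , eq
... | suc x = let i , q = zero-term (f ∘ suc) (≤-trans (s≤s (m≤n+m _ x)) (s≤s⁻¹ lt)) in suc i , q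

sum≡0⇒term≡0 : (f : Fin n → ℕ) → sum f ≡ 0 → ∀ i → f i ≡ 0
sum≡0⇒term≡0 f s≡0 i = n≤0⇒n≡0 (subst (f i ≤_) s≡0 (term≤sum f i))

sum≤size : (f : Fin n → ℕ) → (∀ i → f i ≤ 1) → sum f ≤ n
sum≤size {n} f le = subst (sum f ≤_) (trans (sum-const n 1) (*-identityʳ n)) (sum-mono le)

-- A vanishing term would cap the sum at `n - 1`. It turns "at most once" into "exactly once" when
-- the total is known.
full-sum : (f : Fin n → ℕ) → (∀ i → f i ≤ 1) → n ≤ sum f → ∀ i → f i ≡ 1
full-sum {n} f le ge i with f i in eq
... | suc zero = refl
... | suc (suc x) = contradiction (subst (_≤ 1) eq (le i)) λ { (s≤s ()) }
... | zero = contradiction ge (<⇒≱ (subst₂ _≤_ (+-comm _ 1) (trans (sum-const n 1) (*-identityʳ n))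
               (sum-mono-gap le i (subst (λ z → z + 1 ≤ 1) (sym eq) ≤-refl))))

sum≤1 : (f : Fin n → ℕ) → (∀ i → f i ≤ 1) → (∀ i j → 1 ≤ f i → 1 ≤ f j → i ≡ j) → sum f ≤ 1
sum≤1 {zero} f le uniq = z≤n
sum≤1 {suc n} f le uniq with f zero in eq
... | zero = sum≤1 (f ∘ suc) (le ∘ suc) (λ i j p q → Fin.suc-injective (uniq (suc i) (suc j) p q))
... | suc x = subst (λ z → suc x + z ≤ 1) (sym rest≡0)
                (subst (_≤ 1) (trans eq (sym (+-identityʳ (suc x)))) (le zero))
  where
  rest≡0 : sum (f ∘ suc) ≡ 0
  rest≡0 with sum (f ∘ suc) in eq′
  ... | zero = refl
  ... | suc y with positive-term (f ∘ suc) (subst (1 ≤_) (sym eq′) (s≤s z≤n))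
  ...   | j , p with uniq zero (suc j) (subst (1 ≤_) (sym eq) (s≤s z≤n)) p
  ...     | ()

sum-splitAt : ∀ m {n} (f : Fin m ⊎ Fin n → ℕ) →
  sum (λ u → f (splitAt m u)) ≡ sum (λ a → f (inj₁ a)) + sum (λ b → f (inj₂ b))
sum-splitAt zero f = refl
sum-splitAt (suc m) f = begin
  f (inj₁ zero) + sum (λ u → f (Sum.map suc id (splitAt m u))) ≡⟨ cong (f (inj₁ zero) +_) (sum-splitAt m (f ∘ Sum.map suc id)) ⟩
  f (inj₁ zero) + (sum (λ a → f (inj₁ (suc a))) + _)           ≡⟨ +-assoc (f (inj₁ zero)) _ _ ⟨
  _ ∎
  where open ≡-Reasoning

sum-remQuot : ∀ m n (f : Fin m × Fin n → ℕ) →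
  sum (λ p → f (remQuot {m} n p)) ≡ sum (λ i → sum (λ x → f (i , x)))
sum-remQuot zero n f = refl
sum-remQuot (suc m) n f = begin
  sum (λ p → f (remQuot {suc m} n p))
    ≡⟨ sum-cong-≗ (λ p → remQuot-suc p) ⟩
  sum (λ p → g (splitAt n p))
    ≡⟨ sum-splitAt n g ⟩
  sum (λ x → f (zero , x)) + sum (λ p → f (map₁ suc (remQuot {m} n p)))
    ≡⟨ cong (sum (λ x → f (zero , x)) +_) (sum-remQuot m n (f ∘ map₁ suc)) ⟩
  _ ∎
  where
  open ≡-Reasoning
  g : Fin n ⊎ Fin (m * n) → ℕ
  g (inj₁ x) = f (zero , x)
  g (inj₂ p) = f (map₁ suc (remQuot {m} n p))
  remQuot-suc : ∀ p → f (remQuot {suc m} n p) ≡ g (splitAt n p)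
  remQuot-suc p with splitAt n p
  ... | inj₁ x = refl
  ... | inj₂ q = refl

count-tabulate : {A : Set} (p : A → Bool) (f : Fin n → A) →
  length (filterᵇ p (tabulate f)) ≡ sum (λ i → ⟦ p (f i) ⟧)
count-tabulate {zero} p f = refl
count-tabulate {suc n} p f with p (f zero)
... | true = cong suc (count-tabulate p (f ∘ suc))
... | false = count-tabulate p (f ∘ suc)

count-allFin : (p : Fin n → Bool) → length (filterᵇ p (allFin n)) ≡ sum (λ i → ⟦ p i ⟧)
count-allFin p = count-tabulate p id

count-++ : {A : Set} (p : A → Bool) (xs ys : List A) →
  length (filterᵇ p (xs ++ ys)) ≡ length (filterᵇ p xs) + length (filterᵇ p ys)
count-++ p [] ys = refl
count-++ p (x ∷ xs) ys with p x
... | true = cong suc (count-++ p xs ys)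
... | false = count-++ p xs ys

count-map : {A B : Set} (p : B → Bool) (f : A → B) (xs : List A) →
  length (filterᵇ p (map f xs)) ≡ length (filterᵇ (p ∘ f) xs)
count-map p f [] = refl
count-map p f (x ∷ xs) with p (f x)
... | true = cong suc (count-map p f xs)
... | false = count-map p f xs

-- Stated for `tabulate f` because the tail of `allFin` is again a tabulation, but not an `allFin`.
count-pairs : (p : Fin m × Fin n → Bool) (f : Fin k → Fin m) →
  length (filterᵇ p (concatMap (λ u → map (u ,_) (allFin n)) (tabulate f))) ≡
  sum (λ i → sum (λ v → ⟦ p (f i , v) ⟧))
count-pairs {k = zero} p f = refl
count-pairs {n = n} {k = suc k} p f = begin
  length (filterᵇ p (map (f zero ,_) (allFin n) ++ concatMap (λ u → map (u ,_) (allFin n)) (tabulate (f ∘ suc))))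
    ≡⟨ count-++ p (map (f zero ,_) (allFin n)) _ ⟩
  length (filterᵇ p (map (f zero ,_) (allFin n))) + _
    ≡⟨ cong₂ _+_ (trans (count-map p (f zero ,_) (allFin n)) (count-allFin {n} (λ v → p (f zero , v)))) (count-pairs p (f ∘ suc)) ⟩
  _ ∎
  where open ≡-Reasoning

descent : {A : Set} (μ : A → ℕ) {P : A → Set} → (∀ a → P a ⊎ ∃ λ b → μ b < μ a) → A → ∃ P
descent {A} μ {P} step a = go a (<-wellFounded (μ a))
  where
  go : ∀ a → Acc _<_ (μ a) → ∃ P
  go a (acc rs) with step a
  ... | inj₁ p = a , p
  ... | inj₂ (b , lt) = go b (rs lt)

-- Injective maps of finite sets

-- Each value is hit at most once, and `n` hits are spread over `n` values, so `full-sum` applies.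
-- Surjectivity of injective maps follows.
hits-once : (g : Fin n → Fin n) → (∀ {a b} → g a ≡ g b → a ≡ b) → ∀ c → sum (λ x → δ (g x) c) ≡ 1
hits-once {n} g inj = full-sum _ at-most (≤-reflexive (sym total))
  where
  at-most : ∀ c → sum (λ x → δ (g x) c) ≤ 1
  at-most c = sum≤1 _ (λ x → δ≤1 (g x) c) (λ i j p q → inj (trans (δ-pos p) (sym (δ-pos q))))
  total : sum (λ c → sum (λ x → δ (g x) c)) ≡ n
  total = begin
    sum (λ c → sum (λ x → δ (g x) c)) ≡⟨ ∑-comm (λ c x → δ (g x) c) ⟩
    sum (λ x → sum (δ (g x)))         ≡⟨ sum-cong-≗ (λ x → sum-δ₁ (g x)) ⟩
    sum {n} (λ _ → 1)                 ≡⟨ trans (sum-const n 1) (*-identityʳ n) ⟩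
    n ∎
    where open ≡-Reasoning

sum-reindex : (g : Fin n → Fin n) → (∀ {a b} → g a ≡ g b → a ≡ b) → ∀ f → sum (f ∘ g) ≡ sum f
sum-reindex {n} g inj f = begin
  sum (f ∘ g)                                   ≡⟨ sum-cong-≗ (λ x → sym (sum-δ (g x) f)) ⟩
  sum (λ x → sum (λ y → δ (g x) y * f y))       ≡⟨ ∑-comm (λ x y → δ (g x) y * f y) ⟩
  sum (λ y → sum (λ x → δ (g x) y * f y))       ≡⟨ sum-cong-≗ (λ y → sym (*-distribʳ-sum (f y) (λ x → δ (g x) y))) ⟩
  sum (λ y → sum (λ x → δ (g x) y) * f y)       ≡⟨ sum-cong-≗ (λ y → trans (cong (_* f y) (hits-once g inj y)) (*-identityˡ (f y))) ⟩
  sum f ∎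
  where open ≡-Reasoning

injective⇒inverse : (g : Fin n → Fin n) → (∀ {a b} → g a ≡ g b → a ≡ b) →
  ∃ λ (g⁻¹ : Fin n → Fin n) → (∀ c → g (g⁻¹ c) ≡ c) × (∀ x → g⁻¹ (g x) ≡ x)
injective⇒inverse g inj = proj₁ ∘ pre , (λ c → proj₂ (pre c)) , λ x → inj (proj₂ (pre (g x)))
  where
  pre : ∀ c → ∃ λ x → g x ≡ c
  pre c = map₂ δ-pos (positive-term _ (≤-reflexive (sym (hits-once g inj c))))

enumerate : (P : Fin k → ℕ) → (∀ c → P c ≤ 1) → ∀ n → n ≤ sum P →
  ∃ λ (s : Fin n → Fin k) → (∀ {x y} → s x ≡ s y → x ≡ y) × (∀ x → P (s x) ≡ 1)
enumerate P le zero _ = (λ ()) , (λ { {()} }) , λ ()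
enumerate {suc k} P le (suc n) ge with P zero in eq
... | zero = let s , inj , good = enumerate (P ∘ suc) (le ∘ suc) (suc n) ge in
  suc ∘ s , (λ e → inj (Fin.suc-injective e)) , good
... | suc zero = let s , inj , good = enumerate (P ∘ suc) (le ∘ suc) n (s≤s⁻¹ ge) in
  (λ { zero → zero ; (suc x) → suc (s x) }) ,
  (λ { {zero} {zero} _ → refl ; {suc x} {suc y} e → cong suc (inj (Fin.suc-injective e)) }) ,
  (λ { zero → eq ; (suc x) → good x })
... | suc (suc x) = contradiction (subst (_≤ 1) eq (le zero)) λ { (s≤s ()) }

-- Local search for equitable colourings of a conflict graph

Balanced : (Fin k → ℕ) → Set
Balanced s = ∀ c d → s c ≤ s d + 1

least : (s : Fin (suc n) → ℕ) → ∃ λ i → ∀ j → s i ≤ s j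
least {zero} s = zero , λ { zero → ≤-refl }
least {suc n} s with least (s ∘ suc)
... | i , i-least with ≤-total (s zero) (s (suc i))
...   | inj₁ le = zero , λ { zero → ≤-refl ; (suc j) → ≤-trans le (i-least j) }
...   | inj₂ ge = suc i , λ { zero → ge ; (suc j) → i-least j }

balanced-or-gap : (s : Fin (suc n) → ℕ) →
  Balanced s ⊎ ∃ λ α → ∃ λ β → (∀ c → s β ≤ s c) × s β + 2 ≤ s α
balanced-or-gap s with least s
... | β , β-least with Fin.all? (λ α → s α ≤? s β + 1)
...   | yes le = inj₁ λ c d → ≤-trans (le c) (+-monoˡ-≤ 1 (β-least d))
...   | no ¬le with Fin.¬∀⟶∃¬ _ _ (λ α → s α ≤? s β + 1) ¬le
...     | α , α≰ = inj₂ (α , β , β-least , subst (_≤ s α) (sym (+-suc (s β) 1)) (≰⇒> α≰))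

_[_≔_] : {A : Set} → (Fin m → A) → Fin m → A → Fin m → A
(f [ x ≔ c ]) i = if i == x then c else f i

set-same : {A : Set} (f : Fin m → A) (x : Fin m) (c : A) → (f [ x ≔ c ]) x ≡ c
set-same f x c with x Fin.≟ x
... | yes _ = refl
... | no x≢x = contradiction refl x≢x

set-other : {A : Set} (f : Fin m → A) {x i : Fin m} (c : A) → i ≢ x → (f [ x ≔ c ]) i ≡ f i
set-other f {x} {i} c i≢x with i Fin.≟ x
... | yes i≡x = contradiction i≡x i≢x
... | no _ = refl

-- With `w` an indicator this is the size of class `c`; with `w` a row of a conflict matrix it
-- counts the conflicts that an item would meet in colour `c`.
weight : (Fin m → ℕ) → (Fin m → Fin k) → Fin k → ℕ
weight w f c = sum (λ i → w i * δ (f i) c)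

sum-weight : (w : Fin m → ℕ) (f : Fin m → Fin k) → sum (weight w f) ≡ sum w
sum-weight w f = begin
  sum (λ c → sum (λ i → w i * δ (f i) c)) ≡⟨ ∑-comm (λ c i → w i * δ (f i) c) ⟩
  sum (λ i → sum (λ c → w i * δ (f i) c)) ≡⟨ sum-cong-≗ (λ i → *-distribˡ-sum (w i) (δ (f i))) ⟨
  sum (λ i → w i * sum (δ (f i)))         ≡⟨ sum-cong-≗ (λ i → trans (cong (w i *_) (sum-δ₁ (f i))) (*-identityʳ (w i))) ⟩
  sum w ∎
  where open ≡-Reasoning

-- The lost term is added on the left and the gained one on the right, so that the change is
-- expressed without subtraction.
weight-set : (w : Fin m → ℕ) (f : Fin m → Fin k) (x : Fin m) (c d : Fin k) →
  weight w (f [ x ≔ c ]) d + w x * δ (f x) d ≡ weight w f d + w x * δ c d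
weight-set {m} w f x c d = begin
  weight w f′ d + w x * δ (f x) d
    ≡⟨ cong (weight w f′ d +_) (sum-δ x (λ i → w i * δ (f i) d)) ⟨
  weight w f′ d + sum (λ i → δ x i * (w i * δ (f i) d))
    ≡⟨ ∑-distrib-+ (λ i → w i * δ (f′ i) d) (λ i → δ x i * (w i * δ (f i) d)) ⟨
  sum (λ i → w i * δ (f′ i) d + δ x i * (w i * δ (f i) d))
    ≡⟨ sum-cong-≗ pointwise ⟩
  sum (λ i → w i * δ (f i) d + δ x i * (w i * δ c d))
    ≡⟨ ∑-distrib-+ (λ i → w i * δ (f i) d) (λ i → δ x i * (w i * δ c d)) ⟩
  weight w f d + sum (λ i → δ x i * (w i * δ c d))
    ≡⟨ cong (weight w f d +_) (sum-δ x (λ i → w i * δ c d)) ⟩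
  weight w f d + w x * δ c d ∎
  where
  open ≡-Reasoning
  f′ = f [ x ≔ c ]
  pointwise : ∀ i → w i * δ (f′ i) d + δ x i * (w i * δ (f i) d) ≡ w i * δ (f i) d + δ x i * (w i * δ c d)
  pointwise i = go (i Fin.≟ x)
    where
    go : Dec (i ≡ x) → w i * δ (f′ i) d + δ x i * (w i * δ (f i) d) ≡ w i * δ (f i) d + δ x i * (w i * δ c d)
    go (yes refl) rewrite set-same f i c | δ-refl i =
      trans (cong (w i * δ c d +_) (*-identityˡ _)) (trans (+-comm (w i * δ c d) _) (cong (w i * δ (f i) d +_) (sym (*-identityˡ _))))
    go (no i≢x) rewrite set-other f c i≢x | δ-≢ (i≢x ∘ sym) = refl

-- Moving one unit from `α` to `β` changes the sum of squares by `2 (s β - s α) + 2`, which the gap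
-- makes at most -2. This sum is the measure that lets the local search terminate.
squares-decrease : (s s′ : Fin k → ℕ) (α β : Fin k) → s β + 2 ≤ s α →
  (∀ c → s′ c + δ α c ≡ s c + δ β c) → sum (λ c → s′ c * s′ c) < sum (λ c → s c * s c)
squares-decrease s s′ α β gap move = +-cancelʳ-≤ (s α + s α) _ _ (begin
  suc Φ′ + (s α + s α)                 ≡⟨⟩
  suc (Φ′ + (s α + s α))               ≡⟨ cong suc total ⟩
  suc (Φ + (s β + s β) + 2)            ≤⟨ n≤1+n _ ⟩
  2 + (Φ + (s β + s β) + 2)            ≡⟨ rearrange Φ (s β) ⟩
  Φ + ((s β + 2) + (s β + 2))          ≤⟨ +-monoʳ-≤ Φ (+-mono-≤ gap gap) ⟩
  Φ + (s α + s α)                      ∎)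
  where
  open ≤-Reasoning
  Φ′ = sum (λ c → s′ c * s′ c)
  Φ = sum (λ c → s c * s c)
  rearrange : ∀ Φ b → 2 + (Φ + (b + b) + 2) ≡ Φ + ((b + 2) + (b + 2))
  rearrange = solve-∀
  α≢β : α ≢ β
  α≢β refl = <⇒≱ (m<m+n (s β) (s≤s z≤n)) gap
  at-α : ∀ p q → p + 1 ≡ q + 0 → p * p + 1 * (q + q) ≡ q * q + (0 * (q + q) + (1 + 0))
  at-α p q eq = subst (λ z → p * p + 1 * (z + z) ≡ z * z + (0 * (z + z) + (1 + 0))) (trans eq (+-identityʳ q)) (ring₁ p)
    where
    ring₁ : ∀ p → p * p + 1 * ((p + 1) + (p + 1)) ≡ (p + 1) * (p + 1) + (0 * ((p + 1) + (p + 1)) + (1 + 0))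
    ring₁ = solve-∀
  at-β : ∀ p q → p + 0 ≡ q + 1 → p * p + 0 * (q + q) ≡ q * q + (1 * (q + q) + (0 + 1))
  at-β p q eq = subst (λ z → z * z + 0 * (q + q) ≡ q * q + (1 * (q + q) + (0 + 1))) (trans (sym eq) (+-identityʳ p)) (ring₂ q)
    where
    ring₂ : ∀ q → (q + 1) * (q + 1) + 0 * (q + q) ≡ q * q + (1 * (q + q) + (0 + 1))
    ring₂ = solve-∀
  pointwise : ∀ c → s′ c * s′ c + δ α c * (s c + s c) ≡ s c * s c + (δ β c * (s c + s c) + (δ α c + δ β c))
  pointwise c with move c
  ... | eq with α Fin.≟ c | β Fin.≟ c
  ...   | yes refl | yes refl = contradiction refl α≢β
  ...   | yes refl | no _ = at-α (s′ c) (s c) eq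
  ...   | no _ | yes refl = at-β (s′ c) (s c) eq
  ...   | no _ | no _ = cong (_+ 0) (cong (λ z → z * z) (trans (sym (+-identityʳ _)) (trans eq (+-identityʳ _))))
  total : Φ′ + (s α + s α) ≡ Φ + (s β + s β) + 2
  total = begin-equality
    Φ′ + (s α + s α)
      ≡⟨ cong (Φ′ +_) (sum-δ α (λ c → s c + s c)) ⟨
    Φ′ + sum (λ c → δ α c * (s c + s c))
      ≡⟨ ∑-distrib-+ (λ c → s′ c * s′ c) (λ c → δ α c * (s c + s c)) ⟨
    sum (λ c → s′ c * s′ c + δ α c * (s c + s c))
      ≡⟨ sum-cong-≗ pointwise ⟩
    sum (λ c → s c * s c + (δ β c * (s c + s c) + (δ α c + δ β c)))
      ≡⟨ ∑-distrib-+ (λ c → s c * s c) (λ c → δ β c * (s c + s c) + (δ α c + δ β c)) ⟩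
    Φ + sum (λ c → δ β c * (s c + s c) + (δ α c + δ β c))
      ≡⟨ cong (Φ +_) (∑-distrib-+ (λ c → δ β c * (s c + s c)) (λ c → δ α c + δ β c)) ⟩
    Φ + (sum (λ c → δ β c * (s c + s c)) + sum (λ c → δ α c + δ β c))
      ≡⟨ cong (Φ +_) (cong₂ _+_ (sum-δ β (λ c → s c + s c))
           (trans (∑-distrib-+ (δ α) (δ β)) (cong₂ _+_ (sum-δ₁ α) (sum-δ₁ β)))) ⟩
    Φ + ((s β + s β) + 2)
      ≡⟨ +-assoc Φ _ 2 ⟨
    Φ + (s β + s β) + 2 ∎

Proper : (Fin m → Fin m → ℕ) → (Fin m → Fin k) → Set
Proper conf f = ∀ i j → 1 ≤ conf i j → f i ≢ f j

-- The conflicts of the new item have total weight at most `D < k`, so some colour carries none of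
-- them.
greedy-coloring : ∀ {m} (conf : Fin m → Fin m → ℕ) {D} → (∀ i j → conf i j ≡ conf j i) →
  (∀ i → conf i i ≡ 0) → (∀ i → sum (conf i) ≤ D) → D < k → ∃ λ (f : Fin m → Fin k) → Proper conf f
greedy-coloring {m = zero} conf cs ci deg D<k = (λ ()) , λ ()
greedy-coloring {k} {m = suc m} conf {D} cs ci deg D<k
  with greedy-coloring (λ i j → conf (suc i) (suc j)) (λ i j → cs (suc i) (suc j)) (ci ∘ suc)
         (λ i → ≤-trans (m≤n+m _ (conf (suc i) zero)) (deg (suc i))) D<k
... | f , prop with zero-term (weight (conf zero ∘ suc) f)
                      (≤-<-trans (≤-trans (≤-reflexive (sum-weight (conf zero ∘ suc) f))
                                          (≤-trans (m≤n+m _ (conf zero zero)) (deg zero))) D<k)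
...   | c , free = g , g-prop
  where
  g : Fin (suc m) → Fin k
  g zero = c
  g (suc i) = f i
  c≢ : ∀ j → 1 ≤ conf zero (suc j) → c ≢ f j
  c≢ j p c≡ = <⇒≢ (*-mono-≤ p (≤-reflexive (sym (trans (cong (δ (f j)) c≡) (δ-refl (f j))))))
                 (sym (sum≡0⇒term≡0 _ free j))
  g-prop : Proper conf g
  g-prop zero zero p = contradiction (subst (1 ≤_) (ci zero) p) λ ()
  g-prop zero (suc j) p = c≢ j p
  g-prop (suc i) zero p = c≢ i (subst (1 ≤_) (cs (suc i) zero) p) ∘ sym
  g-prop (suc i) (suc j) p = prop i j p

set-proper : (conf : Fin m → Fin m → ℕ) → (∀ i j → conf i j ≡ conf j i) → (∀ i → conf i i ≡ 0) →
  (f : Fin m → Fin k) → Proper conf f → ∀ x c → weight (conf x) f c ≡ 0 → Proper conf (f [ x ≔ c ])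
set-proper conf cs ci f prop x c free i j p = go (i Fin.≟ x) (j Fin.≟ x)
  where
  c≢ : ∀ j → 1 ≤ conf x j → c ≢ f j
  c≢ j p c≡ = <⇒≢ (*-mono-≤ p (≤-reflexive (sym (trans (cong (δ (f j)) c≡) (δ-refl (f j))))))
                 (sym (sum≡0⇒term≡0 _ free j))
  go : Dec (i ≡ x) → Dec (j ≡ x) → (f [ x ≔ c ]) i ≢ (f [ x ≔ c ]) j
  go (yes refl) (yes refl) = contradiction (subst (1 ≤_) (ci i) p) λ ()
  go (yes refl) (no j≢) rewrite set-same f i c | set-other f c j≢ = c≢ j p
  go (no i≢) (yes refl) rewrite set-same f j c | set-other f c i≢ = c≢ i (subst (1 ≤_) (cs i j) p) ∘ sym
  go (no i≢) (no j≢) rewrite set-other f c i≢ | set-other f c j≢ = prop i j p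

-- Only the items with act i ≡ 1 are counted in colour classes; conf-deg makes the others conflict-free.
record Conflicts (m D : ℕ) : Set where
  field
    act : Fin m → ℕ
    conf : Fin m → Fin m → ℕ
    act≤1 : ∀ i → act i ≤ 1
    conf-sym : ∀ i j → conf i j ≡ conf j i
    conf-irr : ∀ i → conf i i ≡ 0
    conf-deg : ∀ i → sum (conf i) ≤ D * act i

module Equitabilise {m D q : ℕ} (C : Conflicts m D) where
  open Conflicts C

  size : (Fin m → Fin (suc q)) → Fin (suc q) → ℕ
  size = weight act

  N : (Fin m → Fin (suc q)) → Fin m → Fin (suc q) → ℕ
  N f i = weight (conf i) f

  -- y can leave the big class α neither directly for the small class β, nor for
  -- the class of some x which in turn moves to β.
  record Stuck (f : Fin m → Fin (suc q)) (α β : Fin (suc q)) (y : Fin m) : Set where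
    field
      proper : Proper conf f
      β-least : ∀ c → size f β ≤ size f c
      gap : size f β + 2 ≤ size f α
      y-act : act y ≡ 1
      y∈α : f y ≡ α
      no-move : ∀ i → 1 ≤ act i → f i ≡ α → 1 ≤ N f i β
      no-double-move : ∀ x → 1 ≤ act x → f x ≢ α → f x ≢ β → N f x β ≡ 0 → 1 ≤ N (f [ x ≔ β ]) y (f x)

  0<act⇒≡1 : ∀ {i} → 1 ≤ act i → act i ≡ 1
  0<act⇒≡1 p = ≤-antisym (act≤1 _) p

  -- The item `y` of class `α` is fixed in advance, and only this item may replace `x` in a double
  -- move. That is enough, because the count against a stuck colouring uses the at most `D`
  -- conflicts of a single `y`.
  improve : ∀ f → Proper conf f →
    (∃ λ α → ∃ λ β → ∃ λ y → Stuck f α β y) ⊎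
    Balanced (size f) ⊎
    (∃ λ f′ → Proper conf f′ × sum (λ c → size f′ c * size f′ c) < sum (λ c → size f c * size f c))
  improve f prop with balanced-or-gap (size f)
  ... | inj₁ bal = inj₂ (inj₁ bal)
  ... | inj₂ (α , β , β-least , gap)
    with positive-term _ (≤-trans (≤-trans (s≤s z≤n) (m≤n+m 2 (size f β))) gap)
  ...   | y , y-pos = search
    where
    act×col : ∀ {i c} → 1 ≤ act i * δ (f i) c → act i ≡ 1 × f i ≡ c
    act×col {i} {c} p with act i in eq | δ (f i) c in eq′
    ... | zero | _ = contradiction p λ ()
    ... | suc a | zero = contradiction (subst (1 ≤_) (*-zeroʳ (suc a)) p) λ ()
    ... | suc a | suc b = trans (sym eq) (0<act⇒≡1 (subst (1 ≤_) (sym eq) (s≤s z≤n))) , δ-pos (subst (1 ≤_) (sym eq′) (s≤s z≤n))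

    y-act = proj₁ (act×col y-pos)
    y∈α = proj₂ (act×col {y} y-pos)

    Move : Fin m → Set
    Move i = 1 ≤ act i × f i ≡ α × N f i β ≡ 0

    move? : ∀ i → Dec (Move i)
    move? i = (1 ≤? act i) ×-dec ((f i Fin.≟ α) ×-dec (N f i β ≟ 0))

    Double : Fin m → Set
    Double x = 1 ≤ act x × f x ≢ α × f x ≢ β × N f x β ≡ 0 × N (f [ x ≔ β ]) y (f x) ≡ 0

    double? : ∀ x → Dec (Double x)
    double? x = (1 ≤? act x) ×-dec (¬? (f x Fin.≟ α) ×-dec (¬? (f x Fin.≟ β) ×-dec
                  ((N f x β ≟ 0) ×-dec (N (f [ x ≔ β ]) y (f x) ≟ 0))))

    size-set : ∀ g {x} → act x ≡ 1 → ∀ c d → size (g [ x ≔ c ]) d + δ (g x) d ≡ size g d + δ c d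
    size-set g {x} x-act c d = begin
      size (g [ x ≔ c ]) d + δ (g x) d           ≡⟨ cong (size (g [ x ≔ c ]) d +_) (unit (δ (g x) d)) ⟩
      size (g [ x ≔ c ]) d + act x * δ (g x) d   ≡⟨ weight-set act g x c d ⟩
      size g d + act x * δ c d                   ≡⟨ cong (size g d +_) (unit (δ c d)) ⟨
      size g d + δ c d                           ∎
      where
      open ≡-Reasoning
      unit : ∀ z → z ≡ act x * z
      unit z = trans (sym (*-identityˡ z)) (cong (_* z) (sym x-act))

    search : (∃ λ α → ∃ λ β → ∃ λ y → Stuck f α β y) ⊎ Balanced (size f) ⊎
      (∃ λ f′ → Proper conf f′ × sum (λ c → size f′ c * size f′ c) < sum (λ c → size f c * size f c))
    search with Fin.any? move? | Fin.any? double?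
    ... | yes (i , i-act , i∈α , free) | _ = inj₂ (inj₂ (f [ i ≔ β ] ,
            set-proper conf conf-sym conf-irr f prop i β free ,
            squares-decrease (size f) _ α β gap λ c →
              trans (cong (λ z → size (f [ i ≔ β ]) c + δ z c) (sym i∈α)) (size-set f (0<act⇒≡1 i-act) β c)))
    ... | no _ | yes (x , x-act , x∉α , x∉β , x-free , y-free) = inj₂ (inj₂ (f₂ ,
            set-proper conf conf-sym conf-irr f₁ (set-proper conf conf-sym conf-irr f prop x β x-free) y (f x) y-free ,
            squares-decrease (size f) _ α β gap λ c →
              trans (cong (λ z → size f₂ c + δ z c) (sym f₁y)) (trans (size-set f₁ y-act (f x) c) (size-set f (0<act⇒≡1 x-act) β c))))
      where
      f₁ = f [ x ≔ β ]
      f₂ = f₁ [ y ≔ f x ]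
      -- `x` and `y` differ because they lie in different classes, so `y` still leaves `α`. The
      -- class of `x` loses `x` and gains `y`, and the net effect is one unit from `α` to `β`.
      f₁y : f₁ y ≡ α
      f₁y = trans (set-other f β (λ y≡x → x∉α (trans (cong f (sym y≡x)) y∈α))) y∈α
    ... | no ¬move | no ¬double = inj₁ (α , β , y , record
      { proper = prop ; β-least = β-least ; gap = gap ; y-act = y-act ; y∈α = y∈α
      ; no-move = λ i p q → n≢0⇒n>0 λ z → ¬move (i , p , q , z)
      ; no-double-move = λ x p q r s → n≢0⇒n>0 λ z → ¬double (x , p , q , r , s , z) })

  equitable-coloring : (∀ {f α β y} → Stuck f α β y → ⊥) → D ≤ q →
    ∃ λ f → Proper conf f × Balanced (size f)
  equitable-coloring unstuck D≤q =
    let (f , prop) , bal = descent {A = ∃ λ f → Proper conf f} (λ f → sum (λ c → size (proj₁ f) c * size (proj₁ f) c))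
          {P = λ f → Balanced (size (proj₁ f))} step (greedy-coloring conf conf-sym conf-irr deg (s≤s D≤q))
    in f , prop , bal
    where
    deg : ∀ i → sum (conf i) ≤ D
    deg i = ≤-trans (conf-deg i) (≤-trans (*-monoʳ-≤ D (act≤1 i)) (≤-reflexive (*-identityʳ D)))
    step : (f : ∃ λ f → Proper conf f) → _
    step (f , prop) with improve f prop
    ... | inj₁ (_ , _ , _ , stuck) = ⊥-elim (unstuck stuck)
    ... | inj₂ (inj₁ bal) = inj₁ bal
    ... | inj₂ (inj₂ (f′ , prop′ , lt)) = inj₂ ((f′ , prop′) , lt)

  module _ {f : Fin m → Fin (suc q)} {α β : Fin (suc q)} {y : Fin m} (stuck : Stuck f α β y) where
    open Stuck stuck

    b : ℕ
    b = size f β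

    -- The number of conflicts between class `c` and the class of `β`.
    B : Fin (suc q) → ℕ
    B c = sum (λ x → δ (f x) c * N f x β)

    -- Double counting: every conflict is charged to its end in the class of `β`, where each of the
    -- `b` active items has at most `D` conflicts.
    ∑B : sum B ≤ D * b
    ∑B = begin
      sum B                                                   ≡⟨ ∑-comm (λ c x → δ (f x) c * N f x β) ⟩
      sum (λ x → sum (λ c → δ (f x) c * N f x β))             ≡⟨ sum-cong-≗ (λ x → sym (*-distribʳ-sum (N f x β) (δ (f x)))) ⟩
      sum (λ x → sum (δ (f x)) * N f x β)                     ≡⟨ sum-cong-≗ (λ x → trans (cong (_* N f x β) (sum-δ₁ (f x))) (*-identityˡ _)) ⟩
      sum (λ x → sum (λ z → conf x z * δ (f z) β))            ≡⟨ ∑-comm (λ x z → conf x z * δ (f z) β) ⟩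
      sum (λ z → sum (λ x → conf x z * δ (f z) β))            ≡⟨ sum-cong-≗ (λ z → sym (*-distribʳ-sum (δ (f z) β) (λ x → conf x z))) ⟩
      sum (λ z → sum (λ x → conf x z) * δ (f z) β)            ≤⟨ sum-mono (λ z → *-monoˡ-≤ (δ (f z) β) (≤-trans (≤-reflexive (sum-cong-≗ (λ x → conf-sym x z))) (conf-deg z))) ⟩
      sum (λ z → D * act z * δ (f z) β)                       ≡⟨ sum-cong-≗ (λ z → *-assoc D (act z) _) ⟩
      sum (λ z → D * (act z * δ (f z) β))                     ≡⟨ *-distribˡ-sum D (λ z → act z * δ (f z) β) ⟨
      D * b                                                   ∎
      where open ≤-Reasoning

    ∑N : sum (N f y) ≤ D
    ∑N = ≤-trans (≤-reflexive (sum-weight (conf y) f))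
           (≤-trans (conf-deg y) (≤-reflexive (trans (cong (D *_) y-act) (*-identityʳ D))))

    blocked : ∀ c → (∀ x → 1 ≤ act x → f x ≡ c → 1 ≤ N f x β) → size f c ≤ B c
    blocked c bl = sum-mono pointwise
      where
      pointwise : ∀ x → act x * δ (f x) c ≤ δ (f x) c * N f x β
      pointwise x with act x in eq | f x Fin.≟ c
      ... | zero | _ = z≤n
      ... | suc a | no _ = ≤-reflexive (*-zeroʳ (suc a))
      ... | suc a | yes fx≡c = subst (suc a * 1 ≤_) (sym (*-identityˡ _))
              (≤-trans (≤-reflexive (*-identityʳ (suc a)))
                (≤-trans (subst (_≤ 1) eq (act≤1 x)) (bl x (subst (1 ≤_) (sym eq) (s≤s z≤n)) fx≡c)))

    α-blocked : size f α ≤ B α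
    α-blocked = blocked α no-move

    Nyβ : 1 ≤ N f y β
    Nyβ = no-move y (≤-reflexive (sym y-act)) y∈α

    N-after-move : ∀ {x c} → f x ≡ c → c ≢ β → N (f [ x ≔ β ]) y c + conf y x ≡ N f y c
    N-after-move {x} {c} refl c≢β = begin
      N (f [ x ≔ β ]) y c + conf y x             ≡⟨ cong (N (f [ x ≔ β ]) y c +_) (trans (sym (*-identityʳ _)) (cong (conf y x *_) (sym (δ-refl c)))) ⟩
      N (f [ x ≔ β ]) y c + conf y x * δ (f x) c ≡⟨ weight-set (conf y) f x β c ⟩
      N f y c + conf y x * δ β c                 ≡⟨ cong (λ z → N f y c + conf y x * z) (δ-≢ (c≢β ∘ sym)) ⟩
      N f y c + conf y x * 0                     ≡⟨ cong (N f y c +_) (*-zeroʳ (conf y x)) ⟩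
      N f y c + 0                                ≡⟨ +-identityʳ _ ⟩
      N f y c ∎
      where open ≡-Reasoning

    -- A class is paid for in one of two ways. If `y` has a conflict in it, the second summand is at
    -- least `b`; this covers `β`, since `y` cannot move there. If not, no member of it can move to
    -- `β`, as `y` could take its place, so each member contributes to `B c`.
    class-bound : ∀ c → b ≤ B c + b * N f y c
    class-bound c with c Fin.≟ α | c Fin.≟ β | N f y c in eq
    ... | _ | yes refl | _ = subst (λ z → b ≤ B c + b * z) eq
                               (≤-trans (≤-trans (≤-reflexive (sym (*-identityʳ b))) (*-monoʳ-≤ b Nyβ)) (m≤n+m _ (B c)))
    ... | yes refl | no _ | _ = ≤-trans (≤-trans (β-least c) α-blocked) (m≤m+n _ _)
    ... | no _ | no _ | suc z = ≤-trans (m≤m*n b (suc z)) (m≤n+m _ (B c))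
    ... | no c≢α | no c≢β | zero = ≤-trans (≤-trans (β-least c) (blocked c bl)) (m≤m+n _ _)
      where
      bl : ∀ x → 1 ≤ act x → f x ≡ c → 1 ≤ N f x β
      bl x x-act refl = n≢0⇒n>0 λ free → <⇒≢ (≤-trans (no-double-move x x-act c≢α c≢β free)
                          (≤-trans (m≤m+n _ _) (≤-reflexive (N-after-move refl c≢β)))) (sym eq)

    -- In the sum of `class-bound` over all colours, the conflicts with `β` and those of `y`
    -- contribute at most `D * b` each. The surplus 2 comes from `α`, whose at least `b + 2` members
    -- all conflict with the class of `β`.
    stuck-count : suc q * b + 2 ≤ D * b + D * b
    stuck-count = begin
      suc q * b + 2                   ≡⟨ cong (_+ 2) (sum-const (suc q) b) ⟨
      sum {suc q} (λ _ → b) + 2       ≤⟨ sum-mono-gap class-bound α (≤-trans gap (≤-trans α-blocked (m≤m+n _ _))) ⟩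
      sum (λ c → B c + b * N f y c)   ≡⟨ ∑-distrib-+ B (λ c → b * N f y c) ⟩
      sum B + sum (λ c → b * N f y c) ≡⟨ cong (sum B +_) (*-distribˡ-sum b (N f y)) ⟨
      sum B + b * sum (N f y)         ≤⟨ +-mono-≤ ∑B (*-monoʳ-≤ b ∑N) ⟩
      D * b + b * D                   ≡⟨ cong (D * b +_) (*-comm b D) ⟩
      D * b + D * b                   ∎
      where open ≤-Reasoning

    unstuck-many-colors : D + D ≤ suc q → ⊥
    unstuck-many-colors 2D≤q = <⇒≱ (m<m+n (suc q * b) (s≤s z≤n)) (begin
      suc q * b + 2 ≤⟨ stuck-count ⟩
      D * b + D * b ≡⟨ *-distribʳ-+ b D D ⟨
      (D + D) * b   ≤⟨ *-monoˡ-≤ b 2D≤q ⟩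
      suc q * b     ∎)
      where open ≤-Reasoning

    -- Two items per class on average, with D = 3: then b = 1, and a class W which is not
    -- blocked for β must contain two neighbours of y.
    pair-bound : b ≡ 1 → ∀ c → 2 ≤ B c + B c + N f y c + δ β c
    pair-bound b≡1 c with c Fin.≟ α | c Fin.≟ β | B c in eq
    ... | _ | yes refl | z = subst (λ z → 2 ≤ z + z + N f y c + δ c c) eq
            (+-mono-≤ (≤-trans Nyβ (m≤n+m _ (B c + B c))) (≤-reflexive (sym (δ-refl c))))
    ... | yes refl | no _ | z = subst (λ z → 2 ≤ z + z + N f y c + δ β c) eq (≤-trans (+-mono-≤ 1≤B 1≤B) (≤-trans (m≤m+n _ _) (m≤m+n _ _)))
      where
      1≤B : 1 ≤ B c
      1≤B = ≤-trans (≤-reflexive (sym b≡1)) (≤-trans (β-least c) α-blocked)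
    ... | no _ | no _ | suc z = ≤-trans (s≤s (≤-trans (s≤s z≤n) (m≤n+m (suc z) z))) (≤-trans (m≤m+n _ _) (m≤m+n _ _))
    ... | no c≢α | no c≢β | zero = ≤-trans two (m≤m+n _ _)
      where
      free : ∀ x → f x ≡ c → N f x β ≡ 0
      free x refl = trans (sym (trans (cong (_* N f x β) (δ-refl (f x))) (*-identityˡ _))) (sum≡0⇒term≡0 _ eq x)
      positive : ∀ {p q} → 1 ≤ p * q → 1 ≤ p × 1 ≤ q
      positive {suc p} {suc q} _ = s≤s z≤n , s≤s z≤n
      positive {suc p} {zero} h = contradiction (subst (1 ≤_) (*-zeroʳ p) h) λ ()
      conf-act : ∀ {x} → 1 ≤ conf y x → 1 ≤ act x
      conf-act {x} p = n≢0⇒n>0 λ z → <⇒≢ p (sym (trans (conf-sym y x)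
        (sum≡0⇒term≡0 _ (n≤0⇒n≡0 (≤-trans (conf-deg x) (≤-reflexive (trans (cong (D *_) z) (*-zeroʳ D))))) y)))
      another : ∀ x → 1 ≤ act x → f x ≡ c → 1 ≤ N (f [ x ≔ β ]) y c
      another x x-act refl = no-double-move x x-act c≢α c≢β (free x refl)
      two : 2 ≤ N f y c
      -- `x₀` is any member of the class. Without it `y` still has a neighbour `x₁` there, and
      -- without `x₁` alone there is still a further conflict.
      two with positive-term _ (≤-trans (≤-reflexive (sym b≡1)) (β-least c))
      ... | x₀ , p₀ with positive {act x₀} p₀
      ...   | a₀ , d₀ with another x₀ a₀ (δ-pos d₀)
      ...     | N₁ with positive-term _ (≤-trans N₁ (≤-trans (m≤m+n _ _) (≤-reflexive (N-after-move (δ-pos {a = f x₀} d₀) c≢β))))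
      ...       | x₁ , p₁ with positive {conf y x₁} p₁
      ...         | e₁ , d₁ = ≤-trans (+-mono-≤ (another x₁ (conf-act e₁) (δ-pos d₁)) e₁)
                                (≤-reflexive (N-after-move (δ-pos d₁) c≢β))

    -- The average class size is two, so `b ≥ 2` together with the gap makes the total too large,
    -- and `b = 0` contradicts `stuck-count`. Only `b = 1` calls for the refined bound.
    unstuck-pairs : D ≤ 3 → 3 ≤ q → sum act ≡ suc q * 2 → ⊥
    unstuck-pairs D≤3 3≤q total with b in eq
    ... | zero = contradiction (≤-trans (≤-trans (m≤n+m 2 (suc q * b)) stuck-count)
                   (≤-reflexive (subst (λ z → D * z + D * z ≡ 0) (sym eq) (cong₂ _+_ (*-zeroʳ D) (*-zeroʳ D))))) λ ()
    -- At least four colours count 2 each, and `α` adds 4 more because `B α ≥ 3` enters twice. The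
    -- upper bound is 3 + 3 from `B`, 3 from the conflicts of `y` and 1 from `β`.
    ... | suc zero = <⇒≱ {10} {12} (s≤s (n≤1+n 10)) (begin
      12                                                    ≤⟨ +-monoˡ-≤ 4 (*-monoˡ-≤ 2 (s≤s 3≤q)) ⟩
      suc q * 2 + 4                                         ≡⟨ cong (_+ 4) (sum-const (suc q) 2) ⟨
      sum {suc q} (λ _ → 2) + 4                             ≤⟨ sum-mono-gap (pair-bound eq) α 6≤ ⟩
      sum (λ c → B c + B c + N f y c + δ β c)               ≡⟨ ∑-distrib-+ (λ c → B c + B c + N f y c) (δ β) ⟩
      sum (λ c → B c + B c + N f y c) + sum (δ β)           ≡⟨ cong₂ _+_ (trans (∑-distrib-+ (λ c → B c + B c) (N f y)) (cong (_+ sum (N f y)) (∑-distrib-+ B B))) (sum-δ₁ β) ⟩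
      sum B + sum B + sum (N f y) + 1                       ≤⟨ +-monoˡ-≤ 1 (+-mono-≤ (+-mono-≤ ∑B≤3 ∑B≤3) (≤-trans ∑N D≤3)) ⟩
      10                                                    ∎)
      where
      open ≤-Reasoning
      ∑B≤3 : sum B ≤ 3
      ∑B≤3 = ≤-trans ∑B (≤-trans (≤-reflexive (trans (cong (D *_) eq) (*-identityʳ D))) D≤3)
      3≤Bα : 3 ≤ B α
      3≤Bα = ≤-trans (subst (λ z → z + 2 ≤ size f α) eq gap) α-blocked
      6≤ : 2 + 4 ≤ B α + B α + N f y α + δ β α
      6≤ = ≤-trans (+-mono-≤ 3≤Bα 3≤Bα) (≤-trans (m≤m+n _ _) (m≤m+n _ _))
    ... | suc (suc z) = <⇒≱ (m<m+n (suc q * 2) (s≤s z≤n)) (begin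
      suc q * 2 + 2                   ≤⟨ +-monoˡ-≤ 2 (*-monoʳ-≤ (suc q) (s≤s (s≤s (z≤n {z})))) ⟩
      suc q * suc (suc z) + 2         ≡⟨ cong (λ z → suc q * z + 2) eq ⟨
      suc q * b + 2                   ≡⟨ cong (_+ 2) (sum-const (suc q) b) ⟨
      sum {suc q} (λ _ → b) + 2       ≤⟨ sum-mono-gap β-least α gap ⟩
      sum (size f)                    ≡⟨ sum-weight act f ⟩
      sum act                         ≡⟨ total ⟩
      suc q * 2                       ∎)
      where open ≤-Reasoning

-- Class sizes of total colourings as sums over ordered pairs

edge : Graph n → Fin n → Fin n → ℕ
edge X u v = ⟦ adj X u v ⟧

lt : Fin n → Fin n → ℕ
lt u v = ⟦ ⌊ u Fin.<? v ⌋ ⟧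

degree-sum : (X : Graph n) (v : Fin n) → degree X v ≡ sum (edge X v)
degree-sum X v = count-allFin (adj X v)

edge-sym : (X : Graph n) → ∀ u v → edge X u v ≡ edge X v u
edge-sym X u v = cong ⟦_⟧ (adj-sym X u v)

edge-irr : (X : Graph n) → ∀ u → edge X u u ≡ 0
edge-irr X u = cong ⟦_⟧ (adj-irr X u)

lt-< : {u v : Fin n} → u Fin.< v → lt u v ≡ 1
lt-< {u = u} {v} u<v = T⇒⟦⟧ {⌊ u Fin.<? v ⌋} (fromWitness {a? = u Fin.<? v} u<v)

lt-split : (u v : Fin n) (z : ℕ) → (u ≡ v → z ≡ 0) → z ≡ lt u v * z + lt v u * z
lt-split u v z diag with u Fin.<? v | v Fin.<? u
... | yes u<v | yes v<u = contradiction v<u (<-asym u<v)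
... | yes _ | no _ = sym (trans (+-identityʳ _) (+-identityʳ z))
... | no _ | yes _ = sym (+-identityʳ z)
... | no u≮v | no v≮u = diag (Fin.toℕ-injective (≤-antisym (≮⇒≥ v≮u) (≮⇒≥ u≮v)))

sum-ordered-pairs : (f : Fin n → Fin n → ℕ) → (∀ u v → f u v ≡ f v u) → (∀ u → f u u ≡ 0) →
  sum (λ u → sum (f u)) ≡ sum (λ u → sum (λ v → lt u v * f u v)) + sum (λ u → sum (λ v → lt u v * f u v))
sum-ordered-pairs f f-sym f-irr = begin
  sum (λ u → sum (f u))
    ≡⟨ sum-cong-≗ (λ u → sum-cong-≗ (λ v → lt-split u v (f u v) λ { refl → f-irr u })) ⟩
  sum (λ u → sum (λ v → lt u v * f u v + lt v u * f u v))
    ≡⟨ sum-cong-≗ (λ u → ∑-distrib-+ (λ v → lt u v * f u v) (λ v → lt v u * f u v)) ⟩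
  sum (λ u → sum (λ v → lt u v * f u v) + sum (λ v → lt v u * f u v))
    ≡⟨ ∑-distrib-+ (λ u → sum (λ v → lt u v * f u v)) (λ u → sum (λ v → lt v u * f u v)) ⟩
  S + sum (λ u → sum (λ v → lt v u * f u v))
    ≡⟨ cong (S +_) (∑-comm (λ u v → lt v u * f u v)) ⟩
  S + sum (λ v → sum (λ u → lt v u * f u v))
    ≡⟨ cong (S +_) (sum-cong-≗ (λ v → sum-cong-≗ (λ u → cong (lt v u *_) (f-sym u v)))) ⟩
  S + S ∎
  where
  open ≡-Reasoning
  S = sum (λ u → sum (λ v → lt u v * f u v))

handshake : (X : Graph n) → Cubic X → ∃ λ e → n * 3 ≡ e + e
handshake {n} X cubic = sum (λ u → sum (λ v → lt u v * edge X u v)) , trans (sym (trans (sum-cong-≗ (λ u → trans (sym (degree-sum X u)) (cubic u))) (sum-const n 3)))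
  (sum-ordered-pairs (edge X) (edge-sym X) (edge-irr X))

-- Every edge is counted twice, once in each direction.
edgeCount : Graph n → (Fin n → Fin n → Fin k) → Fin k → ℕ
edgeCount X e c = sum (λ u → sum (λ v → edge X u v * δ (e u v) c))

edge*-cong : (X : Graph n) {x y : Fin n → Fin n → ℕ} → (∀ u v → T (adj X u v) → x u v ≡ y u v) →
  ∀ u v → edge X u v * x u v ≡ edge X u v * y u v
edge*-cong X eq u v with adj X u v | eq u v
... | true | e = cong (_+ 0) (e tt)
... | false | _ = refl

edgeCount-halves : (X : Graph n) (e : Fin n → Fin n → Fin k) → (∀ u v → T (adj X u v) → e u v ≡ e v u) → ∀ c →
  edgeCount X e c ≡ sum (λ u → sum (λ v → lt u v * (edge X u v * δ (e u v) c)))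
                  + sum (λ u → sum (λ v → lt u v * (edge X u v * δ (e u v) c)))
edgeCount-halves X e e-sym c = sum-ordered-pairs _
  (λ u v → trans (edge*-cong X (λ u v uv → cong (λ z → δ z c) (e-sym u v uv)) u v) (cong (_* δ (e v u) c) (edge-sym X u v)))
  (λ u → cong (_* δ (e u u) c) (edge-irr X u))

classSize-sum : {X : Graph n} (φ : TotalColoring X k) → ∀ c →
  classSize φ c ≡ sum (λ v → δ (vcol φ v) c) + sum (λ u → sum (λ v → lt u v * (edge X u v * δ (ecol φ u v) c)))
classSize-sum {n} {X = X} φ c = cong₂ _+_ (count-allFin (λ v → vcol φ v == c))
  (trans (count-pairs {n = n} (λ e → ⌊ proj₁ e Fin.<? proj₂ e ⌋ ∧ adj X (proj₁ e) (proj₂ e) ∧ (ecol φ (proj₁ e) (proj₂ e) == c)) id)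
    (sum-cong-≗ λ u → sum-cong-≗ λ v → trans (⟦∧⟧ ⌊ u Fin.<? v ⌋ _) (cong (lt u v *_) (⟦∧⟧ (adj X u v) _))))

-- Doubling trades the restriction `u < v` for a sum over all ordered pairs, which can be rearranged
-- freely. Class sizes are compared in this form and halved by `double-injective`.
classSize-double : {X : Graph n} (φ : TotalColoring X k) → ∀ c →
  classSize φ c + classSize φ c ≡ sum (λ v → δ (vcol φ v) c) + sum (λ v → δ (vcol φ v) c) + edgeCount X (ecol φ) c
classSize-double {X = X} φ c = begin
  classSize φ c + classSize φ c ≡⟨ cong₂ _+_ (classSize-sum φ c) (classSize-sum φ c) ⟩
  (V + S) + (V + S)             ≡⟨ rearrange V S ⟩
  V + V + (S + S)               ≡⟨ cong (V + V +_) (edgeCount-halves X (ecol φ) (ecol-sym φ) c) ⟨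
  V + V + edgeCount X (ecol φ) c ∎
  where
  open ≡-Reasoning
  V = sum (λ v → δ (vcol φ v) c)
  S = sum (λ u → sum (λ v → lt u v * (edge X u v * δ (ecol φ u v) c)))
  rearrange : ∀ v s → (v + s) + (v + s) ≡ v + v + (s + s)
  rearrange = solve-∀

-- How often `u` sees colour `c`, on itself or on an edge at `u`.
star : {X : Graph n} → TotalColoring X k → Fin n → Fin k → ℕ
star {X = X} φ u c = δ (vcol φ u) c + weight (edge X u) (ecol φ u) c

sum-star : {X : Graph n} (φ : TotalColoring X k) → ∀ u → sum (star φ u) ≡ suc (degree X u)
sum-star {X = X} φ u = trans (∑-distrib-+ (δ (vcol φ u)) _)
  (cong₂ _+_ (sum-δ₁ (vcol φ u)) (trans (sum-weight (edge X u) (ecol φ u)) (sym (degree-sum X u))))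

edge*δ⇒ : (X : Graph n) {u v : Fin n} {a b : Fin k} → 1 ≤ edge X u v * δ a b → T (adj X u v) × a ≡ b
edge*δ⇒ X {u} {v} {a} {b} p with adj X u v
... | true = tt , δ-pos (subst (1 ≤_) (+-identityʳ _) p)

edge*δ≤1 : (X : Graph n) (u v : Fin n) (a b : Fin k) → edge X u v * δ a b ≤ 1
edge*δ≤1 X u v a b = *-mono-≤ (⟦⟧≤1 (adj X u v)) (δ≤1 a b)

edge-colors-distinct : (X : Graph n) (u : Fin n) (e : Fin n → Fin k) →
  (∀ v w → T (adj X u v) → T (adj X u w) → v ≢ w → e v ≢ e w) → ∀ c → weight (edge X u) e c ≤ 1
edge-colors-distinct X u e ee′ c = sum≤1 _ (λ v → edge*δ≤1 X u v (e v) c) uniq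
  where
  uniq : ∀ v w → 1 ≤ edge X u v * δ (e v) c → 1 ≤ edge X u w * δ (e w) c → v ≡ w
  uniq v w p q with v Fin.≟ w | edge*δ⇒ X p | edge*δ⇒ X q
  ... | yes v≡w | _ | _ = v≡w
  ... | no v≢w | uv , refl | uw , eq = contradiction (sym eq) (ee′ v w uv uw v≢w)

star≤1 : {X : Graph n} (φ : TotalColoring X k) → ∀ u c → star φ u c ≤ 1
star≤1 {X = X} φ u c with vcol φ u Fin.≟ c
... | no _ = edge-colors-distinct X u (ecol φ u) (ee φ u) c
... | yes refl with weight (edge X u) (ecol φ u) c in eq
...   | zero = ≤-refl
...   | suc z with positive-term _ (subst (1 ≤_) (sym eq) (s≤s z≤n))
...     | v , p with edge*δ⇒ X p
...       | uv , e≡c = contradiction (sym e≡c) (ve φ u v uv)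

-- A vertex and its edges have pairwise different colours. The lower bound of the theorem rests on
-- this alone.
degree<colors : {X : Graph n} → TotalColoring X k → ∀ u → suc (degree X u) ≤ k
degree<colors φ u = subst (_≤ _) (sum-star φ u) (sum≤size (star φ u) (star≤1 φ u))

-- Equitable edge colourings of cubic graphs

record EdgeColoring (X : Graph n) (k : ℕ) : Set where
  field
    color : Fin n → Fin n → Fin k
    color-sym : ∀ u v → color u v ≡ color v u
    color-proper : ∀ u v w → T (adj X u v) → T (adj X u w) → v ≢ w → color u v ≢ color u w
    size : Fin k → ℕ
    size-double : ∀ c → edgeCount X color c ≡ size c + size c
    size-balanced : Balanced size

-- Items are all ordered pairs of vertices. A pair is active when it is an edge listed in increasing
-- order, so every edge is exactly one active item.
module CubicEdges (X : Graph n) (cubic : Cubic X) where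

  a : Fin n → Fin n → ℕ
  a u v = lt u v * edge X u v

  inc : Fin n × Fin n → Fin n × Fin n → ℕ
  inc (u , v) (x , y) = (δ u x + δ u y) + (δ v x + δ v y)

  ends : Fin (n * n) → Fin n × Fin n
  ends = remQuot {n} n

  act : Fin (n * n) → ℕ
  act p = a (proj₁ (ends p)) (proj₂ (ends p))

  -- The adjacency of the line graph: `1 ∸ δ p r` removes the diagonal, and `inc` counts common
  -- ends, of which two different edges of a simple graph have at most one.
  conf : Fin (n * n) → Fin (n * n) → ℕ
  conf p r = act p * (act r * ((1 ∸ δ p r) * inc (ends p) (ends r)))

  incident : ∀ u → sum (λ x → sum (λ y → a x y * (δ u x + δ u y))) ≡ 3
  incident u = begin
    sum (λ x → sum (λ y → a x y * (δ u x + δ u y)))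
      ≡⟨ sum-cong-≗ (λ x → sum-cong-≗ (λ y → rearrange (a x y) (δ u x) (δ u y))) ⟩
    sum (λ x → sum (λ y → δ u x * a x y + δ u y * a x y))
      ≡⟨ sum-cong-≗ (λ x → ∑-distrib-+ (λ y → δ u x * a x y) (λ y → δ u y * a x y)) ⟩
    sum (λ x → sum (λ y → δ u x * a x y) + sum (λ y → δ u y * a x y))
      ≡⟨ sum-cong-≗ (λ x → cong₂ _+_ (sym (*-distribˡ-sum (δ u x) (a x))) (sum-δ u (a x))) ⟩
    sum (λ x → δ u x * sum (a x) + a x u)
      ≡⟨ ∑-distrib-+ (λ x → δ u x * sum (a x)) (λ x → a x u) ⟩
    sum (λ x → δ u x * sum (a x)) + sum (λ x → a x u)
      ≡⟨ cong (_+ sum (λ x → a x u)) (sum-δ u (λ x → sum (a x))) ⟩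
    sum (a u) + sum (λ x → a x u)
      ≡⟨ ∑-distrib-+ (a u) (λ x → a x u) ⟨
    sum (λ x → a u x + a x u)
      ≡⟨ sum-cong-≗ (λ x → trans (cong (a u x +_) (cong (lt x u *_) (edge-sym X x u))) (sym (lt-split u x (edge X u x) λ { refl → edge-irr X u }))) ⟩
    sum (edge X u)
      ≡⟨ trans (sym (degree-sum X u)) (cubic u) ⟩
    3 ∎
    where
    open ≡-Reasoning
    rearrange : ∀ a d e → a * (d + e) ≡ d * a + e * a
    rearrange = solve-∀

  sum-incident : ∀ e → sum (λ r → act r * inc e (ends r)) ≡ 6
  sum-incident (u , v) = begin
    sum (λ r → act r * inc (u , v) (ends r))
      ≡⟨ sum-remQuot n n (λ e → a (proj₁ e) (proj₂ e) * inc (u , v) e) ⟩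
    sum (λ x → sum (λ y → a x y * ((δ u x + δ u y) + (δ v x + δ v y))))
      ≡⟨ sum-cong-≗ (λ x → trans (sum-cong-≗ (λ y → *-distribˡ-+ (a x y) (δ u x + δ u y) _)) (∑-distrib-+ (λ y → a x y * (δ u x + δ u y)) (λ y → a x y * (δ v x + δ v y)))) ⟩
    sum (λ x → sum (λ y → a x y * (δ u x + δ u y)) + sum (λ y → a x y * (δ v x + δ v y)))
      ≡⟨ ∑-distrib-+ (λ x → sum (λ y → a x y * (δ u x + δ u y))) (λ x → sum (λ y → a x y * (δ v x + δ v y))) ⟩
    _ ≡⟨ cong₂ _+_ (incident u) (incident v) ⟩
    6 ∎
    where open ≡-Reasoning

  -- Each end of an edge meets 3 edges; the edge itself is counted twice, leaving 4.
  conflict-degree : ∀ p → act p ≡ 1 → sum (λ r → act r * ((1 ∸ δ p r) * inc (ends p) (ends r))) ≤ 4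
  conflict-degree p p-act = +-cancelʳ-≤ 2 _ _ (begin
    sum (λ r → act r * ((1 ∸ δ p r) * inc e (ends r))) + 2
      ≤⟨ +-monoʳ-≤ (sum (λ r → act r * ((1 ∸ δ p r) * inc e (ends r)))) self ⟩
    sum (λ r → act r * ((1 ∸ δ p r) * inc e (ends r))) + act p * inc e e
      ≡⟨ cong (sum (λ r → act r * ((1 ∸ δ p r) * inc e (ends r))) +_) (sum-δ p (λ r → act r * inc e (ends r))) ⟨
    sum (λ r → act r * ((1 ∸ δ p r) * inc e (ends r))) + sum (λ r → δ p r * (act r * inc e (ends r)))
      ≡⟨ ∑-distrib-+ (λ r → act r * ((1 ∸ δ p r) * inc e (ends r))) (λ r → δ p r * (act r * inc e (ends r))) ⟨
    sum (λ r → act r * ((1 ∸ δ p r) * inc e (ends r)) + δ p r * (act r * inc e (ends r)))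
      ≡⟨ sum-cong-≗ (λ r → merge (p == r) (act r) (inc e (ends r))) ⟩
    sum (λ r → act r * inc e (ends r))
      ≡⟨ sum-incident e ⟩
    6 ∎)
    where
    open ≤-Reasoning
    e = ends p
    self : 2 ≤ act p * inc e e
    self = ≤-trans (+-mono-≤ (≤-trans (≤-reflexive (sym (δ-refl (proj₁ e)))) (m≤m+n _ _))
                             (≤-trans (≤-reflexive (sym (δ-refl (proj₂ e)))) (m≤n+m _ _)))
             (≤-reflexive (sym (trans (cong (_* inc e e) p-act) (*-identityˡ _))))
    merge : ∀ b x y → x * ((1 ∸ ⟦ b ⟧) * y) + ⟦ b ⟧ * (x * y) ≡ x * y
    merge true x y = trans (cong (_+ (x * y + 0)) (*-zeroʳ x)) (+-identityʳ _)
    merge false x y = trans (+-identityʳ _) (cong (x *_) (+-identityʳ y))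

  act≤1′ : ∀ p → act p ≤ 1
  act≤1′ p = *-mono-≤ (⟦⟧≤1 ⌊ proj₁ (ends p) Fin.<? proj₂ (ends p) ⌋) (⟦⟧≤1 (adj X (proj₁ (ends p)) (proj₂ (ends p))))

  conflicts : Conflicts (n * n) 4
  conflicts = record
    { act = act
    ; conf = conf
    ; act≤1 = act≤1′
    ; conf-sym = λ p r → trans (swap (act p) (act r) _)
        (cong (λ z → act r * (act p * z)) (cong₂ (λ x y → (1 ∸ x) * y) (δ-sym p r) (inc-sym (ends p) (ends r))))
    ; conf-irr = λ p → trans (cong (λ z → act p * (act p * ((1 ∸ z) * inc (ends p) (ends p)))) (δ-refl p))
        (trans (cong (act p *_) (*-zeroʳ (act p))) (*-zeroʳ (act p)))
    ; conf-deg = deg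
    }
    where
    swap : ∀ x y z → x * (y * z) ≡ y * (x * z)
    swap = solve-∀
    inc-sym : ∀ e e′ → inc e e′ ≡ inc e′ e
    inc-sym (u , v) (x , y) rewrite δ-sym u x | δ-sym u y | δ-sym v x | δ-sym v y = shuffle (δ x u) (δ y u) (δ x v) (δ y v)
      where
      shuffle : ∀ p q r s → (p + q) + (r + s) ≡ (p + r) + (q + s)
      shuffle = solve-∀
    deg : ∀ p → sum (conf p) ≤ 4 * act p
    deg p = go (act p) refl (act≤1′ p)
      where
      others : Fin (n * n) → ℕ
      others r = act r * ((1 ∸ δ p r) * inc (ends p) (ends r))
      go : ∀ z → act p ≡ z → z ≤ 1 → sum (conf p) ≤ 4 * act p
      go zero eq _ = ≤-trans (≤-reflexive (trans (sym (*-distribˡ-sum (act p) others)) (cong (_* sum others) eq))) z≤n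
      go (suc zero) eq _ = ≤-trans (≤-reflexive (trans (sym (*-distribˡ-sum (act p) others)) (*-comm (act p) (sum others))))
        (*-monoˡ-≤ (act p) (conflict-degree p eq))
      go (suc (suc _)) _ (s≤s ())

  -- Both directions of an edge name the same item, so a colouring of items is symmetric on all
  -- pairs, as `color-sym` demands.
  item : Fin n → Fin n → Fin (n * n)
  item u v = if ⌊ u Fin.<? v ⌋ then combine u v else combine v u

  item-sym : ∀ u v → item u v ≡ item v u
  item-sym u v with u Fin.<? v | v Fin.<? u
  ... | yes u<v | yes v<u = contradiction v<u (<-asym u<v)
  ... | yes _ | no _ = refl
  ... | no _ | yes _ = refl
  ... | no u≮v | no v≮u with Fin.toℕ-injective (≤-antisym (≮⇒≥ v≮u) (≮⇒≥ u≮v))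
  ...   | refl = refl

  item-injective : ∀ {u v w} → item u v ≡ item u w → v ≡ w
  item-injective {u} {v} {w} eq with u Fin.<? v | u Fin.<? w
  ... | yes _ | yes _ = proj₂ (Fin.combine-injective u v u w eq)
  ... | yes u<v | no u≮w with Fin.combine-injective u v w u eq
  ...   | refl , refl = refl
  item-injective {u} {v} {w} eq | no _ | yes _ with Fin.combine-injective v u u w eq
  ... | refl , refl = refl
  item-injective {u} {v} {w} eq | no _ | no _ = proj₁ (Fin.combine-injective v u w u eq)

  act-combine : ∀ u v → act (combine u v) ≡ a u v
  act-combine u v = cong (λ e → a (proj₁ e) (proj₂ e)) (Fin.remQuot-combine u v)

  item-act : ∀ {u v} → T (adj X u v) → act (item u v) ≡ 1
  item-act {u} {v} uv = go (u Fin.<? v) refl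
    where
    go : (d : Dec (u Fin.< v)) → (u Fin.<? v) ≡ d → act (item u v) ≡ 1
    go (yes u<v) eq rewrite eq = trans (act-combine u v) (cong₂ _*_ (lt-< u<v) (T⇒⟦⟧ uv))
    go (no u≮v) eq rewrite eq = trans (act-combine v u)
      (cong₂ _*_ (lt-< v<u) (T⇒⟦⟧ (subst T (adj-sym X u v) uv)))
      where
      v<u : v Fin.< u
      v<u = ≤∧≢⇒< (≮⇒≥ u≮v) λ v≡u → subst T (trans (cong (adj X u) (Fin.toℕ-injective v≡u)) (adj-irr X u)) uv

  item-end : ∀ u v → proj₁ (ends (item u v)) ≡ u ⊎ proj₂ (ends (item u v)) ≡ u
  item-end u v with u Fin.<? v
  ... | yes _ = inj₁ (cong proj₁ (Fin.remQuot-combine u v))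
  ... | no _ = inj₂ (cong proj₂ (Fin.remQuot-combine v u))

  inc-common : ∀ {u} e e′ → proj₁ e ≡ u ⊎ proj₂ e ≡ u → proj₁ e′ ≡ u ⊎ proj₂ e′ ≡ u → 1 ≤ inc e e′
  inc-common (u , v) (x , y) (inj₁ refl) (inj₁ refl) rewrite δ-refl u = s≤s z≤n
  inc-common (u , v) (x , y) (inj₁ refl) (inj₂ refl) rewrite δ-refl u = ≤-trans (m≤n+m 1 (δ u x)) (m≤m+n _ _)
  inc-common (u , v) (x , y) (inj₂ refl) (inj₁ refl) rewrite δ-refl v = ≤-trans (m≤m+n 1 (δ v y)) (m≤n+m _ (δ u v + δ u y))
  inc-common (u , v) (x , y) (inj₂ refl) (inj₂ refl) rewrite δ-refl v = ≤-trans (m≤n+m 1 (δ v x)) (m≤n+m _ (δ u x + δ u v))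

  conf-edges : ∀ u v w → T (adj X u v) → T (adj X u w) → v ≢ w → 1 ≤ conf (item u v) (item u w)
  conf-edges u v w uv uw v≢w = positive _ _ (≤-reflexive (sym (item-act uv)))
    (positive _ _ (≤-reflexive (sym (item-act uw))) (positive _ _ distinct
      (inc-common (ends (item u v)) (ends (item u w)) (item-end u v) (item-end u w))))
    where
    positive : ∀ x y → 1 ≤ x → 1 ≤ y → 1 ≤ x * y
    positive x y p q = *-mono-≤ p q
    distinct : 1 ≤ 1 ∸ δ (item u v) (item u w)
    distinct = ≤-reflexive (cong (1 ∸_) (sym (δ-≢ (λ eq → v≢w (item-injective {u} {v} {w} eq)))))

  fromItems : (f : Fin (n * n) → Fin k) → Proper conf f → Balanced (weight act f) → EdgeColoring X k
  fromItems {k} f proper balanced = record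
    { color = col
    ; color-sym = λ u v → cong f (item-sym u v)
    ; color-proper = λ u v w uv uw v≢w → proper (item u v) (item u w) (conf-edges u v w uv uw v≢w)
    ; size = weight act f
    ; size-double = λ c → trans (edgeCount-halves X col (λ u v _ → cong f (item-sym u v)) c)
        (cong₂ _+_ (sym (halves c)) (sym (halves c)))
    ; size-balanced = balanced
    }
    where
    col : Fin n → Fin n → Fin k
    col u v = f (item u v)
    halves : ∀ c → weight act f c ≡ sum (λ u → sum (λ v → lt u v * (edge X u v * δ (col u v) c)))
    halves c = begin
      sum (λ p → act p * δ (f p) c)
        ≡⟨ sum-cong-≗ (λ p → cong (λ z → act p * δ (f z) c) (sym (Fin.combine-remQuot {n} n p))) ⟩
      sum (λ p → act p * δ (f (combine (proj₁ (ends p)) (proj₂ (ends p)))) c)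
        ≡⟨ sum-remQuot n n (λ e → a (proj₁ e) (proj₂ e) * δ (f (combine (proj₁ e) (proj₂ e))) c) ⟩
      sum (λ u → sum (λ v → lt u v * edge X u v * δ (f (combine u v)) c))
        ≡⟨ sum-cong-≗ (λ u → sum-cong-≗ (λ v → ordered u v)) ⟩
      sum (λ u → sum (λ v → lt u v * (edge X u v * δ (col u v) c))) ∎
      where
      open ≡-Reasoning
      ordered : ∀ u v → lt u v * edge X u v * δ (f (combine u v)) c ≡ lt u v * (edge X u v * δ (col u v) c)
      ordered u v with u Fin.<? v
      ... | yes _ = *-assoc 1 (edge X u v) _
      ... | no _ = refl

  -- The line graph has degree `D = 4`, so the search needs `2D = 8` colours. They are available for
  -- `G`, where `n + 4 ≥ 8`, and for a large copy, where `h + 4 ≥ 8`.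
  equitable-edge-coloring : ∀ {q} → 7 ≤ q → EdgeColoring X (suc q)
  equitable-edge-coloring {q} 7≤q =
    let f , proper , balanced = E.equitable-coloring (λ s → E.unstuck-many-colors s (s≤s 7≤q)) (≤-trans (s≤s (s≤s (s≤s (s≤s z≤n)))) 7≤q)
    in fromItems f proper balanced
    where module E = Equitabilise {q = q} conflicts

open CubicEdges using (equitable-edge-coloring)

-- Renaming colours to even out the load

double-injective : ∀ {x y} → x + x ≡ y + y → x ≡ y
double-injective {x} {y} eq = *-cancelˡ-≡ x y 2 (trans (twice x) (trans eq (sym (twice y))))
  where
  twice : ∀ z → 2 * z ≡ z + z
  twice = solve-∀

relabel : (H₀ H : Graph n) (ρ : Fin n → Fin n) (π : Fin k → Fin k) →
  (∀ {a b} → ρ a ≡ ρ b → a ≡ b) → (∀ {a b} → π a ≡ π b → a ≡ b) →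
  (∀ x y → adj H x y ≡ adj H₀ (ρ x) (ρ y)) → TotalColoring H₀ k → TotalColoring H k
relabel H₀ H ρ π ρ-inj π-inj iso φ = record
  { vcol = π ∘ vcol φ ∘ ρ
  ; ecol = λ x y → π (ecol φ (ρ x) (ρ y))
  ; ecol-sym = λ x y xy → cong π (ecol-sym φ _ _ (to x y xy))
  ; vv = λ x y xy eq → vv φ _ _ (to x y xy) (π-inj eq)
  ; ee = λ x y z xy xz y≢z eq → ee φ _ _ _ (to x y xy) (to x z xz) (y≢z ∘ ρ-inj) (π-inj eq)
  ; ve = λ x y xy eq → ve φ _ _ (to x y xy) (π-inj eq)
  }
  where
  to : ∀ x y → T (adj H x y) → T (adj H₀ (ρ x) (ρ y))
  to x y = subst T (iso x y)

classSize-relabel : (H₀ H : Graph n) (ρ : Fin n → Fin n) (π : Fin k → Fin k)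
  (ρ-inj : ∀ {a b} → ρ a ≡ ρ b → a ≡ b) (π-inj : ∀ {a b} → π a ≡ π b → a ≡ b)
  (iso : ∀ x y → adj H x y ≡ adj H₀ (ρ x) (ρ y)) (φ : TotalColoring H₀ k) → ∀ c →
  classSize (relabel H₀ H ρ π ρ-inj π-inj iso φ) (π c) ≡ classSize φ c
classSize-relabel H₀ H ρ π ρ-inj π-inj iso φ c = double-injective (begin
  classSize φ′ (π c) + classSize φ′ (π c)                ≡⟨ classSize-double φ′ (π c) ⟩
  V′ + V′ + edgeCount H (ecol φ′) (π c)                  ≡⟨ cong₂ (λ v e → v + v + e) V≡ E≡ ⟩
  V + V + edgeCount H₀ (ecol φ) c                        ≡⟨ classSize-double φ c ⟨
  classSize φ c + classSize φ c                          ∎)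
  where
  open ≡-Reasoning
  φ′ = relabel H₀ H ρ π ρ-inj π-inj iso φ
  V′ = sum (λ v → δ (vcol φ′ v) (π c))
  V = sum (λ v → δ (vcol φ v) c)
  V≡ : V′ ≡ V
  V≡ = trans (sum-cong-≗ (λ v → δ-inj π π-inj (vcol φ (ρ v)) c)) (sum-reindex ρ ρ-inj (λ v → δ (vcol φ v) c))
  t : Fin _ → Fin _ → ℕ
  t u v = edge H₀ u v * δ (ecol φ u v) c
  E≡ : edgeCount H (ecol φ′) (π c) ≡ edgeCount H₀ (ecol φ) c
  E≡ = begin
    sum (λ u → sum (λ v → edge H u v * δ (ecol φ′ u v) (π c)))
      ≡⟨ sum-cong-≗ (λ u → sum-cong-≗ (λ v → cong₂ (λ a d → ⟦ a ⟧ * d) (iso u v) (δ-inj π π-inj (ecol φ (ρ u) (ρ v)) c))) ⟩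
    sum (λ u → sum (λ v → t (ρ u) (ρ v))) ≡⟨ sum-cong-≗ (λ u → sum-reindex ρ ρ-inj (t (ρ u))) ⟩
    sum (λ u → sum (t (ρ u)))             ≡⟨ sum-reindex ρ ρ-inj (λ u → sum (t u)) ⟩
    sum (λ u → sum (t u))                 ∎

balanced-relabel : (H₀ H : Graph n) (ρ : Fin n → Fin n) (π : Fin k → Fin k)
  (ρ-inj : ∀ {a b} → ρ a ≡ ρ b → a ≡ b) (π-inj : ∀ {a b} → π a ≡ π b → a ≡ b)
  (iso : ∀ x y → adj H x y ≡ adj H₀ (ρ x) (ρ y)) (φ : TotalColoring H₀ k) (L : Fin k → ℕ) →
  Balanced (λ j → L (π j) + classSize φ j) →
  Balanced (λ d → L d + classSize (relabel H₀ H ρ π ρ-inj π-inj iso φ) d)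
balanced-relabel H₀ H ρ π ρ-inj π-inj iso φ L bal c d with injective⇒inverse π π-inj
... | π⁻¹ , ππ⁻¹ , _ = subst₂ (λ x y → x ≤ y + 1) (eq c) (eq d) (bal (π⁻¹ c) (π⁻¹ d))
  where
  eq : ∀ c → L (π (π⁻¹ c)) + classSize φ (π⁻¹ c) ≡ L c + classSize (relabel H₀ H ρ π ρ-inj π-inj iso φ) c
  eq c = trans (cong (L (π (π⁻¹ c)) +_) (sym (classSize-relabel H₀ H ρ π ρ-inj π-inj iso φ (π⁻¹ c))))
    (cong (λ z → L z + classSize (relabel H₀ H ρ π ρ-inj π-inj iso φ) z) (ππ⁻¹ c))

sorting : (s : Fin k → ℕ) → ∃ λ (g : Fin k → Fin k) →
  (∀ {a b} → g a ≡ g b → a ≡ b) × (∀ i j → i Fin.≤ j → s (g i) ≤ s (g j))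
sorting {zero} s = id , id , λ ()
sorting {suc k} s with least s
... | i , i-least with sorting (s ∘ punchIn i)
...   | g , g-inj , g-mono = g′ , g′-inj , g′-mono
  where
  g′ : Fin (suc k) → Fin (suc k)
  g′ zero = i
  g′ (suc j) = punchIn i (g j)
  g′-inj : ∀ {a b} → g′ a ≡ g′ b → a ≡ b
  g′-inj {zero} {zero} _ = refl
  g′-inj {zero} {suc b} eq = contradiction (sym eq) (Fin.punchInᵢ≢i i (g b))
  g′-inj {suc a} {zero} eq = contradiction eq (Fin.punchInᵢ≢i i (g a))
  g′-inj {suc a} {suc b} eq = cong suc (g-inj (Fin.punchIn-injective i _ _ eq))
  g′-mono : ∀ a b → a Fin.≤ b → s (g′ a) ≤ s (g′ b)
  g′-mono zero b _ = i-least (g′ b)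
  g′-mono (suc a) (suc b) (s≤s a≤b) = g-mono a b a≤b

-- Pair the heaviest loads with the smallest sizes.
align : (L s : Fin k → ℕ) → Balanced L → Balanced s → ∃ λ (π : Fin k → Fin k) →
  (∀ {a b} → π a ≡ π b → a ≡ b) × Balanced (λ j → L (π j) + s j)
align L s bL bs with sorting L | sorting (λ j → sum s ∸ s j)
... | g , g-inj , g-mono | r , r-inj , r-mono with injective⇒inverse r r-inj
...   | r⁻¹ , rr⁻¹ , r⁻¹r = g ∘ r⁻¹ ,
        (λ {a} {b} eq → trans (sym (rr⁻¹ a)) (trans (cong r (g-inj eq)) (rr⁻¹ b))) ,
        λ c d → subst₂ (λ c′ d′ → L (g (r⁻¹ c)) + s c′ ≤ L (g (r⁻¹ d)) + s d′ + 1) (rr⁻¹ c) (rr⁻¹ d) (ranked (r⁻¹ c) (r⁻¹ d))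
  where
  -- The sort was by `sum s ∸ s j`. No size exceeds the sum, so the truncated difference reverses
  -- the order faithfully.
  decreasing : ∀ {i j} → i Fin.≤ j → s (r j) ≤ s (r i)
  decreasing {i} {j} i≤j = ≮⇒≥ λ lt → <⇒≱ (∸-monoʳ-< lt (term≤sum s (r j))) (r-mono i j i≤j)
  -- Whichever rank is smaller, one of the two summands is already in order, and only the imbalance
  -- of the other, at most one, remains.
  ranked : ∀ i j → L (g i) + s (r i) ≤ L (g j) + s (r j) + 1
  ranked i j with ≤-total (toℕ i) (toℕ j)
  ... | inj₁ i≤j = ≤-trans (+-mono-≤ (g-mono i j i≤j) (bs (r i) (r j))) (≤-reflexive (sym (+-assoc (L (g j)) _ 1)))
  ... | inj₂ j≤i = ≤-trans (+-mono-≤ (bL (g i) (g j)) (decreasing j≤i)) (≤-reflexive (swap (L (g j)) _))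
    where
    swap : ∀ x y → x + 1 + y ≡ x + y + 1
    swap = solve-∀

-- One class above `z` lifts all others to at least `z`. With a known total this bounds class sizes
-- from above; `balanced-sum-≤` is the mirror image.
balanced-sum-≥ : (s : Fin k → ℕ) → Balanced s → ∀ c {z} → suc z ≤ s c → k * z + 1 ≤ sum s
balanced-sum-≥ {k} s bal c {z} z<s = ≤-trans (≤-reflexive (cong (_+ 1) (sym (sum-const k z))))
  (sum-mono-gap (λ d → s≤s⁻¹ (≤-trans z<s (≤-trans (bal c d) (≤-reflexive (+-comm _ 1))))) c
    (≤-trans (≤-reflexive (+-comm z 1)) z<s))

balanced-sum-≤ : (s : Fin k → ℕ) → Balanced s → ∀ c {z} → suc (s c) ≤ z → sum s + 1 ≤ k * z
balanced-sum-≤ {k} s bal c {z} s<z = ≤-trans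
  (sum-mono-gap {g = λ _ → z} (λ d → ≤-trans (bal d c) (≤-trans (≤-reflexive (+-comm _ 1)) s<z)) c
    (≤-trans (≤-reflexive (+-comm _ 1)) s<z))
  (≤-reflexive (sum-const k z))

-- Injections that avoid forbidden values

sum-injection≤ : (s : Fin n → Fin k) → (∀ {a b} → s a ≡ s b → a ≡ b) → ∀ f → sum (f ∘ s) ≤ sum f
sum-injection≤ s inj f = begin
  sum (f ∘ s)                                   ≡⟨ sum-cong-≗ (λ x → sym (sum-δ (s x) f)) ⟩
  sum (λ x → sum (λ c → δ (s x) c * f c))       ≡⟨ ∑-comm (λ x c → δ (s x) c * f c) ⟩
  sum (λ c → sum (λ x → δ (s x) c * f c))       ≡⟨ sum-cong-≗ (λ c → sym (*-distribʳ-sum (f c) (λ x → δ (s x) c))) ⟩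
  sum (λ c → sum (λ x → δ (s x) c) * f c)       ≤⟨ sum-mono (λ c → *-monoˡ-≤ (f c) (once c)) ⟩
  sum (λ c → 1 * f c)                           ≡⟨ sum-cong-≗ (λ c → *-identityˡ (f c)) ⟩
  sum f ∎
  where
  open ≤-Reasoning
  once : ∀ c → sum (λ x → δ (s x) c) ≤ 1
  once c = sum≤1 _ (λ x → δ≤1 (s x) c) (λ i j p q → inj (trans (δ-pos p) (sym (δ-pos q))))

transpose-left : (i j : Fin n) → transpose i j i ≡ j
transpose-left i j rewrite dec-true (i Fin.≟ i) refl = refl

transpose-right : (i j : Fin n) → j ≢ i → transpose i j j ≡ i
transpose-right i j j≢i rewrite dec-false (j Fin.≟ i) j≢i | dec-true (j Fin.≟ j) refl = refl

transpose-other : (i j : Fin n) {l : Fin n} → l ≢ i → l ≢ j → transpose i j l ≡ l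
transpose-other i j {l} l≢i l≢j rewrite dec-false (l Fin.≟ i) l≢i | dec-false (l Fin.≟ j) l≢j = refl

-- Local search over injections: a forbidden value s x can be exchanged with some s x′
-- so that both become allowed, since x and s x together exclude fewer than n choices of x′.
module Assignment {n k : ℕ} (forb : Fin n → Fin k → ℕ) (d : ℕ) (row : ∀ x → sum (forb x) ≤ d)
  (col : ∀ c → sum (λ x → forb x c) + d ≤ n) where

  Injection : (Fin k → ℕ) → Set
  Injection P = ∃ λ (s : Fin n → Fin k) → (∀ {x y} → s x ≡ s y → x ≡ y) × (∀ x → P (s x) ≡ 1)

  assign : ∀ {P} → Injection P → ∃ λ (i : Injection P) → ∀ x → forb x (proj₁ i x) ≡ 0
  assign {P} = descent (λ i → sum (λ x → forb x (proj₁ i x))) step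
    where
    step : (i : Injection P) → (∀ x → forb x (proj₁ i x) ≡ 0) ⊎
      ∃ λ (j : Injection P) → sum (λ x → forb x (proj₁ j x)) < sum (λ x → forb x (proj₁ i x))
    step (s , inj , good) with Fin.all? (λ x → forb x (s x) ≟ 0)
    ... | yes allowed = inj₁ allowed
    ... | no ¬allowed with Fin.¬∀⟶∃¬ _ _ (λ x → forb x (s x) ≟ 0) ¬allowed
    ...   | x , bad = inj₂ ((s ∘ τ , τ-inj ∘ inj , good ∘ τ) ,
              subst (_≤ sum (λ i → forb i (s i))) (+-comm _ 1) (sum-mono-gap improved x at-x))
      where
      -- The obstacles to exchanging the values of `x` and `y`.
      both : Fin n → ℕ
      both y = forb y (s x) + forb x (s y)

      -- The entry at `x` is replaced by 1, so that the zero to be found lies elsewhere. As `both x`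
      -- is at least 2, this also supplies the strictness of `sum cost < n`.
      cost : Fin n → ℕ
      cost = both [ x ≔ 1 ]

      cost≤ : ∀ y → cost y ≤ both y
      cost≤ y with y Fin.≟ x
      ... | yes refl = ≤-trans (n≢0⇒n>0 bad) (m≤m+n _ _)
      ... | no _ = ≤-refl

      cost-x : cost x + 1 ≤ both x
      cost-x = subst (λ z → z + 1 ≤ both x) (sym (set-same both x 1)) (+-mono-≤ (n≢0⇒n>0 bad) (n≢0⇒n>0 bad))

      sum-cost : sum cost < n
      sum-cost = subst (_≤ n) (+-comm (sum cost) 1) (begin
        sum cost + 1                                        ≤⟨ sum-mono-gap cost≤ x cost-x ⟩
        sum both                                            ≡⟨ ∑-distrib-+ (λ y → forb y (s x)) (λ y → forb x (s y)) ⟩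
        sum (λ y → forb y (s x)) + sum (λ y → forb x (s y)) ≤⟨ +-monoʳ-≤ (sum (λ y → forb y (s x))) (≤-trans (sum-injection≤ s inj (forb x)) (row x)) ⟩
        sum (λ y → forb y (s x)) + d                        ≤⟨ col (s x) ⟩
        n                                                   ∎)
        where open ≤-Reasoning

      x′ : Fin n
      x′ = proj₁ (zero-term cost sum-cost)

      cost-x′ : cost x′ ≡ 0
      cost-x′ = proj₂ (zero-term cost sum-cost)

      x′≢x : x′ ≢ x
      x′≢x eq = contradiction (trans (sym cost-x′) (trans (cong cost eq) (set-same both x 1))) λ ()

      both-x′ : both x′ ≡ 0
      both-x′ = trans (sym (set-other both 1 x′≢x)) cost-x′

      τ : Fin n → Fin n
      τ = transpose x x′

      τ-inj : ∀ {a b} → τ a ≡ τ b → a ≡ b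
      τ-inj {a} {b} eq = trans (sym (transpose-inverse x′ x)) (trans (cong (transpose x′ x) eq) (transpose-inverse x′ x))

      new-x : forb x (s (τ x)) ≡ 0
      new-x = trans (cong (forb x ∘ s) (transpose-left x x′)) (m+n≡0⇒n≡0 (forb x′ (s x)) both-x′)

      new-x′ : forb x′ (s (τ x′)) ≡ 0
      new-x′ = trans (cong (forb x′ ∘ s) (transpose-right x x′ x′≢x)) (m+n≡0⇒m≡0 (forb x′ (s x)) both-x′)

      improved : ∀ i → forb i (s (τ i)) ≤ forb i (s i)
      improved i = go (i Fin.≟ x) (i Fin.≟ x′)
        where
        go : Dec (i ≡ x) → Dec (i ≡ x′) → forb i (s (τ i)) ≤ forb i (s i)
        go (yes i≡x) _ = subst (λ i → forb i (s (τ i)) ≤ forb i (s i)) (sym i≡x) (≤-trans (≤-reflexive new-x) z≤n)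
        go (no _) (yes i≡x′) = subst (λ i → forb i (s (τ i)) ≤ forb i (s i)) (sym i≡x′) (≤-trans (≤-reflexive new-x′) z≤n)
        go (no i≢x) (no i≢x′) = ≤-reflexive (cong (forb i ∘ s) (transpose-other x x′ i≢x i≢x′))

      at-x : forb x (s (τ x)) + 1 ≤ forb x (s x)
      at-x = subst (λ z → z + 1 ≤ forb x (s x)) (sym new-x) (n≢0⇒n>0 bad)

-- Copies of H that fit a vertex of G

-- c is the colour of the vertex of G to which the copy is attached; E c′ ≡ 1 iff c′ is the
-- colour of an edge of G at that vertex.
record Copy (H : Graph n) (E : Fin k → ℕ) (c : Fin k) : Set where
  field
    φ : TotalColoring H k
    spoke : Fin n → Fin k
    spoke-injective : ∀ {x y} → spoke x ≡ spoke y → x ≡ y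
    spoke∉E : ∀ x → E (spoke x) ≡ 0
    spoke≢c : ∀ x → spoke x ≢ c
    spoke≢vcol : ∀ x → spoke x ≢ vcol φ x
    spoke≢ecol : ∀ x y → T (adj H x y) → spoke x ≢ ecol φ x y
    vcol≢c : ∀ x → vcol φ x ≢ c

-- F marks the colours of the neighbours in G which are already coloured.
Extensible : Graph n → ℕ → Set
Extensible H k = ∀ (L E F : Fin k → ℕ) → Balanced L → (∀ c → E c ≤ 1) → sum E ≡ 3 → sum F ≤ 3 →
  ∃ λ c → E c ≡ 0 × F c ≡ 0 × Σ (Copy H E c) λ C → Balanced (λ d → L d + classSize (Copy.φ C) d)

module SpokeColors {k : ℕ} (E : Fin k → ℕ) (c : Fin k) (E≤1 : ∀ d → E d ≤ 1) (∑E : sum E ≡ 3) (E-c : E c ≡ 0) where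

  used : Fin k → ℕ
  used d = E d + δ c d

  used≤1 : ∀ d → used d ≤ 1
  used≤1 d with c Fin.≟ d
  ... | yes refl = subst (λ z → z + 1 ≤ 1) (sym E-c) ≤-refl
  ... | no _ = ≤-trans (≤-reflexive (+-identityʳ (E d))) (E≤1 d)

  available : Fin k → ℕ
  available d = 1 ∸ used d

  -- The four colours lost are those of the vertex of G and its three edges in G. For `k = n + 4`
  -- exactly `n` remain, so the spokes must use every one of them.
  sum-available : sum available + 4 ≡ k
  sum-available = begin
    sum available + 4              ≡⟨ cong (sum available +_) (trans (∑-distrib-+ E (δ c)) (cong₂ _+_ ∑E (sum-δ₁ c))) ⟨
    sum available + sum used       ≡⟨ ∑-distrib-+ available used ⟨
    sum (λ d → 1 ∸ used d + used d) ≡⟨ sum-cong-≗ (λ d → m∸n+n≡m (used≤1 d)) ⟩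
    sum {k} (λ _ → 1)              ≡⟨ trans (sum-const k 1) (*-identityʳ k) ⟩
    k ∎
    where open ≡-Reasoning

  available⇒ : ∀ {d} → available d ≡ 1 → E d ≡ 0 × d ≢ c
  available⇒ {d} eq = m+n≡0⇒m≡0 (E d) unused , λ { refl → contradiction (trans (sym (δ-refl d)) (m+n≡0⇒n≡0 (E d) unused)) λ () }
    where
    unused : used d ≡ 0
    unused with used d
    ... | zero = refl
    ... | suc zero = contradiction eq λ ()
    ... | suc (suc _) = contradiction eq λ ()

  available≤1 : ∀ d → available d ≤ 1
  available≤1 d = m∸n≤m 1 (used d)

-- Copies on at least eight vertices

balanced⇒pairs : ∀ {q} (f : Fin (q + q) → Fin q) → Balanced (weight (λ _ → 1) f) → ∀ i → sum (λ v → δ (f v) i) ≡ 2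
balanced⇒pairs {q} f balanced i = trans (sum-cong-≗ (λ v → sym (*-identityˡ (δ (f v) i)))) (go (<-cmp (size i) 2))
  where
  open import Relation.Binary.Definitions using (Tri; tri<; tri≈; tri>)
  size : Fin q → ℕ
  size = weight (λ _ → 1) f
  ring : ∀ h → (h + h) * 1 ≡ h * 2
  ring = solve-∀
  total : sum size ≡ q * 2
  total = trans (sum-weight (λ _ → 1) f) (trans (sum-const (q + q) 1) (ring q))
  -- The average is exactly two, and in a balanced family a single class below or above it would
  -- push the total to the same side.
  go : Tri (size i < 2) (size i ≡ 2) (2 < size i) → size i ≡ 2
  go (tri≈ _ eq _) = eq
  go (tri< lt _ _) = contradiction (≤-trans (≤-reflexive (cong (_+ 1) (sym total))) (balanced-sum-≤ size balanced i lt)) (<⇒≱ (m<m+n (q * 2) (s≤s z≤n)))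
  go (tri> _ _ gt) = contradiction (≤-trans (balanced-sum-≥ size balanced i gt) (≤-reflexive total)) (<⇒≱ (m<m+n (q * 2) (s≤s z≤n)))

-- Here `D = 3`, but there may be only four colours, fewer than the `2D = 6` of the general count.
-- What helps is that `2h` vertices on `h` colours make two per class, the situation of
-- `unstuck-pairs`.
vertex-pairs : ∀ {q} → 3 ≤ q → (H : Graph (suc q + suc q)) → Cubic H →
  ∃ λ (f : Fin (suc q + suc q) → Fin (suc q)) → Proper (edge H) f × (∀ i → sum (λ v → δ (f v) i) ≡ 2)
vertex-pairs {q} 3≤q H cubic =
  map₂ (λ {f} → map₂ (balanced⇒pairs {suc q} f)) (V.equitable-coloring unstuck 3≤q)
  where
  vertexConflicts : Conflicts (suc q + suc q) 3
  vertexConflicts = record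
    { act = λ _ → 1
    ; conf = edge H
    ; act≤1 = λ _ → ≤-refl
    ; conf-sym = edge-sym H
    ; conf-irr = edge-irr H
    ; conf-deg = λ i → ≤-reflexive (trans (sym (degree-sum H i)) (cubic i))
    }
  module V = Equitabilise {q = q} vertexConflicts
  ring : ∀ h → (h + h) * 1 ≡ h * 2
  ring = solve-∀
  n≡h*2 : sum {suc q + suc q} (λ _ → 1) ≡ suc q * 2
  n≡h*2 = trans (sum-const (suc q + suc q) 1) (ring (suc q))
  unstuck : ∀ {f α β y} → V.Stuck f α β y → ⊥
  unstuck {f} {α} {β} {y} s = V.unstuck-pairs {f} {α} {β} {y} s ≤-refl 3≤q n≡h*2

-- Copies of a cubic graph on 2h ≥ 8 vertices: h colours of two vertices each,
-- and h + 4 further colours for the edges.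
module LargeCopies {h : ℕ} (4≤h : 4 ≤ h) (H : Graph (h + h)) (cubic : Cubic H)
  (f : Fin (h + h) → Fin h) (f-proper : Proper (edge H) f)
  (vertexClass : ∀ i → sum (λ v → δ (f v) i) ≡ 2) (edges : EdgeColoring H (h + 4)) where

  K : ℕ
  K = h + (h + 4)

  open EdgeColoring edges

  sum-edgeCount : ∀ {l} (e : Fin (h + h) → Fin (h + h) → Fin l) → sum (edgeCount H e) ≡ (h + h) * 3
  sum-edgeCount e = begin
    sum (λ c → sum (λ u → weight (edge H u) (e u) c)) ≡⟨ ∑-comm (λ c u → weight (edge H u) (e u) c) ⟩
    sum (λ u → sum (weight (edge H u) (e u)))         ≡⟨ sum-cong-≗ (λ u → trans (sum-weight (edge H u) (e u)) (trans (sym (degree-sum H u)) (cubic u))) ⟩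
    sum {h + h} (λ _ → 3)                             ≡⟨ sum-const (h + h) 3 ⟩
    (h + h) * 3 ∎
    where open ≡-Reasoning

  sum-size : sum size ≡ h * 3
  sum-size = double-injective (begin
    sum size + sum size         ≡⟨ ∑-distrib-+ size size ⟨
    sum (λ c → size c + size c) ≡⟨ sum-cong-≗ size-double ⟨
    sum (edgeCount H color)     ≡⟨ sum-edgeCount color ⟩
    (h + h) * 3                 ≡⟨ *-distribʳ-+ 3 h h ⟩
    h * 3 + h * 3 ∎)
    where open ≡-Reasoning

  -- An empty class would limit all others to one edge, and `3h` edges do not fit into `h + 4` such
  -- classes.
  size≥1 : ∀ c → 1 ≤ size c
  size≥1 c = n≢0⇒n>0 λ eq → contradiction
    (≤-trans (≤-reflexive (cong (_+ 1) (sym sum-size))) (balanced-sum-≤ size size-balanced c (≤-reflexive (cong suc eq))))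
    (<⇒≱ (begin-strict
      (h + 4) * 1     ≡⟨ *-identityʳ (h + 4) ⟩
      h + 4           ≤⟨ +-monoʳ-≤ h (≤-trans 4≤h (m≤m+n h h)) ⟩
      h + (h + h)     <⟨ n<1+n _ ⟩
      1 + (h + (h + h)) ≡⟨ ring h ⟩
      h * 3 + 1       ∎))
    where
    open ≤-Reasoning
    ring : ∀ h → 1 + (h + (h + h)) ≡ h * 3 + 1
    ring = solve-∀

  size≤3 : ∀ c → size c ≤ 3
  size≤3 c = ≮⇒≥ λ 3<s → contradiction (≤-trans (balanced-sum-≥ size size-balanced c 3<s) (≤-reflexive sum-size))
    (<⇒≱ (≤-<-trans (*-monoˡ-≤ 3 (m≤m+n h 4)) (m<m+n ((h + 4) * 3) (s≤s z≤n))))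

  -- A class of three edges forces all others to have at least two, hence `2 (h + 4) + 1 ≤ 3h` and
  -- `h ≥ 9`; smaller classes are covered by `h ≥ 4`. The exchange of spokes depends on this bound.
  size+2≤h : ∀ c → size c + 2 ≤ h
  size+2≤h c with size c ≤? 2
  ... | yes ≤2 = ≤-trans (+-monoˡ-≤ 2 ≤2) 4≤h
  ... | no ≰2 = ≤-trans (+-monoˡ-≤ 2 (size≤3 c)) (≤-trans (m≤m+n 5 4) 9≤h)
    where
    ring₁ : ∀ h → 9 + h * 2 ≡ (h + 4) * 2 + 1
    ring₁ = solve-∀
    ring₂ : ∀ h → h * 3 ≡ h + h * 2
    ring₂ = solve-∀
    9≤h : 9 ≤ h
    9≤h = +-cancelʳ-≤ (h * 2) 9 h (≤-trans (≤-reflexive (ring₁ h))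
      (≤-trans (balanced-sum-≥ size size-balanced c (≰⇒> ≰2)) (≤-reflexive (trans sum-size (ring₂ h)))))

  ↑ˡ≢↑ʳ : ∀ {i : Fin h} {j : Fin (h + 4)} → i ↑ˡ (h + 4) ≢ h ↑ʳ j
  ↑ˡ≢↑ʳ {i} {j} eq with trans (sym (Fin.splitAt-↑ˡ h i (h + 4))) (trans (cong (splitAt h) eq) (Fin.splitAt-↑ʳ h (h + 4) j))
  ... | ()

  ↑ˡ-inj : ∀ {i j : Fin h} → i ↑ˡ (h + 4) ≡ j ↑ˡ (h + 4) → i ≡ j
  ↑ˡ-inj = Fin.↑ˡ-injective (h + 4) _ _

  ↑ʳ-inj : ∀ {i j : Fin (h + 4)} → h ↑ʳ i ≡ h ↑ʳ j → i ≡ j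
  ↑ʳ-inj = Fin.↑ʳ-injective h _ _

  φ₀ : TotalColoring H K
  φ₀ = record
    { vcol = λ v → f v ↑ˡ (h + 4)
    ; ecol = λ u v → h ↑ʳ color u v
    ; ecol-sym = λ u v _ → cong (h ↑ʳ_) (color-sym u v)
    ; vv = λ u v uv eq → f-proper u v (≤-reflexive (sym (T⇒⟦⟧ uv))) (↑ˡ-inj eq)
    ; ee = λ u v w uv uw v≢w eq → color-proper u v w uv uw v≢w (↑ʳ-inj eq)
    ; ve = λ u v _ → ↑ˡ≢↑ʳ
    }

  sizes : Fin h ⊎ Fin (h + 4) → ℕ
  sizes (inj₁ _) = 2
  sizes (inj₂ j) = size j

  classSize-↑ˡ : ∀ i → classSize φ₀ (i ↑ˡ (h + 4)) ≡ 2
  classSize-↑ˡ i = double-injective (trans (classSize-double φ₀ (i ↑ˡ (h + 4)))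
    (cong₂ (λ v e → v + v + e)
      (trans (sum-cong-≗ (λ v → δ-inj (_↑ˡ (h + 4)) ↑ˡ-inj (f v) i)) (vertexClass i))
      (trans (sum-cong-≗ (λ u → trans (sum-cong-≗ (λ v → trans (cong (edge H u v *_) (δ-≢ {a = h ↑ʳ color u v} {i ↑ˡ (h + 4)} (↑ˡ≢↑ʳ ∘ sym))) (*-zeroʳ (edge H u v)))) (sum-zero {h + h}))) (sum-zero {h + h}))))

  classSize-↑ʳ : ∀ j → classSize φ₀ (h ↑ʳ j) ≡ size j
  classSize-↑ʳ j = double-injective (trans (classSize-double φ₀ (h ↑ʳ j))
    (trans (cong₂ (λ v e → v + v + e)
      (trans (sum-cong-≗ (λ v → δ-≢ {a = f v ↑ˡ (h + 4)} {h ↑ʳ j} ↑ˡ≢↑ʳ)) (sum-zero {h + h}))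
      (sum-cong-≗ (λ u → sum-cong-≗ (λ v → cong (edge H u v *_) (δ-inj (h ↑ʳ_) ↑ʳ-inj (color u v) j)))))
    (size-double j)))

  classSize-φ₀ : ∀ c → classSize φ₀ c ≡ sizes (splitAt h c)
  classSize-φ₀ c = subst (λ z → classSize φ₀ z ≡ sizes (splitAt h c)) (Fin.join-splitAt h (h + 4) c) (go (splitAt h c))
    where
    go : ∀ s → classSize φ₀ (Fin.join h (h + 4) s) ≡ sizes s
    go (inj₁ i) = classSize-↑ˡ i
    go (inj₂ j) = classSize-↑ʳ j

  -- Edge classes have between one and three elements, so none is more than one away from the vertex
  -- classes, which have two.
  φ₀-balanced : Balanced (classSize φ₀)
  φ₀-balanced c d = subst₂ (λ x y → x ≤ y + 1) (sym (classSize-φ₀ c)) (sym (classSize-φ₀ d)) (go (splitAt h c) (splitAt h d))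
    where
    go : ∀ s t → sizes s ≤ sizes t + 1
    go (inj₁ _) (inj₁ _) = s≤s (s≤s z≤n)
    go (inj₁ _) (inj₂ j) = +-monoˡ-≤ 1 (size≥1 j)
    go (inj₂ i) (inj₁ _) = size≤3 i
    go (inj₂ i) (inj₂ j) = size-balanced i j

  φ₀-small : ∀ c → classSize φ₀ c + 2 ≤ h
  φ₀-small c = subst (λ z → z + 2 ≤ h) (sym (classSize-φ₀ c)) (go (splitAt h c))
    where
    go : ∀ s → sizes s + 2 ≤ h
    go (inj₁ _) = 4≤h
    go (inj₂ j) = size+2≤h j

  module Aligned (L E F : Fin K → ℕ) (E≤1 : ∀ c → E c ≤ 1) (∑E : sum E ≡ 3) (∑F : sum F ≤ 3)
    (π : Fin K → Fin K) (π-inj : ∀ {a b} → π a ≡ π b → a ≡ b) (π-bal : Balanced (λ j → L (π j) + classSize φ₀ j))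
    (π⁻¹ : Fin K → Fin K) (ππ⁻¹ : ∀ c → π (π⁻¹ c) ≡ c) where

    φ : TotalColoring H K
    φ = relabel H H id π id π-inj (λ _ _ → refl) φ₀

    classSize-φ : ∀ d → classSize φ d ≡ classSize φ₀ (π⁻¹ d)
    classSize-φ d = trans (cong (classSize φ) (sym (ππ⁻¹ d))) (classSize-relabel H H id π id π-inj (λ _ _ → refl) φ₀ (π⁻¹ d))

    balanced : Balanced (λ d → L d + classSize φ d)
    balanced = balanced-relabel H H id π id π-inj (λ _ _ → refl) φ₀ L π-bal

    vertexColor : Fin K → ℕ
    vertexColor c = sum {h} (λ i → δ (π (i ↑ˡ (h + 4))) c)

    excluded : Fin K → ℕ
    excluded c = (E c + F c) + vertexColor c

    sum-vertexColor : sum vertexColor ≡ h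
    sum-vertexColor = trans (∑-comm {K} {h} (λ c i → δ (π (i ↑ˡ (h + 4))) c))
      (trans (sum-cong-≗ {h} (λ i → sum-δ₁ (π (i ↑ˡ (h + 4))))) (trans (sum-const h 1) (*-identityʳ h)))

    -- Three colours of edges of G, at most three of neighbours in G and `h` of vertices of the copy
    -- are ruled out, and `h + 6 < 2h + 4`.
    sum-excluded : sum excluded < K
    sum-excluded = begin-strict
      sum excluded                       ≡⟨ trans (∑-distrib-+ (λ c → E c + F c) vertexColor) (cong (_+ sum vertexColor) (∑-distrib-+ E F)) ⟩
      sum E + sum F + sum vertexColor    ≤⟨ +-mono-≤ (+-mono-≤ (≤-reflexive ∑E) ∑F) (≤-reflexive sum-vertexColor) ⟩
      6 + h                              ≡⟨ +-comm 6 h ⟩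
      h + 6                              <⟨ +-monoʳ-< h (+-monoˡ-≤ 4 (≤-trans (n≤1+n 3) 4≤h)) ⟩
      h + (h + 4)                        ∎
      where open ≤-Reasoning

    c : Fin K
    c = proj₁ (zero-term excluded sum-excluded)

    c-free : excluded c ≡ 0
    c-free = proj₂ (zero-term excluded sum-excluded)

    E-c : E c ≡ 0
    E-c = m+n≡0⇒m≡0 (E c) (m+n≡0⇒m≡0 (E c + F c) c-free)

    F-c : F c ≡ 0
    F-c = m+n≡0⇒n≡0 (E c) (m+n≡0⇒m≡0 (E c + F c) c-free)

    vcol≢c : ∀ x → vcol φ x ≢ c
    vcol≢c x eq = contradiction (trans (sym (δ-refl c)) (trans (cong (λ z → δ z c) (sym eq))
      (sum≡0⇒term≡0 (λ i → δ (π (i ↑ˡ (h + 4))) c) (m+n≡0⇒n≡0 (E c + F c) c-free) (f x)))) λ ()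

    open SpokeColors E c E≤1 ∑E E-c

    spoke-row : ∀ x → sum (star φ x) ≤ 4
    spoke-row x = ≤-reflexive (trans (sum-star φ x) (cong suc (cubic x)))

    -- A colour class of `s` elements is seen by at most `2s` vertices of the copy, and
    -- `2s + 4 ≤ 2h` by `φ₀-small`. The 4 is the number of colours that a vertex itself sees in the
    -- copy.
    spoke-col : ∀ d → sum (λ x → star φ x d) + 4 ≤ h + h
    spoke-col d = begin
      sum (λ x → star φ x d) + 4
        ≡⟨ cong (_+ 4) (∑-distrib-+ (λ x → δ (vcol φ x) d) (λ x → weight (edge H x) (ecol φ x) d)) ⟩
      sum (λ x → δ (vcol φ x) d) + edgeCount H (ecol φ) d + 4
        ≤⟨ +-monoˡ-≤ 4 (+-monoˡ-≤ (edgeCount H (ecol φ) d) (m≤m+n _ (sum (λ x → δ (vcol φ x) d)))) ⟩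
      sum (λ x → δ (vcol φ x) d) + sum (λ x → δ (vcol φ x) d) + edgeCount H (ecol φ) d + 4
        ≡⟨ cong (_+ 4) (classSize-double φ d) ⟨
      classSize φ d + classSize φ d + 4
        ≡⟨ cong (λ z → z + z + 4) (classSize-φ d) ⟩
      classSize φ₀ (π⁻¹ d) + classSize φ₀ (π⁻¹ d) + 4
        ≡⟨ ring (classSize φ₀ (π⁻¹ d)) ⟩
      (classSize φ₀ (π⁻¹ d) + 2) + (classSize φ₀ (π⁻¹ d) + 2)
        ≤⟨ +-mono-≤ (φ₀-small (π⁻¹ d)) (φ₀-small (π⁻¹ d)) ⟩
      h + h ∎
      where
      open ≤-Reasoning
      ring : ∀ s → s + s + 4 ≡ (s + 2) + (s + 2)
      ring = solve-∀

    enough : h + h ≤ sum available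
    enough = ≤-reflexive (+-cancelʳ-≡ 4 _ _ (trans (+-assoc h h 4) (sym sum-available)))

    open Assignment (star φ) 4 spoke-row spoke-col

    spokes : ∃ λ (i : Injection available) → ∀ x → star φ x (proj₁ i x) ≡ 0
    spokes = assign {available} (enumerate available available≤1 (h + h) enough)

    s : Fin (h + h) → Fin K
    s = proj₁ (proj₁ spokes)

    allowed : ∀ x → star φ x (s x) ≡ 0
    allowed = proj₂ spokes

    copy : Copy H E c
    copy = record
      { φ = φ
      ; spoke = s
      ; spoke-injective = proj₁ (proj₂ (proj₁ spokes))
      ; spoke∉E = λ x → proj₁ (available⇒ (proj₂ (proj₂ (proj₁ spokes)) x))
      ; spoke≢c = λ x → proj₂ (available⇒ (proj₂ (proj₂ (proj₁ spokes)) x))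
      ; spoke≢vcol = λ x eq → contradiction (trans (sym (δ-refl (s x))) (trans (cong (λ z → δ z (s x)) eq) (m+n≡0⇒m≡0 (δ (vcol φ x) (s x)) (allowed x)))) λ ()
      ; spoke≢ecol = λ x y xy eq → contradiction
          (trans (sym (cong₂ _*_ (T⇒⟦⟧ xy) (δ-refl (s x)))) (trans (cong (λ z → edge H x y * δ z (s x)) eq)
            (sum≡0⇒term≡0 _ (m+n≡0⇒n≡0 (δ (vcol φ x) (s x)) (allowed x)) y))) λ ()
      ; vcol≢c = vcol≢c
      }

  extensible : Extensible H K
  extensible L E F L-bal E≤1 ∑E ∑F =
    let π , π-inj , π-bal = align L (classSize φ₀) L-bal φ₀-balanced
        π⁻¹ , ππ⁻¹ , _ = injective⇒inverse π π-inj
        open Aligned L E F E≤1 ∑E ∑F π π-inj π-bal π⁻¹ ππ⁻¹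
    in c , E-c , F-c , copy , balanced

large-extensible : ∀ {q} → 3 ≤ q → (H : Graph (suc q + suc q)) → Cubic H → Extensible H (suc q + (suc q + 4))
large-extensible {q} 3≤q H cubic =
  let f , f-proper , f-classes = vertex-pairs 3≤q H cubic
  in LargeCopies.extensible (s≤s 3≤q) H cubic f f-proper f-classes (equitable-edge-coloring H cubic (+-monoˡ-≤ 4 3≤q))

-- Assembling the colouring of the corona

attach-copies : {H : Graph n} → Extensible H k → ∀ N (a : Fin N → Fin N → ℕ) (E : Fin N → Fin k → ℕ) →
  (∀ i j → a i j ≡ a j i) → (∀ i → a i i ≡ 0) → (∀ i → sum (a i) ≤ 3) →
  (∀ i c → E i c ≤ 1) → (∀ i → sum (E i) ≡ 3) → (L : Fin k → ℕ) → Balanced L →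
  ∃ λ (c : Fin N → Fin k) → Σ (∀ i → Copy H (E i) (c i)) λ C →
    (∀ i → E i (c i) ≡ 0) × Proper a c × Balanced (λ d → L d + sum (λ i → classSize (Copy.φ (C i)) d))
attach-copies ext zero a E a-sym a-irr a-deg E≤1 ∑E L bal =
  (λ ()) , (λ ()) , (λ ()) , (λ ()) , λ c d → subst₂ (λ x y → x ≤ y + 1) (sym (+-identityʳ (L c))) (sym (+-identityʳ (L d))) (bal c d)
attach-copies {k = k} {H = H} ext (suc N) a E a-sym a-irr a-deg E≤1 ∑E L bal
  with attach-copies ext N (λ i j → a (suc i) (suc j)) (E ∘ suc) (λ i j → a-sym (suc i) (suc j)) (a-irr ∘ suc)
         (λ i → ≤-trans (m≤n+m _ (a (suc i) zero)) (a-deg (suc i))) (E≤1 ∘ suc) (∑E ∘ suc) L bal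
... | c , C , E-c , c-proper , bal′
  -- The vertex `zero` is treated after all others: its load includes their copies, and the role of
  -- `F` is played by the colours of its neighbours, all of them coloured by now.
  with ext (λ d → L d + sum (λ i → classSize (Copy.φ (C i)) d)) (E zero) (weight (a zero ∘ suc) c) bal′ (E≤1 zero) (∑E zero)
         (≤-trans (≤-reflexive (sum-weight (a zero ∘ suc) c)) (≤-trans (m≤n+m _ (a zero zero)) (a-deg zero)))
...   | c₀ , E-c₀ , F-c₀ , C₀ , bal₀ = c⁺ , C⁺ , E-c⁺ , c⁺-proper , λ c d → subst₂ (λ x y → x ≤ y + 1) (shuffle c) (shuffle d) (bal₀ c d)
  where
  c⁺ : Fin (suc N) → Fin k
  c⁺ zero = c₀
  c⁺ (suc i) = c i
  C⁺ : ∀ i → Copy H (E i) (c⁺ i)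
  C⁺ zero = C₀
  C⁺ (suc i) = C i
  E-c⁺ : ∀ i → E i (c⁺ i) ≡ 0
  E-c⁺ zero = E-c₀
  E-c⁺ (suc i) = E-c i
  c₀≢ : ∀ j → 1 ≤ a zero (suc j) → c₀ ≢ c j
  c₀≢ j p c≡ = <⇒≢ (*-mono-≤ p (≤-reflexive (sym (trans (cong (δ (c j)) c≡) (δ-refl (c j))))))
                  (sym (sum≡0⇒term≡0 _ F-c₀ j))
  c⁺-proper : Proper a c⁺
  c⁺-proper zero zero p = contradiction (subst (1 ≤_) (a-irr zero) p) λ ()
  c⁺-proper zero (suc j) p = c₀≢ j p
  c⁺-proper (suc i) zero p = c₀≢ i (subst (1 ≤_) (a-sym (suc i) zero) p) ∘ sym
  c⁺-proper (suc i) (suc j) p = c-proper i j p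
  shuffle : ∀ d → L d + sum (λ i → classSize (Copy.φ (C i)) d) + classSize (Copy.φ C₀) d ≡
                  L d + (classSize (Copy.φ C₀) d + sum (λ i → classSize (Copy.φ (C i)) d))
  shuffle d = trans (+-assoc (L d) _ _) (cong (L d +_) (+-comm _ (classSize (Copy.φ C₀) d)))

module Corona {N n : ℕ} (G : Graph N) (H : Graph n) where

  Vertex : Set
  Vertex = Fin N ⊎ Fin (N * n)

  copyOf : Fin (N * n) → Fin N
  copyOf p = proj₁ (remQuot {N} n p)

  at : Fin (N * n) → Fin n
  at p = proj₂ (remQuot {N} n p)

  -- `coronaAdj` on vertices that are already split, so that properness can be proved by pattern
  -- matching instead of through `splitAt`.
  adjᵛ : Vertex → Vertex → Bool
  adjᵛ (inj₁ a) (inj₁ b) = adj G a b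
  adjᵛ (inj₁ a) (inj₂ q) = a == copyOf q
  adjᵛ (inj₂ p) (inj₁ b) = copyOf p == b
  adjᵛ (inj₂ p) (inj₂ q) = (copyOf p == copyOf q) ∧ adj H (at p) (at q)

  vertex : Fin (N + N * n) → Vertex
  vertex = splitAt N

  corona-adj : ∀ u v → adj (corona G H) u v ≡ adjᵛ (vertex u) (vertex v)
  corona-adj u v with splitAt N u | splitAt N v
  ... | inj₁ a | inj₁ b = refl
  ... | inj₁ a | inj₂ q = refl
  ... | inj₂ p | inj₁ b = refl
  ... | inj₂ p | inj₂ q = refl

  vertex-injective : ∀ {u v} → vertex u ≡ vertex v → u ≡ v
  vertex-injective {u} {v} eq = trans (sym (Fin.join-splitAt N (N * n) u)) (trans (cong (Fin.join N (N * n)) eq) (Fin.join-splitAt N (N * n) v))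

  remQuot-injective : ∀ {p q} → copyOf p ≡ copyOf q → at p ≡ at q → p ≡ q
  remQuot-injective {p} {q} eq eq′ = trans (sym (Fin.combine-remQuot {N} n p)) (trans (cong₂ combine eq eq′) (Fin.combine-remQuot {N} n q))

  sum-copies : ∀ (f : Fin N → Fin n → ℕ) → sum (λ p → f (copyOf p) (at p)) ≡ sum (λ i → sum (f i))
  sum-copies f = sum-remQuot N n (λ e → f (proj₁ e) (proj₂ e))

  sum-own-copy : ∀ i (f : Fin N → Fin n → ℕ) → sum (λ p → δ i (copyOf p) * f (copyOf p) (at p)) ≡ sum (f i)
  sum-own-copy i f = begin
    sum (λ p → δ i (copyOf p) * f (copyOf p) (at p)) ≡⟨ sum-copies (λ j y → δ i j * f j y) ⟩
    sum (λ j → sum (λ y → δ i j * f j y))            ≡⟨ sum-cong-≗ (λ j → sym (*-distribˡ-sum (δ i j) (f j))) ⟩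
    sum (λ j → δ i j * sum (f j))                    ≡⟨ sum-δ i (λ j → sum (f j)) ⟩
    sum (f i) ∎
    where open ≡-Reasoning

  degᵛ : Vertex → ℕ
  degᵛ s = sum (λ v → ⟦ adjᵛ s (vertex v) ⟧)

  corona-degree : ∀ u → degree (corona G H) u ≡ degᵛ (vertex u)
  corona-degree u = trans (degree-sum (corona G H) u) (sum-cong-≗ (λ v → cong ⟦_⟧ (corona-adj u v)))

  module _ (cubicG : Cubic G) (cubicH : Cubic H) where

    degree-inner : ∀ a → degᵛ (inj₁ a) ≡ 3 + n
    degree-inner a = trans (sum-splitAt N (λ t → ⟦ adjᵛ (inj₁ a) t ⟧)) (cong₂ _+_
      (trans (sym (degree-sum G a)) (cubicG a))
      (trans (sum-cong-≗ (λ q → sym (*-identityʳ (δ a (copyOf q)))))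
        (trans (sum-own-copy a (λ _ _ → 1)) (trans (sum-const n 1) (*-identityʳ n)))))

    degree-outer : ∀ p → degᵛ (inj₂ p) ≡ 4
    degree-outer p = trans (sum-splitAt N (λ t → ⟦ adjᵛ (inj₂ p) t ⟧)) (cong₂ _+_ (sum-δ₁ (copyOf p))
      (trans (sum-cong-≗ (λ q → ⟦∧⟧ (copyOf p == copyOf q) (adj H (at p) (at q))))
        (trans (sum-own-copy (copyOf p) (λ _ y → edge H (at p) y)) (trans (sym (degree-sum H (at p))) (cubicH (at p))))))

  module Coloring {k : ℕ} (edges : EdgeColoring G k) (c : Fin N → Fin k)
    (C : ∀ i → Copy H (weight (edge G i) (EdgeColoring.color edges i)) (c i))
    (c∉E : ∀ i → weight (edge G i) (EdgeColoring.color edges i) (c i) ≡ 0) (c-proper : Proper (edge G) c) where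

    open EdgeColoring edges

    φ : Fin N → TotalColoring H k
    φ i = Copy.φ (C i)

    spoke : Fin N → Fin n → Fin k
    spoke i = Copy.spoke (C i)

    E : Fin N → Fin k → ℕ
    E i = weight (edge G i) (color i)

    color∈E : ∀ {a b} → T (adj G a b) → ∀ {d} → d ≡ color a b → E a d ≢ 0
    color∈E {a} {b} ab refl E≡0 = contradiction
      (trans (sym (cong₂ _*_ (T⇒⟦⟧ ab) (δ-refl (color a b)))) (sum≡0⇒term≡0 _ E≡0 b)) λ ()

    vcolᵛ : Vertex → Fin k
    vcolᵛ (inj₁ a) = c a
    vcolᵛ (inj₂ p) = vcol (φ (copyOf p)) (at p)

    ecolᵛ : Vertex → Vertex → Fin k
    ecolᵛ (inj₁ a) (inj₁ b) = color a b
    ecolᵛ (inj₁ a) (inj₂ q) = spoke a (at q)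
    ecolᵛ (inj₂ p) (inj₁ b) = spoke b (at p)
    ecolᵛ (inj₂ p) (inj₂ q) = ecol (φ (copyOf p)) (at p) (at q)

    same-copy : ∀ {a b : Fin N} → T (a == b) → a ≡ b
    same-copy {a} {b} = toWitness {a? = a Fin.≟ b}

    split-∧ : ∀ {a b} → T (a ∧ b) → T a × T b
    split-∧ {true} {true} _ = tt , tt

    inside : ∀ {p q} → T (adjᵛ (inj₂ p) (inj₂ q)) → copyOf p ≡ copyOf q × T (adj H (at p) (at q))
    inside {p} {q} pq = map₁ same-copy (split-∧ {copyOf p == copyOf q} pq)

    symᵛ : ∀ s t → T (adjᵛ s t) → ecolᵛ s t ≡ ecolᵛ t s
    symᵛ (inj₁ a) (inj₁ b) _ = color-sym a b
    symᵛ (inj₁ a) (inj₂ q) _ = refl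
    symᵛ (inj₂ p) (inj₁ b) _ = refl
    symᵛ (inj₂ p) (inj₂ q) pq = let i≡j , xy = inside {p} {q} pq in
      trans (ecol-sym (φ (copyOf p)) (at p) (at q) xy) (cong (λ i → ecol (φ i) (at q) (at p)) i≡j)

    vvᵛ : ∀ s t → T (adjᵛ s t) → vcolᵛ s ≢ vcolᵛ t
    vvᵛ (inj₁ a) (inj₁ b) ab = c-proper a b (≤-reflexive (sym (T⇒⟦⟧ ab)))
    vvᵛ (inj₁ a) (inj₂ q) aq eq = Copy.vcol≢c (C (copyOf q)) (at q) (trans (sym eq) (cong c (same-copy aq)))
    vvᵛ (inj₂ p) (inj₁ b) pb eq = Copy.vcol≢c (C (copyOf p)) (at p) (trans eq (cong c (sym (same-copy pb))))
    vvᵛ (inj₂ p) (inj₂ q) pq eq = let i≡j , xy = inside {p} {q} pq in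
      vv (φ (copyOf p)) (at p) (at q) xy (trans eq (cong (λ i → vcol (φ i) (at q)) (sym i≡j)))

    edge≢spoke : ∀ {a b} x → T (adj G a b) → color a b ≢ spoke a x
    edge≢spoke {a} x ab eq = color∈E ab (sym eq) (Copy.spoke∉E (C a) x)

    spoke≢inside : ∀ {b p q} → T (copyOf p == b) → T (adjᵛ (inj₂ p) (inj₂ q)) → spoke b (at p) ≢ ecol (φ (copyOf p)) (at p) (at q)
    spoke≢inside {b} {p} {q} pb pq eq = Copy.spoke≢ecol (C (copyOf p)) (at p) (at q) (proj₂ (inside {p} {q} pq))
      (trans (cong (λ i → spoke i (at p)) (same-copy pb)) eq)

    eeᵛ : ∀ s t r → T (adjᵛ s t) → T (adjᵛ s r) → t ≢ r → ecolᵛ s t ≢ ecolᵛ s r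
    eeᵛ (inj₁ a) (inj₁ b) (inj₁ b′) p q b≢b′ = color-proper a b b′ p q (b≢b′ ∘ cong inj₁)
    eeᵛ (inj₁ a) (inj₁ b) (inj₂ r) p q _ = edge≢spoke (at r) p
    eeᵛ (inj₁ a) (inj₂ r) (inj₁ b) p q _ = edge≢spoke (at r) q ∘ sym
    eeᵛ (inj₁ a) (inj₂ r) (inj₂ r′) p q r≢r′ eq = r≢r′ (cong inj₂
      (remQuot-injective (trans (sym (same-copy p)) (same-copy q)) (Copy.spoke-injective (C a) eq)))
    eeᵛ (inj₂ p) (inj₁ b) (inj₁ b′) q r b≢b′ = contradiction (cong inj₁ (trans (sym (same-copy q)) (same-copy r))) b≢b′
    eeᵛ (inj₂ p) (inj₁ b) (inj₂ q) pb pq _ = spoke≢inside {b} {p} {q} pb pq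
    eeᵛ (inj₂ p) (inj₂ q) (inj₁ b) pq pb _ = spoke≢inside {b} {p} {q} pb pq ∘ sym
    eeᵛ (inj₂ p) (inj₂ q) (inj₂ r) pq pr q≢r =
      let i≡j , xy = inside {p} {q} pq ; i≡j′ , xy′ = inside {p} {r} pr in
      ee (φ (copyOf p)) (at p) (at q) (at r) xy xy′ λ eq → q≢r (cong inj₂ (remQuot-injective (trans (sym i≡j) i≡j′) eq))

    veᵛ : ∀ s t → T (adjᵛ s t) → vcolᵛ s ≢ ecolᵛ s t
    veᵛ (inj₁ a) (inj₁ b) ab eq = color∈E ab eq (c∉E a)
    veᵛ (inj₁ a) (inj₂ q) _ eq = Copy.spoke≢c (C a) (at q) (sym eq)
    veᵛ (inj₂ p) (inj₁ b) pb eq = Copy.spoke≢vcol (C (copyOf p)) (at p)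
      (trans (cong (λ i → spoke i (at p)) (same-copy pb)) (sym eq))
    veᵛ (inj₂ p) (inj₂ q) pq = ve (φ (copyOf p)) (at p) (at q) (proj₂ (inside {p} {q} pq))

    Φ : TotalColoring (corona G H) k
    Φ = record
      { vcol = vcolᵛ ∘ vertex
      ; ecol = λ u v → ecolᵛ (vertex u) (vertex v)
      ; ecol-sym = λ u v uv → symᵛ (vertex u) (vertex v) (to u v uv)
      ; vv = λ u v uv → vvᵛ (vertex u) (vertex v) (to u v uv)
      ; ee = λ u v w uv uw v≢w → eeᵛ (vertex u) (vertex v) (vertex w) (to u v uv) (to u w uw) (v≢w ∘ vertex-injective)
      ; ve = λ u v uv → veᵛ (vertex u) (vertex v) (to u v uv)
      }
      where
      to : ∀ u v → T (adj (corona G H) u v) → T (adjᵛ (vertex u) (vertex v))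
      to u v = subst T (corona-adj u v)

    module _ (d : Fin k) where

      term : Vertex → Vertex → ℕ
      term s t = ⟦ adjᵛ s t ⟧ * δ (ecolᵛ s t) d

      spokes : Fin N → ℕ
      spokes a = sum (λ x → δ (spoke a x) d)

      row-inner : ∀ a → sum (λ v → term (inj₁ a) (vertex v)) ≡ E a d + spokes a
      row-inner a = trans (sum-splitAt N (term (inj₁ a)))
        (cong (E a d +_) (sum-own-copy a (λ _ x → δ (spoke a x) d)))

      column-inner : ∀ b → sum (λ p → term (inj₂ p) (inj₁ b)) ≡ spokes b
      column-inner b = trans (sum-cong-≗ (λ p → cong (_* δ (spoke b (at p)) d) (δ-sym (copyOf p) b)))
        (sum-own-copy b (λ _ x → δ (spoke b x) d))

      row-outer : ∀ p → sum (λ q → term (inj₂ p) (inj₂ q)) ≡ weight (edge H (at p)) (ecol (φ (copyOf p)) (at p)) d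
      row-outer p = trans
        (sum-cong-≗ (λ q → trans (cong (_* δ (ecol (φ (copyOf p)) (at p) (at q)) d) (⟦∧⟧ (copyOf p == copyOf q) (adj H (at p) (at q))))
          (*-assoc (δ (copyOf p) (copyOf q)) _ _)))
        (sum-own-copy (copyOf p) (λ _ y → edge H (at p) y * δ (ecol (φ (copyOf p)) (at p) y) d))

      vertices : sum (λ u → δ (vcol Φ u) d) ≡ sum (λ a → δ (c a) d) + sum (λ i → sum (λ x → δ (vcol (φ i) x) d))
      vertices = trans (sum-splitAt N (λ s → δ (vcolᵛ s) d))
        (cong (sum (λ a → δ (c a) d) +_) (sum-copies (λ i x → δ (vcol (φ i) x) d)))

      edgeCounts : edgeCount (corona G H) (ecol Φ) d ≡
        (edgeCount G color d + sum spokes) + (sum spokes + sum (λ i → edgeCount H (ecol (φ i)) d))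
      edgeCounts = begin
        edgeCount (corona G H) (ecol Φ) d
          ≡⟨ sum-cong-≗ (λ u → sum-cong-≗ (λ v → cong (λ z → ⟦ z ⟧ * δ (ecol Φ u v) d) (corona-adj u v))) ⟩
        sum (λ u → sum (λ v → term (vertex u) (vertex v)))
          ≡⟨ sum-splitAt N (λ s → sum (λ v → term s (vertex v))) ⟩
        sum (λ a → sum (λ v → term (inj₁ a) (vertex v))) + sum (λ p → sum (λ v → term (inj₂ p) (vertex v)))
          ≡⟨ cong₂ _+_ inner outer ⟩
        _ ∎
        where
        open ≡-Reasoning
        inner : sum (λ a → sum (λ v → term (inj₁ a) (vertex v))) ≡ edgeCount G color d + sum spokes
        inner = trans (sum-cong-≗ row-inner) (∑-distrib-+ (λ a → E a d) spokes)
        outer : sum (λ p → sum (λ v → term (inj₂ p) (vertex v))) ≡ sum spokes + sum (λ i → edgeCount H (ecol (φ i)) d)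
        outer = begin
          sum (λ p → sum (λ v → term (inj₂ p) (vertex v)))
            ≡⟨ sum-cong-≗ (λ p → sum-splitAt N (term (inj₂ p))) ⟩
          sum (λ p → sum (λ b → term (inj₂ p) (inj₁ b)) + sum (λ q → term (inj₂ p) (inj₂ q)))
            ≡⟨ ∑-distrib-+ (λ p → sum (λ b → term (inj₂ p) (inj₁ b))) (λ p → sum (λ q → term (inj₂ p) (inj₂ q))) ⟩
          sum (λ p → sum (λ b → term (inj₂ p) (inj₁ b))) + sum (λ p → sum (λ q → term (inj₂ p) (inj₂ q)))
            ≡⟨ cong₂ _+_
                 (trans (∑-comm (λ p b → term (inj₂ p) (inj₁ b))) (sum-cong-≗ column-inner))
                 (trans (sum-cong-≗ row-outer) (sum-copies (λ i x → weight (edge H x) (ecol (φ i) x) d))) ⟩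
          sum spokes + sum (λ i → edgeCount H (ecol (φ i)) d) ∎

    module _ (cubicG : Cubic G) (cubicH : Cubic H) (k≡ : k ≡ 4 + n) where

      -- A vertex of G has degree k - 1 in the corona, so it sees every colour exactly once.
      sees-once : ∀ d a → δ (c a) d + (E a d + spokes d a) ≡ 1
      sees-once d a = trans (cong (δ (c a) d +_) (sym (row-inner d a))) (trans (sym star≡) (full-sum (star Φ u) (star≤1 Φ u) enough d))
        where
        u : Fin (N + N * n)
        u = a ↑ˡ (N * n)
        u-vertex : vertex u ≡ inj₁ a
        u-vertex = Fin.splitAt-↑ˡ N a (N * n)
        enough : k ≤ sum (star Φ u)
        enough = ≤-reflexive (trans k≡ (sym (trans (sum-star Φ u) (cong suc
          (trans (corona-degree u) (trans (cong degᵛ u-vertex) (degree-inner cubicG cubicH a)))))))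
        star≡ : star Φ u d ≡ δ (c a) d + sum (λ v → term d (inj₁ a) (vertex v))
        star≡ = trans (cong (δ (vcol Φ u) d +_) (sum-cong-≗ (λ v → cong (λ z → ⟦ z ⟧ * δ (ecol Φ u v) d) (corona-adj u v))))
          (cong (λ s → δ (vcolᵛ s) d + sum (λ v → term d s (vertex v))) u-vertex)

      -- Summing `sees-once` over G yields `N`, with each edge of G counted from both ends, whereas
      -- the class contains it once. Adding `size d` on the left supplies the second count and
      -- avoids a subtraction.
      classSize-Φ : ∀ d → classSize Φ d + size d ≡ N + sum (λ i → classSize (φ i) d)
      classSize-Φ d = double-injective (begin
        (classSize Φ d + size d) + (classSize Φ d + size d)
          ≡⟨ ring₁ (classSize Φ d) (size d) ⟩
        (classSize Φ d + classSize Φ d) + (size d + size d)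
          ≡⟨ cong₂ _+_ (classSize-double Φ d) (sym (size-double d)) ⟩
        sum (λ u → δ (vcol Φ u) d) + sum (λ u → δ (vcol Φ u) d) + edgeCount (corona G H) (ecol Φ) d + GG
          ≡⟨ cong (_+ GG) (cong₂ (λ v e → v + v + e) (vertices d) (edgeCounts d)) ⟩
        (GV + HV) + (GV + HV) + ((GG + SP) + (SP + HH)) + GG
          ≡⟨ ring₂ GV HV GG SP HH ⟩
        (GV + (GG + SP)) + (GV + (GG + SP)) + (HV + HV + HH)
          ≡⟨ cong₂ (λ x y → x + x + y) around-G inside-H ⟩
        N + N + (S + S)
          ≡⟨ ring₁′ N S ⟩
        (N + S) + (N + S) ∎)
        where
        open ≡-Reasoning
        GV = sum (λ a → δ (c a) d)
        HV = sum (λ i → sum (λ x → δ (vcol (φ i) x) d))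
        GG = edgeCount G color d
        SP = sum (spokes d)
        HH = sum (λ i → edgeCount H (ecol (φ i)) d)
        S = sum (λ i → classSize (φ i) d)
        ring₁ : ∀ x y → (x + y) + (x + y) ≡ (x + x) + (y + y)
        ring₁ = solve-∀
        ring₁′ : ∀ x y → (x + x) + (y + y) ≡ (x + y) + (x + y)
        ring₁′ = solve-∀
        ring₂ : ∀ gv hv gg sp hh → (gv + hv) + (gv + hv) + ((gg + sp) + (sp + hh)) + gg ≡
          (gv + (gg + sp)) + (gv + (gg + sp)) + (hv + hv + hh)
        ring₂ = solve-∀
        around-G : GV + (GG + SP) ≡ N
        around-G = begin
          GV + (GG + SP)
            ≡⟨ cong (GV +_) (∑-distrib-+ (λ a → E a d) (spokes d)) ⟨
          GV + sum (λ a → E a d + spokes d a)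
            ≡⟨ ∑-distrib-+ (λ a → δ (c a) d) (λ a → E a d + spokes d a) ⟨
          sum (λ a → δ (c a) d + (E a d + spokes d a))
            ≡⟨ sum-cong-≗ (sees-once d) ⟩
          sum {N} (λ _ → 1)
            ≡⟨ trans (sum-const N 1) (*-identityʳ N) ⟩
          N ∎
        inside-H : HV + HV + HH ≡ S + S
        inside-H = begin
          HV + HV + HH
            ≡⟨ cong (_+ HH) (∑-distrib-+ (λ i → sum (λ x → δ (vcol (φ i) x) d)) (λ i → sum (λ x → δ (vcol (φ i) x) d))) ⟨
          sum (λ i → sum (λ x → δ (vcol (φ i) x) d) + sum (λ x → δ (vcol (φ i) x) d)) + HH
            ≡⟨ ∑-distrib-+ (λ i → sum (λ x → δ (vcol (φ i) x) d) + sum (λ x → δ (vcol (φ i) x) d)) (λ i → edgeCount H (ecol (φ i)) d) ⟨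
          sum (λ i → sum (λ x → δ (vcol (φ i) x) d) + sum (λ x → δ (vcol (φ i) x) d) + edgeCount H (ecol (φ i)) d)
            ≡⟨ sum-cong-≗ (λ i → classSize-double (φ i) d) ⟨
          sum (λ i → classSize (φ i) d + classSize (φ i) d)
            ≡⟨ ∑-distrib-+ (λ i → classSize (φ i) d) (λ i → classSize (φ i) d) ⟩
          S + S ∎

module _ {N n : ℕ} (G : Graph N) (H : Graph n) (cubicG : Cubic G) (cubicH : Cubic H) where

  open Corona G H

  corona-colorable : 4 ≤ n → Extensible H (4 + n) → HasEquitableTotalColoring (corona G H) (4 + n)
  corona-colorable 4≤n ext = fromEdges (equitable-edge-coloring G cubicG (+-monoʳ-≤ 3 4≤n))
    where
    fromEdges : EdgeColoring G (4 + n) → HasEquitableTotalColoring (corona G H) (4 + n)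
    fromEdges edges =
      let c , C , c∉E , c-proper , bal = attach-copies ext N (edge G) E (edge-sym G) (edge-irr G)
            (λ i → ≤-reflexive (trans (sym (degree-sum G i)) (cubicG i))) E≤1
            (λ i → trans (sum-weight (edge G i) (color i)) (trans (sym (degree-sum G i)) (cubicG i))) load load-balanced
      in Coloring.Φ edges c C c∉E c-proper , λ d d′ →
           subst₂ (λ x y → x ≤ y + 1) (sym (sizes c C c∉E c-proper d)) (sym (sizes c C c∉E c-proper d′)) (bal d d′)
      where
      open EdgeColoring edges
      E : Fin N → Fin (4 + n) → ℕ
      E i = weight (edge G i) (color i)
      E≤1 : ∀ i d → E i d ≤ 1
      E≤1 i = edge-colors-distinct G i (color i) (color-proper i)
      -- The edges of one colour form a matching, so `N ∸ size d` is a true difference.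
      size≤N : ∀ d → size d ≤ N
      size≤N d = ≤-trans (m≤m+n (size d) (size d)) (≤-trans (≤-reflexive (sym (size-double d))) (sum≤size (λ i → E i d) (λ i → E≤1 i d)))
      -- What G and all spokes together contribute to class `d`, known before any copy is coloured.
      load : Fin (4 + n) → ℕ
      load d = N ∸ size d
      load-balanced : Balanced load
      load-balanced d d′ = +-cancelʳ-≤ (size d) _ _ (begin
        load d + size d          ≡⟨ m∸n+n≡m (size≤N d) ⟩
        N                        ≡⟨ m∸n+n≡m (size≤N d′) ⟨
        load d′ + size d′        ≤⟨ +-monoʳ-≤ (load d′) (size-balanced d′ d) ⟩
        load d′ + (size d + 1)   ≡⟨ ring (load d′) (size d) ⟩
        load d′ + 1 + size d     ∎)
        where
        open ≤-Reasoning
        ring : ∀ x y → x + (y + 1) ≡ x + 1 + y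
        ring = solve-∀
      sizes : ∀ c C c∉E c-proper d → classSize (Coloring.Φ edges c C c∉E c-proper) d ≡
        load d + sum (λ i → classSize (Copy.φ (C i)) d)
      sizes c C c∉E c-proper d = +-cancelʳ-≡ (size d) _ _ (begin
        classSize Φ d + size d                                ≡⟨ classSize-Φ cubicG cubicH refl d ⟩
        N + S                                                 ≡⟨ cong (_+ S) (m∸n+n≡m (size≤N d)) ⟨
        load d + size d + S                                   ≡⟨ ring (load d) (size d) S ⟩
        load d + S + size d                                   ∎)
        where
        open ≡-Reasoning
        open Coloring edges c C c∉E c-proper
        S = sum (λ i → classSize (Copy.φ (C i)) d)
        ring : ∀ x y z → x + y + z ≡ x + z + y
        ring = solve-∀

  corona-Δ : 1 ≤ N → 4 ≤ n → Δ (corona G H) ≡ 3 + n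
  corona-Δ (s≤s _) 4≤n = ≤-antisym (max≤ id (λ u → ≤-trans (≤-reflexive (corona-degree u)) (deg≤ (vertex u))))
    (≤-trans (≤-reflexive (sym (trans (corona-degree zero) (degree-inner cubicG cubicH zero)))) (≤max id zero))
    where
    deg : Fin (N + N * n) → ℕ
    deg = degree (corona G H)
    deg≤ : ∀ s → degᵛ s ≤ 3 + n
    deg≤ (inj₁ a) = ≤-reflexive (degree-inner cubicG cubicH a)
    deg≤ (inj₂ p) = ≤-trans (≤-reflexive (degree-outer cubicG cubicH p)) (≤-trans 4≤n (m≤n+m n 3))
    max≤ : ∀ {m M} (g : Fin m → Fin (N + N * n)) → (∀ u → deg u ≤ M) → foldr _⊔_ 0 (map deg (tabulate g)) ≤ M
    max≤ {zero} g le = z≤n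
    max≤ {suc m} g le = ⊔-lub (le (g zero)) (max≤ (g ∘ suc) le)
    ≤max : ∀ {m} (g : Fin m → Fin (N + N * n)) → ∀ i → deg (g i) ≤ foldr _⊔_ 0 (map deg (tabulate g))
    ≤max g zero = m≤m⊔n _ _
    ≤max g (suc i) = ≤-trans (≤max (g ∘ suc) i) (m≤n⊔m (deg (g zero)) _)

  corona-lower-bound : 1 ≤ N → ∀ j → HasEquitableTotalColoring (corona G H) j → 4 + n ≤ j
  corona-lower-bound (s≤s _) j (φ , _) = ≤-trans
    (≤-reflexive (cong suc (sym (trans (corona-degree zero) (degree-inner cubicG cubicH zero))))) (degree<colors φ zero)

-- Load patterns and templates for copies on four or six vertices

above : ∀ {m} → Fin (suc m) → Fin m → ℕ
above zero _ = 1
above (suc t) zero = 0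
above (suc t) (suc i) = above t i

-- A monotone 0-1 sequence is determined by the place of its jump. A sorted block of `m` colours
-- thus has only `m + 1` load patterns, few enough to treat each one explicitly.
threshold : ∀ {m} (w : Fin m → ℕ) → (∀ i → w i ≤ 1) → (∀ i j → i Fin.≤ j → w i ≤ w j) → ∃ λ t → ∀ i → w i ≡ above t i
threshold {zero} w le mono = zero , λ ()
threshold {suc m} w le mono with w zero in eq | threshold (w ∘ suc) (le ∘ suc) (λ i j i≤j → mono (suc i) (suc j) (s≤s i≤j))
... | zero | t , t-eq = suc t , λ { zero → eq ; (suc i) → t-eq i }
... | suc z | _ = zero , λ i → ≤-antisym (le i) (≤-trans (≤-trans (s≤s z≤n) (≤-reflexive (sym eq))) (mono zero i z≤n))

bit : ∀ {z} → z ≤ 1 → ∃ λ b → z ≡ ⟦ b ⟧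
bit {zero} _ = false , refl
bit {suc zero} _ = true , refl
bit {suc (suc _)} (s≤s ())

-- The colour 0 is reserved for the vertex of G, 1-3 for the edges of G at it, and the others for
-- the spokes; within the latter two blocks the colours are sorted by their current load.
loads : Bool → Fin 4 → Fin (suc n) → Fin (4 + n) → ℕ
loads b t₁ t₂ zero = ⟦ b ⟧
loads b t₁ t₂ (suc j) = [ above t₁ , above t₂ ]′ (splitAt 3 j)

-- `spoke` is a permutation, as exactly `n` colours are left for the spokes; they are numbered from
-- 4 on. The class sizes are stored as a vector so that balance is checked by lookup.
record Template (H : Graph n) : Set where
  field
    φ : TotalColoring H (4 + n)
    spoke : Fin n → Fin n
    spoke-injective : ∀ x y → spoke x ≡ spoke y → x ≡ y
    spoke≢vcol : ∀ x → 4 ↑ʳ spoke x ≢ vcol φ x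
    spoke≢ecol : ∀ x y → T (adj H x y) → 4 ↑ʳ spoke x ≢ ecol φ x y
    vcol≢0 : ∀ x → vcol φ x ≢ zero
    sizes : Vec ℕ (4 + n)
    classSizes : ∀ c → classSize φ c ≡ lookup sizes c

Templates : Graph n → Set
Templates {n} H = ∀ b (t₁ : Fin 4) (t₂ : Fin (suc n)) →
  ∃ λ (τ : Template H) → Balanced (λ j → loads b t₁ t₂ j + lookup (Template.sizes τ) j)

module SmallCopies {n : ℕ} (4≤n : 4 ≤ n) (H₀ H : Graph n) (ρ : Fin n → Fin n) (ρ-inj : ∀ {a b} → ρ a ≡ ρ b → a ≡ b)
  (iso : ∀ x y → adj H x y ≡ adj H₀ (ρ x) (ρ y)) (templates : Templates H₀)
  (L E F : Fin (4 + n) → ℕ) (L-bal : Balanced L) (E≤1 : ∀ c → E c ≤ 1) (∑E : sum E ≡ 3) (∑F : sum F ≤ 3) where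

  -- Six excluded colours out of at least eight. The vertex colours of the copy are still open at
  -- this point; `vcol≢0` in the template keeps them away from `c`.
  center : ∃ λ c → E c + F c ≡ 0
  center = zero-term (λ c → E c + F c) (≤-<-trans (≤-trans (≤-reflexive (∑-distrib-+ E F)) (+-mono-≤ (≤-reflexive ∑E) ∑F))
    (≤-trans (n≤1+n 7) (+-monoʳ-≤ 4 4≤n)))

  c : Fin (4 + n)
  c = proj₁ center

  E-c : E c ≡ 0
  E-c = m+n≡0⇒m≡0 (E c) (proj₂ center)

  F-c : F c ≡ 0
  F-c = m+n≡0⇒n≡0 (E c) (proj₂ center)

  open SpokeColors E c E≤1 ∑E E-c

  edgeColors : ∃ λ (s : Fin 3 → Fin (4 + n)) → (∀ {x y} → s x ≡ s y → x ≡ y) × (∀ x → E (s x) ≡ 1)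
  edgeColors = enumerate E E≤1 3 (≤-reflexive (sym ∑E))

  spokeColors : ∃ λ (s : Fin n → Fin (4 + n)) → (∀ {x y} → s x ≡ s y → x ≡ y) × (∀ x → available (s x) ≡ 1)
  spokeColors = enumerate available available≤1 n (≤-reflexive (+-cancelʳ-≡ 4 n (sum available) (trans (+-comm n 4) (sym sum-available))))

  least-load : ∃ λ i → ∀ j → L i ≤ L j
  least-load = least L

  ℓ : ℕ
  ℓ = L (proj₁ least-load)

  -- A balanced load is its minimum plus a bit per colour. A common shift does not affect balance,
  -- so the bits alone select the template.
  excess : Fin (4 + n) → ℕ
  excess d = L d ∸ ℓ

  excess≤1 : ∀ d → excess d ≤ 1
  excess≤1 d = ≤-trans (∸-monoˡ-≤ ℓ (L-bal d (proj₁ least-load))) (≤-reflexive (m+n∸m≡n ℓ 1))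

  L≡ : ∀ d → L d ≡ ℓ + excess d
  L≡ d = sym (m+[n∸m]≡n (proj₂ least-load d))

  sorted : ∀ {m} {P : Fin (4 + n) → ℕ} → (∃ λ (s : Fin m → Fin (4 + n)) → (∀ {x y} → s x ≡ s y → x ≡ y) × (∀ x → P (s x) ≡ 1)) →
    ∃ λ (s : Fin m → Fin (4 + n)) → (∀ {x y} → s x ≡ s y → x ≡ y) × (∀ x → P (s x) ≡ 1) × ∃ λ t → ∀ x → excess (s x) ≡ above t x
  sorted (s , inj , good) = let g , g-inj , g-mono = sorting (excess ∘ s) in
    s ∘ g , g-inj ∘ inj , good ∘ g , threshold (excess ∘ s ∘ g) (excess≤1 ∘ s ∘ g) g-mono

  color-bit : ∃ λ b → excess c ≡ ⟦ b ⟧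
  color-bit = bit (excess≤1 c)

  module _ (m : Fin 3 → Fin (4 + n)) (m-inj : ∀ {x y} → m x ≡ m y → x ≡ y) (m-E : ∀ x → E (m x) ≡ 1)
    (t₁ : Fin 4) (m-load : ∀ x → excess (m x) ≡ above t₁ x)
    (s : Fin n → Fin (4 + n)) (s-inj : ∀ {x y} → s x ≡ s y → x ≡ y) (s-avail : ∀ x → available (s x) ≡ 1)
    (t₂ : Fin (suc n)) (s-load : ∀ x → excess (s x) ≡ above t₂ x)
    (b : Bool) (c-load : excess c ≡ ⟦ b ⟧)
    (τ : Template H₀) (τ-bal : Balanced (λ j → loads b t₁ t₂ j + lookup (Template.sizes τ) j)) where

    module τ = Template τ

    π′ : Fin 3 ⊎ Fin n → Fin (4 + n)
    π′ = [ m , s ]′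

    π : Fin (4 + n) → Fin (4 + n)
    π zero = c
    π (suc j) = π′ (splitAt 3 j)

    m≢s : ∀ i x → m i ≢ s x
    m≢s i x eq = contradiction (trans (sym (m-E i)) (trans (cong E eq) (proj₁ (available⇒ (s-avail x))))) λ ()

    π′≢c : ∀ j → π′ j ≢ c
    π′≢c (inj₁ i) eq = contradiction (trans (sym (m-E i)) (trans (cong E eq) E-c)) λ ()
    π′≢c (inj₂ x) = proj₂ (available⇒ (s-avail x))

    π′-inj : ∀ {i j} → π′ i ≡ π′ j → i ≡ j
    π′-inj {inj₁ i} {inj₁ j} eq = cong inj₁ (m-inj eq)
    π′-inj {inj₁ i} {inj₂ x} eq = contradiction eq (m≢s i x)
    π′-inj {inj₂ x} {inj₁ i} eq = contradiction (sym eq) (m≢s i x)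
    π′-inj {inj₂ x} {inj₂ y} eq = cong inj₂ (s-inj eq)

    π-inj : ∀ {a b} → π a ≡ π b → a ≡ b
    π-inj {zero} {zero} _ = refl
    π-inj {zero} {suc b} eq = contradiction (sym eq) (π′≢c (splitAt 3 b))
    π-inj {suc a} {zero} eq = contradiction eq (π′≢c (splitAt 3 a))
    π-inj {suc a} {suc b} eq = cong suc (trans (sym (Fin.join-splitAt 3 n a))
      (trans (cong (Fin.join 3 n) (π′-inj {splitAt 3 a} {splitAt 3 b} eq)) (Fin.join-splitAt 3 n b)))

    π′-load : ∀ j → excess (π′ j) ≡ [ above t₁ , above t₂ ]′ j
    π′-load (inj₁ i) = m-load i
    π′-load (inj₂ x) = s-load x

    π-load : ∀ j → excess (π j) ≡ loads b t₁ t₂ j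
    π-load zero = c-load
    π-load (suc j) = π′-load (splitAt 3 j)

    φ : TotalColoring H (4 + n)
    φ = relabel H₀ H ρ π ρ-inj π-inj iso τ.φ

    balanced : Balanced (λ d → L d + classSize φ d)
    balanced = balanced-relabel H₀ H ρ π ρ-inj π-inj iso τ.φ L λ c d → subst₂ (λ x y → x ≤ y + 1) (eq c) (eq d) (shifted c d)
      where
      eq : ∀ j → ℓ + (loads b t₁ t₂ j + lookup τ.sizes j) ≡ L (π j) + classSize τ.φ j
      eq j = trans (sym (+-assoc ℓ _ _)) (cong₂ _+_ (trans (cong (ℓ +_) (sym (π-load j))) (sym (L≡ (π j)))) (sym (τ.classSizes j)))
      shifted : Balanced (λ j → ℓ + (loads b t₁ t₂ j + lookup τ.sizes j))
      shifted c d = ≤-trans (+-monoʳ-≤ ℓ (τ-bal c d)) (≤-reflexive (sym (+-assoc ℓ _ 1)))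

    copy : Copy H E c
    copy = record
      { φ = φ
      ; spoke = λ x → s (τ.spoke (ρ x))
      ; spoke-injective = λ eq → ρ-inj (τ.spoke-injective _ _ (s-inj eq))
      ; spoke∉E = λ x → proj₁ (available⇒ (s-avail (τ.spoke (ρ x))))
      ; spoke≢c = λ x → proj₂ (available⇒ (s-avail (τ.spoke (ρ x))))
      ; spoke≢vcol = λ x eq → τ.spoke≢vcol (ρ x) (π-inj eq)
      ; spoke≢ecol = λ x y xy eq → τ.spoke≢ecol (ρ x) (ρ y) (subst T (iso x y) xy) (π-inj eq)
      ; vcol≢c = λ x eq → τ.vcol≢0 (ρ x) (π-inj {vcol τ.φ (ρ x)} {zero} eq)
      }

  extension : ∃ λ c → E c ≡ 0 × F c ≡ 0 × Σ (Copy H E c) λ C → Balanced (λ d → L d + classSize (Copy.φ C) d)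
  extension =
    let m , m-inj , m-E , t₁ , m-load = sorted {P = E} edgeColors
        s , s-inj , s-avail , t₂ , s-load = sorted {P = available} spokeColors
        b , c-load = color-bit
        τ , τ-bal = templates b t₁ t₂
    in c , E-c , F-c , copy m m-inj m-E t₁ m-load s s-inj s-avail t₂ s-load b c-load τ τ-bal ,
         balanced m m-inj m-E t₁ m-load s s-inj s-avail t₂ s-load b c-load τ τ-bal

-- Enumeration of the cubic graphs of small order

Tri : ℕ → Set
Tri zero = ⊤
Tri (suc n) = Vec Bool n × Tri n

-- A `Tri n` is the part of an adjacency matrix above the diagonal. It contains neither proofs nor
-- functions, so evaluation can run through all its values.
adjᵗ : Tri n → Fin n → Fin n → Bool
adjᵗ {suc n} (row , t) zero zero = false
adjᵗ {suc n} (row , t) zero (suc j) = lookup row j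
adjᵗ {suc n} (row , t) (suc i) zero = lookup row i
adjᵗ {suc n} (row , t) (suc i) (suc j) = adjᵗ t i j

triangle : (X : Fin n → Fin n → Bool) → Tri n
triangle {zero} X = tt
triangle {suc n} X = Vec.tabulate (X zero ∘ suc) , triangle (λ i j → X (suc i) (suc j))

adjᵗ-triangle : (X : Fin n → Fin n → Bool) → (∀ i j → X i j ≡ X j i) → (∀ i → X i i ≡ false) →
  ∀ i j → adjᵗ (triangle X) i j ≡ X i j
adjᵗ-triangle {suc n} X s irr zero zero = sym (irr zero)
adjᵗ-triangle {suc n} X s irr zero (suc j) = lookup∘tabulate (X zero ∘ suc) j
adjᵗ-triangle {suc n} X s irr (suc i) zero = trans (lookup∘tabulate (X zero ∘ suc) i) (s zero (suc i))
adjᵗ-triangle {suc n} X s irr (suc i) (suc j) = adjᵗ-triangle (λ i j → X (suc i) (suc j)) (λ i j → s (suc i) (suc j)) (irr ∘ suc) i j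

allRows : ∀ n → (Vec Bool n → Bool) → Bool
allRows zero P = P []
allRows (suc n) P = allRows n (P ∘ (true ∷_)) ∧ allRows n (P ∘ (false ∷_))

allRows-sound : ∀ n (P : Vec Bool n → Bool) → T (allRows n P) → ∀ row → T (P row)
allRows-sound zero P h [] = h
allRows-sound (suc n) P h (true ∷ row) = allRows-sound n (P ∘ (true ∷_)) (proj₁ (Equivalence.to T-∧ h)) row
allRows-sound (suc n) P h (false ∷ row) = allRows-sound n (P ∘ (false ∷_)) (proj₂ (Equivalence.to (T-∧ {allRows n (P ∘ (true ∷_))}) h)) row

-- Exhaustive search through the cubic graphs, pruned row by row: d i is the number of
-- neighbours of i among the vertices whose rows have been fixed.
allCubic : ∀ n → (Fin n → ℕ) → (Tri n → Bool) → Bool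
allCubic zero d P = P tt
allCubic (suc n) d P = allRows n λ row →
  if ⌊ d zero + sum (λ j → ⟦ lookup row j ⟧) ≟ 3 ⌋
  then allCubic n (λ i → d (suc i) + ⟦ lookup row i ⟧) (λ t → P (row , t))
  else true

allCubic-sound : ∀ n d (P : Tri n → Bool) → T (allCubic n d P) →
  ∀ t → (∀ i → d i + sum (λ j → ⟦ adjᵗ t i j ⟧) ≡ 3) → T (P t)
allCubic-sound zero d P h tt cubic = h
allCubic-sound (suc n) d P h (row , t) cubic
  with d zero + sum (λ j → ⟦ lookup row j ⟧) ≟ 3 | allRows-sound n _ h row
... | yes _ | h′ = allCubic-sound n (λ i → d (suc i) + ⟦ lookup row i ⟧) (λ t → P (row , t)) h′ t
                     λ i → trans (+-assoc (d (suc i)) _ _) (cubic (suc i))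
... | no ≢3 | _ = contradiction (cubic zero) ≢3

adjᵗ-sym : (t : Tri n) → ∀ i j → adjᵗ t i j ≡ adjᵗ t j i
adjᵗ-sym {suc n} t zero zero = refl
adjᵗ-sym {suc n} t zero (suc j) = refl
adjᵗ-sym {suc n} t (suc i) zero = refl
adjᵗ-sym {suc n} (row , t) (suc i) (suc j) = adjᵗ-sym t i j

adjᵗ-irr : (t : Tri n) → ∀ i → adjᵗ t i i ≡ false
adjᵗ-irr {suc n} t zero = refl
adjᵗ-irr {suc n} (row , t) (suc i) = adjᵗ-irr t i

graph : Tri n → Graph n
graph t = record { adj = adjᵗ t ; adj-sym = adjᵗ-sym t ; adj-irr = adjᵗ-irr t }

-- Backtracking search: the images of xs, given the images chosen so far.
embeddings : (t₀ t : Tri n) → ∀ {m} → Vec (Fin n) m → List (Fin n × Fin n) → List (Vec (Fin n) m)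
embeddings t₀ t [] chosen = [] ∷ []
embeddings t₀ t (x ∷ xs) chosen = concatMap
  (λ y → if all (λ (x′ , y′) → not (y == y′) ∧ ⌊ adjᵗ t x x′ Bool.≟ adjᵗ t₀ y y′ ⌋) chosen
         then map (y ∷_) (embeddings t₀ t xs ((x , y) ∷ chosen)) else [])
  (allFin _)

IsoVia : Tri n → Tri n → Vec (Fin n) n → Set
IsoVia t₀ t ρ = (∀ x y → adjᵗ t x y ≡ adjᵗ t₀ (lookup ρ x) (lookup ρ y)) × (∀ x y → lookup ρ x ≡ lookup ρ y → x ≡ y)

isoVia? : (t₀ t : Tri n) → ∀ ρ → Dec (IsoVia t₀ t ρ)
isoVia? t₀ t ρ = Fin.all? (λ x → Fin.all? λ y → adjᵗ t x y Bool.≟ adjᵗ t₀ (lookup ρ x) (lookup ρ y)) ×-dec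
                 Fin.all? (λ x → Fin.all? λ y → (lookup ρ x Fin.≟ lookup ρ y) →-dec (x Fin.≟ y))

-- `embeddings` merely proposes candidates. Each one is tested in full by `isoVia?`, so the
-- correctness of the backtracking is never an issue.
isomorphic? : (ts : List (Tri n)) (t : Tri n) → Dec (Any (λ t₀ → Any (IsoVia t₀ t) (embeddings t₀ t (Vec.allFin n) [])) ts)
isomorphic? {n} ts t = any? (λ t₀ → any? (isoVia? t₀ t) (embeddings t₀ t (Vec.allFin n) [])) ts

-- `checked` is a closed boolean once `n` and `ts` are given, so evaluation settles the
-- classification. `H` enters the range of that search through the triangle of its adjacency matrix.
small-extensible : ∀ {n} → 4 ≤ n → (ts : List (Tri n)) → T (allCubic n (λ _ → 0) (λ t → ⌊ isomorphic? ts t ⌋)) →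
  All (Templates ∘ graph) ts → (H : Graph n) → Cubic H → Extensible H (4 + n)
small-extensible {n} 4≤n ts checked templates H cubic =
  let templates₀ , found = All.lookupAny templates (toWitness {a? = isomorphic? ts t}
        (allCubic-sound n (λ _ → 0) (λ t → ⌊ isomorphic? ts t ⌋) checked t degrees))
      ρ , iso , ρ-inj = satisfied found
  in SmallCopies.extension 4≤n (graph _) H (lookup ρ) (ρ-inj _ _) (λ x y → trans (sym (t-adj x y)) (iso x y)) templates₀
  where
  t : Tri n
  t = triangle (adj H)
  t-adj : ∀ x y → adjᵗ t x y ≡ adj H x y
  t-adj = adjᵗ-triangle (adj H) (adj-sym H) (adj-irr H)
  degrees : ∀ i → sum (λ j → ⟦ adjᵗ t i j ⟧) ≡ 3
  degrees i = trans (sum-cong-≗ (λ j → cong ⟦_⟧ (t-adj i j))) (trans (sym (degree-sum H i)) (cubic i))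

-- Explicit colourings and their verification

module TemplateCheck (H : Graph n) (vs : Vec (Fin (4 + n)) n) (es : Vec (Vec (Fin (4 + n)) n) n)
  (spokes : Vec (Fin n) n) (sizes : Vec ℕ (4 + n)) where

  v : Fin n → Fin (4 + n)
  v = lookup vs

  e : Fin n → Fin n → Fin (4 + n)
  e x = lookup (lookup es x)

  s : Fin n → Fin (4 + n)
  s x = 4 ↑ʳ lookup spokes x

  EdgeOK : Fin n → Fin n → Set
  EdgeOK x y = e x y ≡ e y x × v x ≢ v y × v x ≢ e x y × s x ≢ e x y × (∀ z → T (adj H x z) → y ≢ z → e x y ≢ e x z)

  Valid : Set
  Valid = (∀ x y → T (adj H x y) → EdgeOK x y) × (∀ x → s x ≢ v x × v x ≢ zero) ×
    (∀ x y → lookup spokes x ≡ lookup spokes y → x ≡ y) ×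
    (∀ c → sum (λ x → δ (v x) c) + sum (λ x → sum (λ y → lt x y * (edge H x y * δ (e x y) c))) ≡ lookup sizes c)

  valid? : Dec Valid
  valid? = Fin.all? (λ x → Fin.all? λ y → T? (adj H x y) →-dec edgeOK? x y) ×-dec
    Fin.all? (λ x → ¬? (s x Fin.≟ v x) ×-dec ¬? (v x Fin.≟ zero)) ×-dec
    Fin.all? (λ x → Fin.all? λ y → (lookup spokes x Fin.≟ lookup spokes y) →-dec (x Fin.≟ y)) ×-dec
    Fin.all? (λ c → sum (λ x → δ (v x) c) + sum (λ x → sum (λ y → lt x y * (edge H x y * δ (e x y) c))) ≟ lookup sizes c)
    where
    edgeOK? : ∀ x y → Dec (EdgeOK x y)
    edgeOK? x y = (e x y Fin.≟ e y x) ×-dec ¬? (v x Fin.≟ v y) ×-dec ¬? (v x Fin.≟ e x y) ×-dec ¬? (s x Fin.≟ e x y) ×-dec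
      Fin.all? (λ z → T? (adj H x z) →-dec (¬? (y Fin.≟ z) →-dec ¬? (e x y Fin.≟ e x z)))

  template : {_ : True valid?} → Template H
  template {p} = let edges , vertices , spokes-inj , sizes-ok = toWitness {a? = valid?} p in
    fromValid edges vertices spokes-inj sizes-ok
    where
    fromValid : (∀ x y → T (adj H x y) → EdgeOK x y) → (∀ x → s x ≢ v x × v x ≢ zero) →
      (∀ x y → lookup spokes x ≡ lookup spokes y → x ≡ y) →
      (∀ c → sum (λ x → δ (v x) c) + sum (λ x → sum (λ y → lt x y * (edge H x y * δ (e x y) c))) ≡ lookup sizes c) → Template H
    fromValid edges vertices spokes-inj sizes-ok = record
      { φ = φ
      ; spoke = lookup spokes
      ; spoke-injective = spokes-inj
      ; spoke≢vcol = λ x → proj₁ (vertices x)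
      ; spoke≢ecol = λ x y xy → proj₁ (proj₂ (proj₂ (proj₂ (edges x y xy))))
      ; vcol≢0 = λ x → proj₂ (vertices x)
      ; sizes = sizes
      ; classSizes = λ c → trans (classSize-sum φ c) (sizes-ok c)
      }
      where
      φ : TotalColoring H (4 + n)
      φ = record
        { vcol = v
        ; ecol = e
        ; ecol-sym = λ x y xy → proj₁ (edges x y xy)
        ; vv = λ x y xy → proj₁ (proj₂ (edges x y xy))
        ; ee = λ x y z xy → proj₂ (proj₂ (proj₂ (proj₂ (edges x y xy)))) z
        ; ve = λ x y xy → proj₁ (proj₂ (proj₂ (edges x y xy)))
        }

open TemplateCheck using (template)

BalancedWith : ∀ {H : Graph n} → Bool → Fin 4 → Fin (suc n) → Template H → Set
BalancedWith b t₁ t₂ τ = ∀ c d → loads b t₁ t₂ c + lookup (Template.sizes τ) c ≤ loads b t₁ t₂ d + lookup (Template.sizes τ) d + 1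

covers? : {H : Graph n} (τs : List (Template H)) → ∀ b → Dec (∀ t₁ t₂ → Any (BalancedWith b t₁ t₂) τs)
covers? τs b = Fin.all? λ t₁ → Fin.all? λ t₂ → any? (λ τ → Fin.all? λ c → Fin.all? λ d →
  loads b t₁ t₂ c + lookup (Template.sizes τ) c ≤? loads b t₁ t₂ d + lookup (Template.sizes τ) d + 1) τs

templates-from : {H : Graph n} (τs : List (Template H)) → True (covers? τs false) → True (covers? τs true) → Templates H
templates-from τs p q false t₁ t₂ = satisfied (toWitness p t₁ t₂)
templates-from τs p q true t₁ t₂ = satisfied (toWitness q t₁ t₂)

K₄ : Tri 4
K₄ = (true ∷ true ∷ true ∷ []) , (true ∷ true ∷ []) , (true ∷ []) , [] , tt

K₃₃ prism : Tri 6
K₃₃ = (false ∷ false ∷ true ∷ true ∷ true ∷ []) , (false ∷ true ∷ true ∷ true ∷ []) , (true ∷ true ∷ true ∷ []) ,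
  (false ∷ false ∷ []) , (false ∷ []) , [] , tt
prism = (true ∷ true ∷ true ∷ false ∷ false ∷ []) , (true ∷ false ∷ true ∷ false ∷ []) , (false ∷ false ∷ true ∷ []) ,
  (true ∷ true ∷ []) , (true ∷ []) , [] , tt

-- Ten elements on eight colours make two classes of size two, and each entry realises one way to
-- split these among centre, edges of G and spokes. In each block the larger classes come at the
-- front, where the sorted loads are smallest. An entry `0F` on the diagonal is a filler, elsewhere
-- it is the colour 0.
K₄-colorings : List (Template (graph K₄))
K₄-colorings =
  template (graph K₄) (6F ∷ 3F ∷ 4F ∷ 5F ∷ [])
     ((0F ∷ 5F ∷ 1F ∷ 2F ∷ []) ∷
      (5F ∷ 0F ∷ 7F ∷ 4F ∷ []) ∷
      (1F ∷ 7F ∷ 0F ∷ 0F ∷ []) ∷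
      (2F ∷ 4F ∷ 0F ∷ 0F ∷ []) ∷ [])
     (0F ∷ 2F ∷ 1F ∷ 3F ∷ []) (1 ∷ 1 ∷ 1 ∷ 1 ∷ 2 ∷ 2 ∷ 1 ∷ 1 ∷ []) ∷
  template (graph K₄) (2F ∷ 4F ∷ 7F ∷ 1F ∷ [])
     ((0F ∷ 3F ∷ 4F ∷ 6F ∷ []) ∷
      (3F ∷ 0F ∷ 1F ∷ 0F ∷ []) ∷
      (4F ∷ 1F ∷ 0F ∷ 5F ∷ []) ∷
      (6F ∷ 0F ∷ 5F ∷ 0F ∷ []) ∷ [])
     (1F ∷ 3F ∷ 2F ∷ 0F ∷ []) (1 ∷ 2 ∷ 1 ∷ 1 ∷ 2 ∷ 1 ∷ 1 ∷ 1 ∷ []) ∷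
  template (graph K₄) (4F ∷ 2F ∷ 1F ∷ 3F ∷ [])
     ((0F ∷ 1F ∷ 6F ∷ 0F ∷ []) ∷
      (1F ∷ 0F ∷ 7F ∷ 5F ∷ []) ∷
      (6F ∷ 7F ∷ 0F ∷ 2F ∷ []) ∷
      (0F ∷ 5F ∷ 2F ∷ 0F ∷ []) ∷ [])
     (1F ∷ 2F ∷ 0F ∷ 3F ∷ []) (1 ∷ 2 ∷ 2 ∷ 1 ∷ 1 ∷ 1 ∷ 1 ∷ 1 ∷ []) ∷
  template (graph K₄) (2F ∷ 1F ∷ 5F ∷ 4F ∷ [])
     ((0F ∷ 6F ∷ 4F ∷ 0F ∷ []) ∷
      (6F ∷ 0F ∷ 0F ∷ 7F ∷ []) ∷
      (4F ∷ 0F ∷ 0F ∷ 3F ∷ []) ∷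
      (0F ∷ 7F ∷ 3F ∷ 0F ∷ []) ∷ [])
     (1F ∷ 0F ∷ 3F ∷ 2F ∷ []) (2 ∷ 1 ∷ 1 ∷ 1 ∷ 2 ∷ 1 ∷ 1 ∷ 1 ∷ []) ∷
  template (graph K₄) (2F ∷ 1F ∷ 5F ∷ 4F ∷ [])
     ((0F ∷ 7F ∷ 0F ∷ 1F ∷ []) ∷
      (7F ∷ 0F ∷ 6F ∷ 0F ∷ []) ∷
      (0F ∷ 6F ∷ 0F ∷ 3F ∷ []) ∷
      (1F ∷ 0F ∷ 3F ∷ 0F ∷ []) ∷ [])
     (0F ∷ 1F ∷ 3F ∷ 2F ∷ []) (2 ∷ 2 ∷ 1 ∷ 1 ∷ 1 ∷ 1 ∷ 1 ∷ 1 ∷ []) ∷ []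

K₄-templates : Templates (graph K₄)
K₄-templates = templates-from K₄-colorings tt tt

-- Fifteen elements on ten colours make five classes of size two. The centre takes none or one and
-- the edges of G none to three of them, which gives eight patterns. Matrix entries at non-edges are
-- fillers.
K₃₃-colorings : List (Template (graph K₃₃))
K₃₃-colorings =
  template (graph K₃₃) (9F ∷ 3F ∷ 5F ∷ 8F ∷ 6F ∷ 4F ∷ [])
     ((0F ∷ 0F ∷ 0F ∷ 2F ∷ 4F ∷ 8F ∷ []) ∷
      (0F ∷ 0F ∷ 0F ∷ 1F ∷ 7F ∷ 5F ∷ []) ∷
      (0F ∷ 0F ∷ 0F ∷ 6F ∷ 0F ∷ 7F ∷ []) ∷
      (2F ∷ 1F ∷ 6F ∷ 0F ∷ 0F ∷ 0F ∷ []) ∷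
      (4F ∷ 7F ∷ 0F ∷ 0F ∷ 0F ∷ 0F ∷ []) ∷
      (8F ∷ 5F ∷ 7F ∷ 0F ∷ 0F ∷ 0F ∷ []) ∷ [])
     (1F ∷ 0F ∷ 4F ∷ 3F ∷ 5F ∷ 2F ∷ []) (1 ∷ 1 ∷ 1 ∷ 1 ∷ 2 ∷ 2 ∷ 2 ∷ 2 ∷ 2 ∷ 1 ∷ []) ∷
  template (graph K₃₃) (2F ∷ 4F ∷ 6F ∷ 1F ∷ 1F ∷ 8F ∷ [])
     ((0F ∷ 0F ∷ 0F ∷ 4F ∷ 9F ∷ 6F ∷ []) ∷
      (0F ∷ 0F ∷ 0F ∷ 7F ∷ 5F ∷ 3F ∷ []) ∷
      (0F ∷ 0F ∷ 0F ∷ 5F ∷ 0F ∷ 7F ∷ []) ∷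
      (4F ∷ 7F ∷ 5F ∷ 0F ∷ 0F ∷ 0F ∷ []) ∷
      (9F ∷ 5F ∷ 0F ∷ 0F ∷ 0F ∷ 0F ∷ []) ∷
      (6F ∷ 3F ∷ 7F ∷ 0F ∷ 0F ∷ 0F ∷ []) ∷ [])
     (1F ∷ 2F ∷ 0F ∷ 4F ∷ 3F ∷ 5F ∷ []) (1 ∷ 2 ∷ 1 ∷ 1 ∷ 2 ∷ 2 ∷ 2 ∷ 2 ∷ 1 ∷ 1 ∷ []) ∷
  template (graph K₃₃) (1F ∷ 9F ∷ 1F ∷ 6F ∷ 8F ∷ 2F ∷ [])
     ((0F ∷ 0F ∷ 0F ∷ 3F ∷ 5F ∷ 0F ∷ []) ∷
      (0F ∷ 0F ∷ 0F ∷ 4F ∷ 7F ∷ 6F ∷ []) ∷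
      (0F ∷ 0F ∷ 0F ∷ 5F ∷ 2F ∷ 4F ∷ []) ∷
      (3F ∷ 4F ∷ 5F ∷ 0F ∷ 0F ∷ 0F ∷ []) ∷
      (5F ∷ 7F ∷ 2F ∷ 0F ∷ 0F ∷ 0F ∷ []) ∷
      (0F ∷ 6F ∷ 4F ∷ 0F ∷ 0F ∷ 0F ∷ []) ∷ [])
     (0F ∷ 1F ∷ 2F ∷ 3F ∷ 5F ∷ 4F ∷ []) (1 ∷ 2 ∷ 2 ∷ 1 ∷ 2 ∷ 2 ∷ 2 ∷ 1 ∷ 1 ∷ 1 ∷ []) ∷
  template (graph K₃₃) (3F ∷ 4F ∷ 7F ∷ 9F ∷ 5F ∷ 1F ∷ [])
     ((0F ∷ 0F ∷ 0F ∷ 2F ∷ 1F ∷ 4F ∷ []) ∷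
      (0F ∷ 0F ∷ 0F ∷ 6F ∷ 3F ∷ 2F ∷ []) ∷
      (0F ∷ 0F ∷ 0F ∷ 0F ∷ 8F ∷ 5F ∷ []) ∷
      (2F ∷ 6F ∷ 0F ∷ 0F ∷ 0F ∷ 0F ∷ []) ∷
      (1F ∷ 3F ∷ 8F ∷ 0F ∷ 0F ∷ 0F ∷ []) ∷
      (4F ∷ 2F ∷ 5F ∷ 0F ∷ 0F ∷ 0F ∷ []) ∷ [])
     (1F ∷ 3F ∷ 0F ∷ 4F ∷ 2F ∷ 5F ∷ []) (1 ∷ 2 ∷ 2 ∷ 2 ∷ 2 ∷ 2 ∷ 1 ∷ 1 ∷ 1 ∷ 1 ∷ []) ∷
  template (graph K₃₃) (7F ∷ 2F ∷ 1F ∷ 6F ∷ 6F ∷ 9F ∷ [])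
     ((0F ∷ 0F ∷ 0F ∷ 5F ∷ 0F ∷ 8F ∷ []) ∷
      (0F ∷ 0F ∷ 0F ∷ 4F ∷ 5F ∷ 0F ∷ []) ∷
      (0F ∷ 0F ∷ 0F ∷ 3F ∷ 4F ∷ 7F ∷ []) ∷
      (5F ∷ 4F ∷ 3F ∷ 0F ∷ 0F ∷ 0F ∷ []) ∷
      (0F ∷ 5F ∷ 4F ∷ 0F ∷ 0F ∷ 0F ∷ []) ∷
      (8F ∷ 0F ∷ 7F ∷ 0F ∷ 0F ∷ 0F ∷ []) ∷ [])
     (0F ∷ 2F ∷ 4F ∷ 3F ∷ 5F ∷ 1F ∷ []) (2 ∷ 1 ∷ 1 ∷ 1 ∷ 2 ∷ 2 ∷ 2 ∷ 2 ∷ 1 ∷ 1 ∷ []) ∷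
  template (graph K₃₃) (5F ∷ 1F ∷ 5F ∷ 4F ∷ 4F ∷ 8F ∷ [])
     ((0F ∷ 0F ∷ 0F ∷ 1F ∷ 6F ∷ 3F ∷ []) ∷
      (0F ∷ 0F ∷ 0F ∷ 0F ∷ 9F ∷ 2F ∷ []) ∷
      (0F ∷ 0F ∷ 0F ∷ 6F ∷ 7F ∷ 0F ∷ []) ∷
      (1F ∷ 0F ∷ 6F ∷ 0F ∷ 0F ∷ 0F ∷ []) ∷
      (6F ∷ 9F ∷ 7F ∷ 0F ∷ 0F ∷ 0F ∷ []) ∷
      (3F ∷ 2F ∷ 0F ∷ 0F ∷ 0F ∷ 0F ∷ []) ∷ [])
     (0F ∷ 1F ∷ 5F ∷ 3F ∷ 4F ∷ 2F ∷ []) (2 ∷ 2 ∷ 1 ∷ 1 ∷ 2 ∷ 2 ∷ 2 ∷ 1 ∷ 1 ∷ 1 ∷ []) ∷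
  template (graph K₃₃) (5F ∷ 9F ∷ 1F ∷ 7F ∷ 4F ∷ 3F ∷ [])
     ((0F ∷ 0F ∷ 0F ∷ 8F ∷ 6F ∷ 1F ∷ []) ∷
      (0F ∷ 0F ∷ 0F ∷ 2F ∷ 0F ∷ 4F ∷ []) ∷
      (0F ∷ 0F ∷ 0F ∷ 0F ∷ 2F ∷ 5F ∷ []) ∷
      (8F ∷ 2F ∷ 0F ∷ 0F ∷ 0F ∷ 0F ∷ []) ∷
      (6F ∷ 0F ∷ 2F ∷ 0F ∷ 0F ∷ 0F ∷ []) ∷
      (1F ∷ 4F ∷ 5F ∷ 0F ∷ 0F ∷ 0F ∷ []) ∷ [])
     (0F ∷ 1F ∷ 2F ∷ 5F ∷ 3F ∷ 4F ∷ []) (2 ∷ 2 ∷ 2 ∷ 1 ∷ 2 ∷ 2 ∷ 1 ∷ 1 ∷ 1 ∷ 1 ∷ []) ∷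
  template (graph K₃₃) (6F ∷ 1F ∷ 7F ∷ 4F ∷ 9F ∷ 4F ∷ [])
     ((0F ∷ 0F ∷ 0F ∷ 1F ∷ 3F ∷ 0F ∷ []) ∷
      (0F ∷ 0F ∷ 0F ∷ 0F ∷ 2F ∷ 5F ∷ []) ∷
      (0F ∷ 0F ∷ 0F ∷ 3F ∷ 8F ∷ 2F ∷ []) ∷
      (1F ∷ 0F ∷ 3F ∷ 0F ∷ 0F ∷ 0F ∷ []) ∷
      (3F ∷ 2F ∷ 8F ∷ 0F ∷ 0F ∷ 0F ∷ []) ∷
      (0F ∷ 5F ∷ 2F ∷ 0F ∷ 0F ∷ 0F ∷ []) ∷ [])
     (0F ∷ 2F ∷ 1F ∷ 4F ∷ 3F ∷ 5F ∷ []) (2 ∷ 2 ∷ 2 ∷ 2 ∷ 2 ∷ 1 ∷ 1 ∷ 1 ∷ 1 ∷ 1 ∷ []) ∷ []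

K₃₃-templates : Templates (graph K₃₃)
K₃₃-templates = templates-from K₃₃-colorings tt tt

-- The same eight size patterns as for `K₃₃`.
prism-colorings : List (Template (graph prism))
prism-colorings =
  template (graph prism) (7F ∷ 4F ∷ 8F ∷ 6F ∷ 8F ∷ 1F ∷ [])
     ((0F ∷ 5F ∷ 6F ∷ 0F ∷ 0F ∷ 0F ∷ []) ∷
      (5F ∷ 0F ∷ 3F ∷ 0F ∷ 2F ∷ 0F ∷ []) ∷
      (6F ∷ 3F ∷ 0F ∷ 0F ∷ 0F ∷ 4F ∷ []) ∷
      (0F ∷ 0F ∷ 0F ∷ 0F ∷ 7F ∷ 9F ∷ []) ∷
      (0F ∷ 2F ∷ 0F ∷ 7F ∷ 0F ∷ 5F ∷ []) ∷
      (0F ∷ 0F ∷ 4F ∷ 9F ∷ 5F ∷ 0F ∷ []) ∷ [])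
     (0F ∷ 2F ∷ 1F ∷ 4F ∷ 5F ∷ 3F ∷ []) (1 ∷ 1 ∷ 1 ∷ 1 ∷ 2 ∷ 2 ∷ 2 ∷ 2 ∷ 2 ∷ 1 ∷ []) ∷
  template (graph prism) (1F ∷ 5F ∷ 9F ∷ 4F ∷ 3F ∷ 7F ∷ [])
     ((0F ∷ 2F ∷ 5F ∷ 0F ∷ 0F ∷ 0F ∷ []) ∷
      (2F ∷ 0F ∷ 8F ∷ 0F ∷ 6F ∷ 0F ∷ []) ∷
      (5F ∷ 8F ∷ 0F ∷ 0F ∷ 0F ∷ 4F ∷ []) ∷
      (0F ∷ 0F ∷ 0F ∷ 0F ∷ 7F ∷ 6F ∷ []) ∷
      (0F ∷ 6F ∷ 0F ∷ 7F ∷ 0F ∷ 1F ∷ []) ∷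
      (0F ∷ 0F ∷ 4F ∷ 6F ∷ 1F ∷ 0F ∷ []) ∷ [])
     (0F ∷ 3F ∷ 2F ∷ 1F ∷ 4F ∷ 5F ∷ []) (1 ∷ 2 ∷ 1 ∷ 1 ∷ 2 ∷ 2 ∷ 2 ∷ 2 ∷ 1 ∷ 1 ∷ []) ∷
  template (graph prism) (9F ∷ 3F ∷ 2F ∷ 6F ∷ 8F ∷ 5F ∷ [])
     ((0F ∷ 1F ∷ 4F ∷ 0F ∷ 0F ∷ 0F ∷ []) ∷
      (1F ∷ 0F ∷ 7F ∷ 0F ∷ 6F ∷ 0F ∷ []) ∷
      (4F ∷ 7F ∷ 0F ∷ 0F ∷ 0F ∷ 1F ∷ []) ∷
      (0F ∷ 0F ∷ 0F ∷ 0F ∷ 5F ∷ 4F ∷ []) ∷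
      (0F ∷ 6F ∷ 0F ∷ 5F ∷ 0F ∷ 2F ∷ []) ∷
      (0F ∷ 0F ∷ 1F ∷ 4F ∷ 2F ∷ 0F ∷ []) ∷ [])
     (1F ∷ 0F ∷ 2F ∷ 3F ∷ 5F ∷ 4F ∷ []) (1 ∷ 2 ∷ 2 ∷ 1 ∷ 2 ∷ 2 ∷ 2 ∷ 1 ∷ 1 ∷ 1 ∷ []) ∷
  template (graph prism) (2F ∷ 3F ∷ 1F ∷ 9F ∷ 1F ∷ 7F ∷ [])
     ((0F ∷ 0F ∷ 8F ∷ 3F ∷ 0F ∷ 0F ∷ []) ∷
      (0F ∷ 0F ∷ 4F ∷ 0F ∷ 5F ∷ 0F ∷ []) ∷
      (8F ∷ 4F ∷ 0F ∷ 0F ∷ 0F ∷ 5F ∷ []) ∷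
      (3F ∷ 0F ∷ 0F ∷ 0F ∷ 6F ∷ 2F ∷ []) ∷
      (0F ∷ 5F ∷ 0F ∷ 6F ∷ 0F ∷ 4F ∷ []) ∷
      (0F ∷ 0F ∷ 5F ∷ 2F ∷ 4F ∷ 0F ∷ []) ∷ [])
     (0F ∷ 2F ∷ 3F ∷ 1F ∷ 4F ∷ 5F ∷ []) (1 ∷ 2 ∷ 2 ∷ 2 ∷ 2 ∷ 2 ∷ 1 ∷ 1 ∷ 1 ∷ 1 ∷ []) ∷
  template (graph prism) (8F ∷ 7F ∷ 4F ∷ 4F ∷ 5F ∷ 6F ∷ [])
     ((0F ∷ 0F ∷ 6F ∷ 3F ∷ 0F ∷ 0F ∷ []) ∷
      (0F ∷ 0F ∷ 5F ∷ 0F ∷ 1F ∷ 0F ∷ []) ∷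
      (6F ∷ 5F ∷ 0F ∷ 0F ∷ 0F ∷ 2F ∷ []) ∷
      (3F ∷ 0F ∷ 0F ∷ 0F ∷ 9F ∷ 0F ∷ []) ∷
      (0F ∷ 1F ∷ 0F ∷ 9F ∷ 0F ∷ 7F ∷ []) ∷
      (0F ∷ 0F ∷ 2F ∷ 0F ∷ 7F ∷ 0F ∷ []) ∷ [])
     (0F ∷ 2F ∷ 3F ∷ 1F ∷ 4F ∷ 5F ∷ []) (2 ∷ 1 ∷ 1 ∷ 1 ∷ 2 ∷ 2 ∷ 2 ∷ 2 ∷ 1 ∷ 1 ∷ []) ∷
  template (graph prism) (6F ∷ 9F ∷ 7F ∷ 3F ∷ 5F ∷ 6F ∷ [])
     ((0F ∷ 4F ∷ 2F ∷ 5F ∷ 0F ∷ 0F ∷ []) ∷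
      (4F ∷ 0F ∷ 1F ∷ 0F ∷ 0F ∷ 0F ∷ []) ∷
      (2F ∷ 1F ∷ 0F ∷ 0F ∷ 0F ∷ 8F ∷ []) ∷
      (5F ∷ 0F ∷ 0F ∷ 0F ∷ 4F ∷ 0F ∷ []) ∷
      (0F ∷ 0F ∷ 0F ∷ 4F ∷ 0F ∷ 1F ∷ []) ∷
      (0F ∷ 0F ∷ 8F ∷ 0F ∷ 1F ∷ 0F ∷ []) ∷ [])
     (3F ∷ 1F ∷ 0F ∷ 2F ∷ 4F ∷ 5F ∷ []) (2 ∷ 2 ∷ 1 ∷ 1 ∷ 2 ∷ 2 ∷ 2 ∷ 1 ∷ 1 ∷ 1 ∷ []) ∷
  template (graph prism) (1F ∷ 5F ∷ 2F ∷ 5F ∷ 4F ∷ 9F ∷ [])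
     ((0F ∷ 3F ∷ 4F ∷ 2F ∷ 0F ∷ 0F ∷ []) ∷
      (3F ∷ 0F ∷ 6F ∷ 0F ∷ 0F ∷ 0F ∷ []) ∷
      (4F ∷ 6F ∷ 0F ∷ 0F ∷ 0F ∷ 1F ∷ []) ∷
      (2F ∷ 0F ∷ 0F ∷ 0F ∷ 8F ∷ 0F ∷ []) ∷
      (0F ∷ 0F ∷ 0F ∷ 8F ∷ 0F ∷ 7F ∷ []) ∷
      (0F ∷ 0F ∷ 1F ∷ 0F ∷ 7F ∷ 0F ∷ []) ∷ [])
     (1F ∷ 0F ∷ 3F ∷ 2F ∷ 5F ∷ 4F ∷ []) (2 ∷ 2 ∷ 2 ∷ 1 ∷ 2 ∷ 2 ∷ 1 ∷ 1 ∷ 1 ∷ 1 ∷ []) ∷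
  template (graph prism) (6F ∷ 3F ∷ 2F ∷ 1F ∷ 9F ∷ 7F ∷ [])
     ((0F ∷ 0F ∷ 4F ∷ 2F ∷ 0F ∷ 0F ∷ []) ∷
      (0F ∷ 0F ∷ 5F ∷ 0F ∷ 1F ∷ 0F ∷ []) ∷
      (4F ∷ 5F ∷ 0F ∷ 0F ∷ 0F ∷ 3F ∷ []) ∷
      (2F ∷ 0F ∷ 0F ∷ 0F ∷ 4F ∷ 0F ∷ []) ∷
      (0F ∷ 1F ∷ 0F ∷ 4F ∷ 0F ∷ 8F ∷ []) ∷
      (0F ∷ 0F ∷ 3F ∷ 0F ∷ 8F ∷ 0F ∷ []) ∷ [])
     (1F ∷ 0F ∷ 2F ∷ 4F ∷ 3F ∷ 5F ∷ []) (2 ∷ 2 ∷ 2 ∷ 2 ∷ 2 ∷ 1 ∷ 1 ∷ 1 ∷ 1 ∷ 1 ∷ []) ∷ []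

prism-templates : Templates (graph prism)
prism-templates = templates-from prism-colorings tt tt

extensible₄ : (H : Graph 4) → Cubic H → Extensible H 8
extensible₄ = small-extensible ≤-refl (K₄ ∷ []) tt (K₄-templates ∷ [])

-- `K₃₃` and the prism are the only cubic graphs on six vertices; `tt` stands for the evaluated
-- enumeration that confirms it.
extensible₆ : (H : Graph 6) → Cubic H → Extensible H 10
extensible₆ = small-extensible (s≤s (s≤s (s≤s (s≤s z≤n)))) (K₃₃ ∷ prism ∷ []) tt (K₃₃-templates ∷ prism-templates ∷ [])

-- The order of a cubic graph and the conclusion

cubic-order≥4 : (H : Graph n) → Cubic H → 1 ≤ n → 4 ≤ n
-- The sum counts the closed neighbourhood of `zero`, which has four elements.
cubic-order≥4 {suc n} H cubic (s≤s _) = ≤-trans (≤-reflexive (sym total)) (sum≤size (λ w → edge H zero w + δ zero w) at-most)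
  where
  at-most : ∀ w → edge H zero w + δ zero w ≤ 1
  at-most zero = ≤-reflexive (cong (_+ 1) (edge-irr H zero))
  at-most (suc w) = ≤-trans (≤-reflexive (+-identityʳ _)) (⟦⟧≤1 (adj H zero (suc w)))
  total : sum (λ w → edge H zero w + δ zero w) ≡ 4
  total = trans (∑-distrib-+ (edge H zero) (δ zero))
    (cong₂ _+_ (trans (sym (degree-sum H zero)) (cubic zero)) (sum-δ₁ {suc n} zero))

cubic-order-even : (H : Graph n) → Cubic H → ∃ λ h → n ≡ h + h
cubic-order-even {n} H cubic with handshake H cubic
-- From `3n = 2e` follows `n = 2 (e - n)`, so half the order is `e - n`. Adding `2n` to both sides
-- keeps the calculation within the naturals.
... | e , 3n≡2e = e ∸ n , +-cancelˡ-≡ (n + n) _ _ (begin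
  n + n + n                               ≡⟨ ring₁ n ⟩
  n * 3                                   ≡⟨ 3n≡2e ⟩
  e + e                                   ≡⟨ cong₂ _+_ (m+[n∸m]≡n n≤e) (m+[n∸m]≡n n≤e) ⟨
  (n + (e ∸ n)) + (n + (e ∸ n))           ≡⟨ ring₂ n (e ∸ n) ⟩
  n + n + ((e ∸ n) + (e ∸ n))             ∎)
  where
  open ≡-Reasoning
  ring₁ : ∀ n → n + n + n ≡ n * 3
  ring₁ = solve-∀
  ring₂ : ∀ n h → (n + h) + (n + h) ≡ n + n + (h + h)
  ring₂ = solve-∀
  n≤e : n ≤ e
  n≤e = ≮⇒≥ λ e<n → <⇒≱ (+-mono-< e<n e<n) (≤-trans (m≤m+n (n + n) n) (≤-reflexive (trans (ring₁ n) 3n≡2e)))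

cubic-extensible : (H : Graph n) → Cubic H → 4 ≤ n → Extensible H (4 + n)
cubic-extensible H cubic 4≤n = let h , n≡2h = cubic-order-even H cubic in go h n≡2h H cubic 4≤n
  where
  ring : ∀ q → suc q + (suc q + 4) ≡ 4 + (suc q + suc q)
  ring = solve-∀
  go : ∀ {n} h → n ≡ h + h → (H : Graph n) → Cubic H → 4 ≤ n → Extensible H (4 + n)
  go 0 refl H cubic ()
  go 1 refl H cubic (s≤s (s≤s ()))
  go 2 refl H cubic _ = extensible₄ H cubic
  go 3 refl H cubic _ = extensible₆ H cubic
  go (suc (suc (suc (suc q)))) refl H cubic _ = subst (Extensible H) (ring (3 + q)) (large-extensible (m≤m+n 3 q) H cubic)

theorem7 : ∀ {nG nH} (G : Graph nG) (H : Graph nH) → 1 ≤ nG → 1 ≤ nH →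
    Cubic G → Cubic H →
    EqTotalChromaticNumber (corona G H) (Δ (corona G H) + 1) × (Δ (corona G H) + 1 ≡ nH + 4)
theorem7 {nG} {nH} G H 1≤nG 1≤nH cubicG cubicH =
  subst (EqTotalChromaticNumber (corona G H)) (sym colors)
    ( corona-colorable G H cubicG cubicH 4≤nH (cubic-extensible H cubicH 4≤nH)
    , corona-lower-bound G H cubicG cubicH 1≤nG)
  , trans colors (+-comm 4 nH)
  where
  4≤nH : 4 ≤ nH
  4≤nH = cubic-order≥4 H cubicH 1≤nH
  colors : Δ (corona G H) + 1 ≡ 4 + nH
  colors = trans (cong (_+ 1) (corona-Δ G H cubicG cubicH 1≤nG 4≤nH)) (+-comm (3 + nH) 1)
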